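{- Let $A\in\mathbb{Q}^{r\times n}$ be a matrix of full row rank. Then $A$ is equimodular if and only if the affine space $\{x\in\mathbb{R}^n:Ax=b\}$ is principally box-integer for all $b\in\mathbb{Q}^r$.
   Context: A rational $r\times n$ matrix is equimodular if it has full row rank (rank $r$) and all its nonzero $r\times r$ determinants have the same absolute value. A polyhedron is a set $P=\{x\in\mathbb{R}^n: Mx\le d\}$ with $M,d$ rational. A face of $P$ is a nonempty set obtained from $P$ by imposing equality in some (possibly none) of the inequalities. $P$ is integer if each of its faces contains a point of $\mathbb{Z}^n$. $P$ is box-integer if $P\cap\{x:\ell\le x\le u\}$ is integer for all $\ell,u\in\mathbb{Z}^n$. For a positive integer $k$, $kP=\{kx:x\in P\}$. $P$ is principally box-integer if $kP$ is box-integer for every positive integer $k$ such that $kP$ is integer. -}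

module Defs where

open import Algebra.Bundles using (module CommutativeRing)
open import Data.Fin.Base using (Fin; zero; suc; toℕ)
open import Data.Fin.Subset using (Subset) renaming (_∈_ to _∈ₛ_)
open import Data.Integer.Base using (ℤ; +_)
open import Data.Nat.Base as ℕ using (ℕ; zero; suc; _⊔_)
import Data.Nat.Properties as ℕ
open import Data.Product.Base using (∃; _×_; _,_)
open import Data.Rational.Base
  using (ℚ; 0ℚ; 1ℚ; ½; _+_; _*_; _-_; -_; ∣_∣; _<_; _≤_; 1/_; _/_;
         Positive; NonNegative; NonZero; positive; nonNegative)
open import Data.Rational.Properties as ℚ using (+-*-commutativeRing)
open import Data.Vec.Functional using (Vector; foldr; tail; removeAt)
open import Function.Definitions using (Injective)
open import Level using (0ℓ)
open import Relation.Binary.PropositionalEquality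
  using (_≡_; _≢_; refl; sym; trans; cong; subst; subst₂)
open import Relation.Unary using (Pred; _∩_; _≐_; Satisfiable)

open import Algebra.Properties.Semiring.Sum
  (CommutativeRing.semiring +-*-commutativeRing) using (sum)
open import Algebra.Properties.Semiring.Exp
  (CommutativeRing.semiring +-*-commutativeRing) using (_^_)

Matrix : Set → ℕ → ℕ → Set
Matrix A m n = Vector (Vector A n) m

columns : ∀ {m n k} → (Fin k → Fin n) → Matrix ℚ m n → Matrix ℚ m k
columns f A i j = A i (f j)

-- Laplace expansion along the first row.
det : ∀ {n} → Matrix ℚ n n → ℚ
det {zero}  A = 1ℚ
det {suc n} A =
  sum (λ j → (- 1ℚ) ^ toℕ j * A zero j * det (λ i → removeAt (tail A i) j))

FullRowRank : ∀ {r n} → Matrix ℚ r n → Set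
FullRowRank {r} A =
  (c : Vector ℚ r) → (∀ j → sum (λ i → c i * A i j) ≡ 0ℚ) → ∀ i → c i ≡ 0ℚ

-- An r × r submatrix is given by r distinct columns.  They may be listed in
-- any order, which affects only the sign of the determinant.
Equimodular : ∀ {r n} → Matrix ℚ r n → Set
Equimodular {r} {n} A = FullRowRank A ×
  ((f g : Fin r → Fin n) → Injective _≡_ _≡_ f → Injective _≡_ _≡_ g →
   det (columns f A) ≢ 0ℚ → det (columns g A) ≢ 0ℚ →
   ∣ det (columns f A) ∣ ≡ ∣ det (columns g A) ∣)

-- The real numbers, as Cauchy sequences of rationals under the setoid
-- equality _≈_.  Only the rational vector space structure and the order are
-- needed, since all matrices are rational.

IsCauchy : (ℕ → ℚ) → Set
IsCauchy s = ∀ ε → 0ℚ < ε →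
  ∃ λ N → ∀ m n → N ℕ.≤ m → N ℕ.≤ n → ∣ s m - s n ∣ < ε

record ℝ : Set where
  constructor mkℝ
  field
    seq    : ℕ → ℚ
    cauchy : IsCauchy seq

open ℝ public

infix 4 _≤ᵣ_ _≈_

_≤ᵣ_ : ℝ → ℝ → Set
x ≤ᵣ y = ∀ ε → 0ℚ < ε → ∃ λ N → ∀ n → N ℕ.≤ n → seq x n ≤ seq y n + ε

_≈_ : ℝ → ℝ → Set
x ≈ y = x ≤ᵣ y × y ≤ᵣ x

fromℚ : ℚ → ℝ
fromℚ q = mkℝ (λ _ → q) λ ε 0<ε →
  0 , λ _ _ _ _ → subst (_< ε) (sym (cong ∣_∣ (ℚ.+-inverseʳ q))) 0<ε

fromℤ : ℤ → ℝ
fromℤ z = fromℚ (z / 1)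

private
  open import Data.Rational.Solver using (module +-*-Solver)
  open +-*-Solver

  ½+½ : ∀ ε → ε * ½ + ε * ½ ≡ ε
  ½+½ ε = trans (sym (ℚ.*-distribˡ-+ ε ½ ½)) (ℚ.*-identityʳ ε)

  0<½* : ∀ ε → 0ℚ < ε → 0ℚ < ε * ½
  0<½* ε 0<ε = subst (_< ε * ½) (ℚ.*-zeroˡ ½) (ℚ.*-monoˡ-<-pos ½ 0<ε)

  +-cauchy : ∀ s t → IsCauchy s → IsCauchy t → IsCauchy (λ n → s n + t n)
  +-cauchy s t cs ct ε 0<ε with cs (ε * ½) (0<½* ε 0<ε) | ct (ε * ½) (0<½* ε 0<ε)
  ... | N₁ , p | N₂ , q = N₁ ⊔ N₂ , λ m n N≤m N≤n → begin-strict
    ∣ (s m + t m) - (s n + t n) ∣      ≡⟨ cong ∣_∣ (rearrange (s m) (t m) (s n) (t n)) ⟩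
    ∣ (s m - s n) + (t m - t n) ∣      ≤⟨ ℚ.∣p+q∣≤∣p∣+∣q∣ (s m - s n) (t m - t n) ⟩
    ∣ s m - s n ∣ + ∣ t m - t n ∣      <⟨ ℚ.+-mono-<
      (p m n (ℕ.m⊔n≤o⇒m≤o N₁ N₂ N≤m) (ℕ.m⊔n≤o⇒m≤o N₁ N₂ N≤n))
      (q m n (ℕ.m⊔n≤o⇒n≤o N₁ N₂ N≤m) (ℕ.m⊔n≤o⇒n≤o N₁ N₂ N≤n)) ⟩
    ε * ½ + ε * ½                      ≡⟨ ½+½ ε ⟩
    ε                                  ∎
    where
    open ℚ.≤-Reasoning
    rearrange : ∀ a b c d → (a + b) - (c + d) ≡ (a - c) + (b - d)
    rearrange = solve 4 (λ a b c d → (a :+ b) :- (c :+ d) := (a :- c) :+ (b :- d)) refl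

  *-cauchy : ∀ q s → IsCauchy s → IsCauchy (λ n → q * s n)
  *-cauchy q s cs ε 0<ε with cs δ 0<δ
    where
    instance
      c-pos : Positive (∣ q ∣ + 1ℚ)
      c-pos = ℚ.nonNeg+pos⇒pos ∣ q ∣ {{ℚ.∣-∣-nonNeg q}} 1ℚ
      c-nz : NonZero (∣ q ∣ + 1ℚ)
      c-nz = ℚ.pos⇒nonZero (∣ q ∣ + 1ℚ)
      1/c-pos : Positive (1/ (∣ q ∣ + 1ℚ))
      1/c-pos = ℚ.1/pos⇒pos (∣ q ∣ + 1ℚ)
    δ : ℚ
    δ = ε * 1/ (∣ q ∣ + 1ℚ)
    0<δ : 0ℚ < δ
    0<δ = subst (_< δ) (ℚ.*-zeroˡ (1/ (∣ q ∣ + 1ℚ))) (ℚ.*-monoˡ-<-pos (1/ (∣ q ∣ + 1ℚ)) 0<ε)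
  ... | N , p = N , λ m n N≤m N≤n → begin-strict
    ∣ q * s m - q * s n ∣              ≡⟨ cong ∣_∣ (factor q (s m) (s n)) ⟩
    ∣ q * (s m - s n) ∣                ≡⟨ ℚ.∣p*q∣≡∣p∣*∣q∣ q (s m - s n) ⟩
    ∣ q ∣ * ∣ s m - s n ∣              ≤⟨ ℚ.*-monoʳ-≤-nonNeg ∣ s m - s n ∣ {{ℚ.∣-∣-nonNeg (s m - s n)}} ∣q∣≤c ⟩
    (∣ q ∣ + 1ℚ) * ∣ s m - s n ∣       <⟨ ℚ.*-monoʳ-<-pos (∣ q ∣ + 1ℚ) (p m n N≤m N≤n) ⟩
    (∣ q ∣ + 1ℚ) * (ε * 1/ (∣ q ∣ + 1ℚ)) ≡⟨ swap (∣ q ∣ + 1ℚ) ε (1/ (∣ q ∣ + 1ℚ)) ⟩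
    ε * ((∣ q ∣ + 1ℚ) * 1/ (∣ q ∣ + 1ℚ)) ≡⟨ cong (ε *_) (ℚ.*-inverseʳ (∣ q ∣ + 1ℚ)) ⟩
    ε * 1ℚ                             ≡⟨ ℚ.*-identityʳ ε ⟩
    ε                                  ∎
    where
    open ℚ.≤-Reasoning
    instance
      c-pos : Positive (∣ q ∣ + 1ℚ)
      c-pos = ℚ.nonNeg+pos⇒pos ∣ q ∣ {{ℚ.∣-∣-nonNeg q}} 1ℚ
      c-nz : NonZero (∣ q ∣ + 1ℚ)
      c-nz = ℚ.pos⇒nonZero (∣ q ∣ + 1ℚ)
    ∣q∣≤c : ∣ q ∣ ≤ ∣ q ∣ + 1ℚ
    ∣q∣≤c = subst (_≤ ∣ q ∣ + 1ℚ) (ℚ.+-identityʳ ∣ q ∣)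
              (ℚ.+-monoʳ-≤ ∣ q ∣ (ℚ.nonNegative⁻¹ 1ℚ))
    factor : ∀ a b c → a * b - a * c ≡ a * (b - c)
    factor = solve 3 (λ a b c → a :* b :- a :* c := a :* (b :- c)) refl
    swap : ∀ a b c → a * (b * c) ≡ b * (a * c)
    swap = solve 3 (λ a b c → a :* (b :* c) := b :* (a :* c)) refl

infixl 6 _+ᵣ_
infixl 7 _·_

_+ᵣ_ : ℝ → ℝ → ℝ
x +ᵣ y = mkℝ (λ n → seq x n + seq y n) (+-cauchy (seq x) (seq y) (cauchy x) (cauchy y))

_·_ : ℚ → ℝ → ℝ
q · x = mkℝ (λ n → q * seq x n) (*-cauchy q (seq x) (cauchy x))

sumᵣ : ∀ {n} → Vector ℝ n → ℝ
sumᵣ = foldr _+ᵣ_ (fromℚ 0ℚ)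

_*ᵥ_ : ∀ {m n} → Matrix ℚ m n → Vector ℝ n → Vector ℝ m
(M *ᵥ x) i = sumᵣ (λ j → M i j · x j)

affineSpace : ∀ {r n} → Matrix ℚ r n → Vector ℚ r → Pred (Vector ℝ n) 0ℓ
affineSpace A b x = ∀ i → (A *ᵥ x) i ≈ fromℚ (b i)

solutions : ∀ {m n} → Matrix ℚ m n → Vector ℚ m → Pred (Vector ℝ n) 0ℓ
solutions M d x = ∀ i → (M *ᵥ x) i ≤ᵣ fromℚ (d i)

IsPolyhedron : ∀ {n} → Pred (Vector ℝ n) 0ℓ → Set
IsPolyhedron {n} P =
  ∃ λ m → ∃ λ (M : Matrix ℚ m n) → ∃ λ (d : Vector ℚ m) → P ≐ solutions M d

-- The system Mx ≤ d describing P is existentially quantified, so F may come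
-- from any such system and being a face is a property of the sets P and F.
IsFace : ∀ {n} → Pred (Vector ℝ n) 0ℓ → Pred (Vector ℝ n) 0ℓ → Set
IsFace {n} P F = Satisfiable F ×
  ∃ λ m → ∃ λ (M : Matrix ℚ m n) → ∃ λ (d : Vector ℚ m) → ∃ λ (I : Subset m) →
    P ≐ solutions M d ×
    F ≐ (P ∩ λ x → ∀ i → i ∈ₛ I → (M *ᵥ x) i ≈ fromℚ (d i))

IsInteger : ∀ {n} → Pred (Vector ℝ n) 0ℓ → Set₁
IsInteger {n} P = IsPolyhedron P ×
  (∀ F → IsFace P F → ∃ λ (z : Vector ℤ n) → F (λ j → fromℤ (z j)))

Box : ∀ {n} → Vector ℤ n → Vector ℤ n → Pred (Vector ℝ n) 0ℓ
Box ℓ u x = ∀ j → fromℤ (ℓ j) ≤ᵣ x j × x j ≤ᵣ fromℤ (u j)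

BoxInteger : ∀ {n} → Pred (Vector ℝ n) 0ℓ → Set₁
BoxInteger {n} P = (ℓ u : Vector ℤ n) → IsInteger (P ∩ Box ℓ u)

dilate : ∀ {n} → ℕ → Pred (Vector ℝ n) 0ℓ → Pred (Vector ℝ n) 0ℓ
dilate k P y = ∃ λ x → P x × (∀ j → y j ≈ (+ k / 1) · x j)

PrincipallyBoxInteger : ∀ {n} → Pred (Vector ℝ n) 0ℓ → Set₁
PrincipallyBoxInteger P =
  (k : ℕ) → 0 ℕ.< k → IsInteger (dilate k P) → BoxInteger (dilate k P)

{-# OPTIONS --safe #-}
-- If A is equimodular and Az = b with z integral, every point x of a face of
-- {Ax = b} ∩ [ℓ, u] can be rounded inside that face.  Keep a column basis of A
-- and the tableau A_B⁻¹A, whose entries are 0 and ±1 by Cramer's rule.  A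
-- nonbasic variable that is not integral is moved, together with the basic
-- variables, until one of the moving variables reaches an integer; then it is
-- integral or can be exchanged with an integral basic variable.  Once all
-- nonbasic variables are integral, so are the basic ones.  The resulting w is
-- tight wherever x is, hence it lies in every face that contains x.  The walk
-- needs case distinctions on reals and is carried out under a double negation,
-- which is removed because only finitely many integer points are candidates.
--
-- Conversely, a box that pins all coordinates outside a basis to 0 shows that
-- A_B⁻¹Az is integral for every integral z.  Hence any two bases differ by an
-- integer matrix with an integer inverse, so their determinants agree up to sign.
module Submission where

open import Defs
open import Algebra.Bundles using (module CommutativeRing)
open import Data.Fin.Base using (Fin; zero; suc; toℕ; fromℕ<; punchIn; splitAt; join; _↑ˡ_; _↑ʳ_)
open import Data.Fin.Properties as Fin using (any?)
open import Data.Fin.Subset using (⊥) renaming (_∈_ to _∈ₛ_)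
open import Data.Fin.Subset.Properties using (∉⊥; _∈?_)
open import Data.Integer.Base as ℤ using (ℤ; -[1+_])
import Data.Integer.Properties as ℤ
import Data.Nat.Coprimality as Coprime
open import Data.Nat.Base as ℕ using (ℕ; zero; suc)
import Data.Nat.Properties as ℕ
open import Data.Product.Base using (Σ; ∃; _×_; _,_; proj₁; proj₂)
open import Data.Rational.Base
  using (ℚ; mkℚ; 0ℚ; 1ℚ; ½; _+_; _*_; _-_; -_; ∣_∣; 1/_; _/_; _≤_; _<_; *≤*; ↥_; ↧_;
         ≢-nonZero; nonNegative; positive)
open import Data.Rational.Properties as ℚ using (+-*-commutativeRing)
open import Data.Rational.Solver using (module +-*-Solver)
open import Data.Sum.Base using (_⊎_; inj₁; inj₂)
open import Data.Unit.Base using (⊤; tt)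
open import Data.Vec.Functional
  using (Vector; []; _∷_; _++_; tail; removeAt; insertAt; updateAt)
open import Data.Vec.Functional.Properties
  using (updateAt-updates; updateAt-minimal; lookup-++ˡ; lookup-++ʳ)
open import Function.Base using (_∘_; const)
open import Function.Bundles using (_⇔_; mk⇔)
open import Function.Definitions using (Injective)
open import Level using (0ℓ)
open import Relation.Binary.PropositionalEquality
open import Relation.Nullary using (¬_; Dec; yes; no; ¬?; contradiction)
open import Relation.Nullary.Decidable
  using (decidable-stable; map′; _×-dec_; _→-dec_; ¬¬-excluded-middle)
open import Relation.Unary using (Pred; _∩_; _≐_; Satisfiable)

open import Algebra.Properties.Semiring.Sum (CommutativeRing.semiring +-*-commutativeRing)
  using (sum; sum-cong-≗; sum-replicate-zero; ∑-distrib-+; ∑-comm; *-distribˡ-sum; *-distribʳ-sum)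
open import Algebra.Properties.Semiring.Exp (CommutativeRing.semiring +-*-commutativeRing)
  using (_^_)
open +-*-Solver using (solve; con; _:=_; _:+_; _:*_; _:-_; :-_)

-- The walk ends because being basic or integral is never lost: a move preserves integers, and a
-- basic variable is only exchanged out once it is integral. So a single pass over the coordinates
-- suffices. Subtracting `z` is what makes the last step work: `A` maps the rounded point minus `z`
-- to zero, so a tableau row expresses a basic coordinate through nonbasic ones with no constant
-- term to control.
--
-- A face may be cut out by any system that describes the polyhedron, so its tight rows cannot be
-- matched with the bounds of the box. They are reached through segments instead: a linear
-- inequality that is tight at an inner point of a segment inside the polyhedron is tight along all
-- of it. It remains to prolong the segment from `w` beyond `x` inside the box, which is possible
-- because `w` respects every integer bound that `x` respects.
--
-- All facts about determinants come from one principle: an alternating form in the rows is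
-- determined by its value at the identity. This gives multiplicativity, and Cramer's rule follows
-- by evaluating a product with a modified identity matrix.

private
  variable
    m n p q r : ℕ
    w x y z x′ y′ : ℝ

-- Determinants

infix 4 _≋_

_≋_ : Matrix ℚ m n → Matrix ℚ m n → Set
M ≋ N = ∀ i → M i ≗ N i

sum-zero : (v : Vector ℚ n) → (∀ i → v i ≡ 0ℚ) → sum v ≡ 0ℚ
sum-zero {n} v v≡0 = trans (sum-cong-≗ v≡0) (sum-replicate-zero n)

sum-linear : ∀ a b (u v : Vector ℚ n) →
  sum (λ i → a * u i + b * v i) ≡ a * sum u + b * sum v
sum-linear a b u v = trans (∑-distrib-+ (λ i → a * u i) (λ i → b * v i))
  (sym (cong₂ _+_ (*-distribˡ-sum a u) (*-distribˡ-sum b v)))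

-- Recursion, instead of a decision whether `i` equals `j`, makes the first row, the first column
-- and the remaining block of the identity matrix reduce by computation.
δ : Matrix ℚ n n
δ zero    zero    = 1ℚ
δ zero    (suc _) = 0ℚ
δ (suc _) zero    = 0ℚ
δ (suc i) (suc j) = δ i j

δ-sym : (i j : Fin n) → δ i j ≡ δ j i
δ-sym zero    zero    = refl
δ-sym zero    (suc _) = refl
δ-sym (suc _) zero    = refl
δ-sym (suc i) (suc j) = δ-sym i j

δ-refl : (i : Fin n) → δ i i ≡ 1ℚ
δ-refl zero    = refl
δ-refl (suc i) = δ-refl i

δ-≢ : {i j : Fin n} → i ≢ j → δ i j ≡ 0ℚ
δ-≢ {i = zero}  {zero}  i≢j with () ← i≢j refl
δ-≢ {i = zero}  {suc _} _   = refl
δ-≢ {i = suc _} {zero}  _   = refl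
δ-≢ {i = suc i} {suc j} i≢j = δ-≢ (i≢j ∘ cong suc)

sum-δˡ : ∀ i (v : Vector ℚ n) → sum (λ k → δ i k * v k) ≡ v i
sum-δˡ zero v = trans
  (cong₂ _+_ (ℚ.*-identityˡ (v zero)) (sum-zero _ λ k → ℚ.*-zeroˡ (v (suc k))))
  (ℚ.+-identityʳ (v zero))
sum-δˡ (suc i) v = trans
  (cong₂ _+_ (ℚ.*-zeroˡ (v zero)) (sum-δˡ i (tail v)))
  (ℚ.+-identityˡ (v (suc i)))

sum-δʳ : ∀ i (v : Vector ℚ n) → sum (λ k → v k * δ k i) ≡ v i
sum-δʳ i v = trans
  (sum-cong-≗ λ k → trans (ℚ.*-comm (v k) (δ k i)) (cong (_* v k) (δ-sym k i)))
  (sum-δˡ i v)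

infixl 7 _✶_

_✶_ : Matrix ℚ m n → Matrix ℚ n p → Matrix ℚ m p
(M ✶ N) i k = sum (λ j → M i j * N j k)

✶-congˡ : {M M′ : Matrix ℚ m n} (N : Matrix ℚ n p) → M ≋ M′ → M ✶ N ≋ M′ ✶ N
✶-congˡ N M≋M′ i k = sum-cong-≗ λ j → cong (_* N j k) (M≋M′ i j)

✶-congʳ : (M : Matrix ℚ m n) {N N′ : Matrix ℚ n p} → N ≋ N′ → M ✶ N ≋ M ✶ N′
✶-congʳ M N≋N′ i k = sum-cong-≗ λ j → cong (M i j *_) (N≋N′ j k)

✶-assoc : (L : Matrix ℚ m n) (M : Matrix ℚ n p) (N : Matrix ℚ p q) →
  (L ✶ M) ✶ N ≋ L ✶ (M ✶ N)
✶-assoc L M N i l = begin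
  sum (λ k → sum (λ j → L i j * M j k) * N k l)
    ≡⟨ sum-cong-≗ (λ k → *-distribʳ-sum (N k l) (λ j → L i j * M j k)) ⟩
  sum (λ k → sum (λ j → L i j * M j k * N k l))
    ≡⟨ ∑-comm (λ k j → L i j * M j k * N k l) ⟩
  sum (λ j → sum (λ k → L i j * M j k * N k l))
    ≡⟨ sum-cong-≗ (λ j → sum-cong-≗ λ k → ℚ.*-assoc (L i j) (M j k) (N k l)) ⟩
  sum (λ j → sum (λ k → L i j * (M j k * N k l)))
    ≡⟨ sum-cong-≗ (λ j → *-distribˡ-sum (L i j) (λ k → M j k * N k l)) ⟨
  sum (λ j → L i j * sum (λ k → M j k * N k l)) ∎
  where open ≡-Reasoning

✶-identityˡ : (M : Matrix ℚ m n) → δ ✶ M ≋ M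
✶-identityˡ M i k = sum-δˡ i (λ j → M j k)

-- Matrices are functions, so a form on matrices must be known to respect pointwise equality before
-- rows can be rewritten inside it.
Extensional : (Matrix ℚ n m → ℚ) → Set
Extensional Φ = ∀ {M N} → M ≋ N → Φ M ≡ Φ N

LinearInFirstRow : (Matrix ℚ (suc n) m → ℚ) → Set
LinearInFirstRow Φ = ∀ a b x y T →
  Φ ((λ j → a * x j + b * y j) ∷ T) ≡ a * Φ (x ∷ T) + b * Φ (y ∷ T)

VanishesOnEqualFirstRows : (Matrix ℚ (suc n) m → ℚ) → Set
VanishesOnEqualFirstRows {zero}  Φ = ⊤
VanishesOnEqualFirstRows {suc n} Φ = ∀ v T → Φ (v ∷ v ∷ T) ≡ 0ℚ

-- Only the first two rows are constrained directly. Fixing the first row and recursing yields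
-- linearity in every row and vanishing on equal adjacent rows, and closure properties become
-- inductions on the number of rows.
Alternating : ∀ n → (Matrix ℚ n m → ℚ) → Set
Alternating zero    Φ = ⊤
Alternating (suc n) Φ =
  LinearInFirstRow Φ × VanishesOnEqualFirstRows Φ ×
  (∀ v → Alternating n (λ T → Φ (v ∷ T)))

∷-cong : {v w : Vector ℚ m} {S T : Matrix ℚ n m} → v ≗ w → S ≋ T → (v ∷ S) ≋ (w ∷ T)
∷-cong v≗w S≋T zero    = v≗w
∷-cong v≗w S≋T (suc i) = S≋T i

≋-refl : {M : Matrix ℚ m n} → M ≋ M
≋-refl _ _ = refl

∷-ext : (Φ : Matrix ℚ (suc n) m → ℚ) → Extensional Φ → ∀ v → Extensional (λ T → Φ (v ∷ T))
∷-ext Φ ext v S≋T = ext (∷-cong (λ _ → refl) S≋T)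

private
  scale-linear : ∀ c a b x y → c * (a * x + b * y) ≡ a * (c * x) + b * (c * y)
  scale-linear = solve 5
    (λ c a b x y → c :* (a :* x :+ b :* y) := a :* (c :* x) :+ b :* (c :* y)) refl

alternating-cong : ∀ n {Φ Ψ : Matrix ℚ n m → ℚ} → Φ ≗ Ψ → Alternating n Φ → Alternating n Ψ
alternating-cong zero    Φ≗Ψ _ = tt
alternating-cong (suc n) {Φ} {Ψ} Φ≗Ψ (lin , van , alt) =
  (λ a b x y T → trans (sym (Φ≗Ψ _)) (trans (lin a b x y T)
    (cong₂ (λ s t → a * s + b * t) (Φ≗Ψ _) (Φ≗Ψ _)))) ,
  vanish n Φ≗Ψ van ,
  (λ v → alternating-cong n (λ T → Φ≗Ψ (v ∷ T)) (alt v))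
  where
  vanish : ∀ n {Φ Ψ : Matrix ℚ (suc n) m → ℚ} → Φ ≗ Ψ →
    VanishesOnEqualFirstRows Φ → VanishesOnEqualFirstRows Ψ
  vanish zero    _   _   = tt
  vanish (suc n) Φ≗Ψ van v T = trans (sym (Φ≗Ψ _)) (van v T)

alternating-scale : ∀ n c (Φ : Matrix ℚ n m → ℚ) → Alternating n Φ →
  Alternating n (λ M → c * Φ M)
alternating-scale zero    c Φ _ = tt
alternating-scale (suc n) c Φ (lin , van , alt) =
  (λ a b x y T → trans (cong (c *_) (lin a b x y T)) (scale-linear c a b _ _)) ,
  vanish n Φ van ,
  (λ v → alternating-scale n c _ (alt v))
  where
  vanish : ∀ n (Φ : Matrix ℚ (suc n) m → ℚ) → VanishesOnEqualFirstRows Φ →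
    VanishesOnEqualFirstRows (λ M → c * Φ M)
  vanish zero    Φ _   = tt
  vanish (suc n) Φ van v T = trans (cong (c *_) (van v T)) (ℚ.*-zeroʳ c)

alternating-sum : ∀ n (Φ : Fin p → Matrix ℚ n m → ℚ) → (∀ j → Alternating n (Φ j)) →
  Alternating n (λ M → sum (λ j → Φ j M))
alternating-sum zero    Φ _   = tt
alternating-sum (suc n) Φ alt =
  (λ a b x y T → trans (sum-cong-≗ λ j → proj₁ (alt j) a b x y T)
    (sum-linear a b (λ j → Φ j (x ∷ T)) (λ j → Φ j (y ∷ T)))) ,
  vanish n Φ (λ j → proj₁ (proj₂ (alt j))) ,
  (λ v → alternating-sum n _ (λ j → proj₂ (proj₂ (alt j)) v))
  where
  vanish : ∀ n (Φ : Fin p → Matrix ℚ (suc n) m → ℚ) → (∀ j → VanishesOnEqualFirstRows (Φ j)) →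
    VanishesOnEqualFirstRows (λ M → sum (λ j → Φ j M))
  vanish zero    Φ _   = tt
  vanish (suc n) Φ van v T = sum-zero _ (λ j → van j v T)

record LinearMap (f : Vector ℚ m → Vector ℚ n) : Set where
  field
    cong-≗ : ∀ {x y} → x ≗ y → f x ≗ f y
    linear : ∀ a b x y → f (λ j → a * x j + b * y j) ≗ λ j → a * f x j + b * f y j

open LinearMap

-- Covers the three row-wise maps that occur: deleting a column, inserting a zero column and
-- multiplying by a matrix on the right.
alternating-map : ∀ n {f : Vector ℚ m → Vector ℚ p} → LinearMap f →
  (Φ : Matrix ℚ n p → ℚ) → Extensional Φ → Alternating n Φ →
  Alternating n (λ M → Φ (λ i → f (M i)))
alternating-map zero    F Φ ext _ = tt
alternating-map (suc n) {f} F Φ ext (lin , van , alt) =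
  (λ a b x y T → begin
    Φ (λ i → f (((λ j → a * x j + b * y j) ∷ T) i))
      ≡⟨ ext (λ { zero → linear F a b x y ; (suc i) _ → refl }) ⟩
    Φ ((λ j → a * f x j + b * f y j) ∷ (λ i → f (T i)))
      ≡⟨ lin a b (f x) (f y) (λ i → f (T i)) ⟩
    a * Φ (f x ∷ (λ i → f (T i))) + b * Φ (f y ∷ (λ i → f (T i)))
      ≡⟨ cong₂ (λ s t → a * s + b * t) (map-∷ x T) (map-∷ y T) ⟩
    a * Φ (λ i → f ((x ∷ T) i)) + b * Φ (λ i → f ((y ∷ T) i)) ∎) ,
  vanish n Φ ext van ,
  (λ v → alternating-cong n (map-∷ v)
    (alternating-map n F (λ T → Φ (f v ∷ T)) (∷-ext Φ ext (f v)) (alt (f v))))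
  where
  open ≡-Reasoning
  map-∷ : ∀ v T → Φ (f v ∷ (λ i → f (T i))) ≡ Φ (λ i → f ((v ∷ T) i))
  map-∷ v T = ext (λ { zero _ → refl ; (suc i) _ → refl })
  vanish : ∀ n (Φ : Matrix ℚ (suc n) _ → ℚ) → Extensional Φ → VanishesOnEqualFirstRows Φ →
    VanishesOnEqualFirstRows (λ M → Φ (λ i → f (M i)))
  vanish zero    Φ _   _   = tt
  vanish (suc n) Φ ext van v T = trans
    (ext (λ { zero _ → refl ; (suc zero) _ → refl ; (suc (suc i)) _ → refl }))
    (van (f v) (λ i → f (T i)))

sgn : Fin n → ℚ
sgn j = (- 1ℚ) ^ toℕ j

det-ext : ∀ n → Extensional (det {n})
det-ext zero    _   = refl
det-ext (suc n) M≋N = sum-cong-≗ λ j → cong₂ (λ a d → sgn j * a * d) (M≋N zero j)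
  (det-ext n (λ i k → M≋N (suc i) (punchIn j k)))

-- Removing columns j and then k is the same as removing them in the other
-- order, and the two signs are opposite, so the terms cancel in pairs.
laplace₂-vanishes : ∀ n (a : Vector ℚ (suc (suc n))) (G : (Fin n → Fin (suc (suc n))) → ℚ) →
  (∀ {φ ψ} → φ ≗ ψ → G φ ≡ G ψ) →
  sum (λ j → sum (λ k →
    sgn j * a j * (sgn k * a (punchIn j k) * G (punchIn j ∘ punchIn k)))) ≡ 0ℚ
laplace₂-vanishes n a G G-cong = begin
  sum (term zero) + sum (λ j → term (suc j) zero + sum (λ k → term (suc j) (suc k)))
    ≡⟨ cong (sum (term zero) +_) (∑-distrib-+ (λ j → term (suc j) zero) (λ j → sum (λ k → term (suc j) (suc k)))) ⟩
  sum (term zero) + (sum (λ j → term (suc j) zero) + sum (λ j → sum (λ k → term (suc j) (suc k))))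
    ≡⟨ ℚ.+-assoc (sum (term zero)) _ _ ⟨
  sum (term zero) + sum (λ j → term (suc j) zero) + sum (λ j → sum (λ k → term (suc j) (suc k)))
    ≡⟨ cong₂ _+_ (trans (sym (∑-distrib-+ (term zero) (λ j → term (suc j) zero))) (sum-zero (λ k → term zero k + term (suc k) zero) cancel)) (inner n a G G-cong) ⟩
  0ℚ + 0ℚ
    ≡⟨ ℚ.+-identityʳ 0ℚ ⟩
  0ℚ ∎
  where
  open ≡-Reasoning
  term : Fin (suc (suc n)) → Fin (suc n) → ℚ
  term j k = sgn j * a j * (sgn k * a (punchIn j k) * G (punchIn j ∘ punchIn k))
  cancel : ∀ k → term zero k + term (suc k) zero ≡ 0ℚ
  cancel k = solve 4
    (λ s x y g → con 1ℚ :* x :* (s :* y :* g) :+ (:- con 1ℚ :* s) :* y :* (con 1ℚ :* x :* g) := con 0ℚ)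
    refl (sgn k) (a zero) (a (suc k)) (G (suc ∘ punchIn k))
  -- The terms in which neither removed column is the first: both signs flip, so their product is
  -- unchanged, and the sum for `tail a` remains, with `lift` keeping the first column in place.
  inner : ∀ n (a : Vector ℚ (suc (suc n))) (G : (Fin n → Fin (suc (suc n))) → ℚ) →
    (∀ {φ ψ} → φ ≗ ψ → G φ ≡ G ψ) →
    sum (λ j → sum (λ k → sgn (suc j) * a (suc j) *
      (sgn (suc k) * a (suc (punchIn j k)) * G (punchIn (suc j) ∘ punchIn (suc k))))) ≡ 0ℚ
  inner zero    a G _      = refl
  inner (suc n) a G G-cong = trans
    (sum-cong-≗ λ j → sum-cong-≗ λ k → trans
      (solve 5 (λ s x t y g → (:- con 1ℚ :* s) :* x :* ((:- con 1ℚ :* t) :* y :* g) :=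
                              s :* x :* (t :* y :* g))
        refl (sgn j) (a (suc j)) (sgn k) (a (suc (punchIn j k))) (G (punchIn (suc j) ∘ punchIn (suc k))))
      (cong (λ g → sgn j * a (suc j) * (sgn k * a (suc (punchIn j k)) * g))
        (G-cong {punchIn (suc j) ∘ punchIn (suc k)} {lift (punchIn j ∘ punchIn k)}
          λ { zero → refl ; (suc l) → refl })))
    (laplace₂-vanishes n (tail a) (λ φ → G (lift φ))
      (λ φ≗ψ → G-cong λ { zero → refl ; (suc l) → cong suc (φ≗ψ l) }))
    where
    lift : (Fin n → Fin (suc (suc n))) → Fin (suc n) → Fin (suc (suc (suc n)))
    lift φ zero    = zero
    lift φ (suc l) = suc (φ l)

private
  linearˡ : ∀ s a b x y d → s * (a * x + b * y) * d ≡ a * (s * x * d) + b * (s * y * d)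
  linearˡ = solve 6 (λ s a b x y d →
    s :* (a :* x :+ b :* y) :* d := a :* (s :* x :* d) :+ b :* (s :* y :* d)) refl

det-alternating : ∀ n → Alternating n (det {n})
det-alternating zero    = tt
det-alternating (suc n) =
  (λ a b x y T → trans
    (sum-cong-≗ λ j → linearˡ (sgn j) a b (x j) (y j) (det (λ i → removeAt (T i) j)))
    (sum-linear a b (λ j → sgn j * x j * det (λ i → removeAt (T i) j))
                    (λ j → sgn j * y j * det (λ i → removeAt (T i) j)))) ,
  vanish n ,
  (λ v → alternating-sum n _ λ j → alternating-scale n (sgn j * v j) _
    (alternating-map n {f = λ x → removeAt x j}
      (record { cong-≗ = λ x≗y k → x≗y (punchIn j k) ; linear = λ _ _ _ _ _ → refl })
      det (det-ext n) (det-alternating n)))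
  where
  vanish : ∀ n → VanishesOnEqualFirstRows (det {suc n})
  vanish zero    = tt
  vanish (suc n) v T = trans
    (sum-cong-≗ λ j → *-distribˡ-sum (sgn j * v j)
      (λ k → sgn k * v (punchIn j k) * det (λ i → removeAt (removeAt (T i) j) k)))
    (laplace₂-vanishes n v (λ φ → det (λ i → T i ∘ φ))
      (λ φ≗ψ → det-ext n (λ i l → cong (T i) (φ≗ψ l))))

module _ (Φ : Matrix ℚ (suc n) m → ℚ) (ext : Extensional Φ) (lin : LinearInFirstRow Φ) where

  first-row-zero : ∀ v T → (∀ j → v j ≡ 0ℚ) → Φ (v ∷ T) ≡ 0ℚ
  first-row-zero v T v≡0 = begin
    Φ (v ∷ T)
      ≡⟨ ext (∷-cong (λ j → trans (v≡0 j) (sym (zeros (v j)))) ≋-refl) ⟩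
    Φ ((λ j → 0ℚ * v j + 0ℚ * v j) ∷ T)
      ≡⟨ lin 0ℚ 0ℚ v v T ⟩
    0ℚ * Φ (v ∷ T) + 0ℚ * Φ (v ∷ T)
      ≡⟨ zeros (Φ (v ∷ T)) ⟩
    0ℚ ∎
    where
    open ≡-Reasoning
    zeros : ∀ x → 0ℚ * x + 0ℚ * x ≡ 0ℚ
    zeros = solve 1 (λ x → con 0ℚ :* x :+ con 0ℚ :* x := con 0ℚ) refl

  first-row-sum : ∀ {p} (c : Vector ℚ p) (V : Matrix ℚ p m) T →
    Φ ((λ j → sum (λ k → c k * V k j)) ∷ T) ≡ sum (λ k → c k * Φ (V k ∷ T))
  first-row-sum {zero}  c V T = first-row-zero _ T (λ _ → refl)
  first-row-sum {suc p} c V T = begin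
    Φ ((λ j → c zero * V zero j + sum (λ k → c (suc k) * V (suc k) j)) ∷ T)
      ≡⟨ ext (∷-cong (λ j → cong (c zero * V zero j +_) (sym (ℚ.*-identityˡ _))) ≋-refl) ⟩
    Φ ((λ j → c zero * V zero j + 1ℚ * sum (λ k → c (suc k) * V (suc k) j)) ∷ T)
      ≡⟨ lin (c zero) 1ℚ (V zero) _ T ⟩
    c zero * Φ (V zero ∷ T) + 1ℚ * Φ ((λ j → sum (λ k → c (suc k) * V (suc k) j)) ∷ T)
      ≡⟨ cong (c zero * Φ (V zero ∷ T) +_)
           (trans (ℚ.*-identityˡ _) (first-row-sum (tail c) (tail V) T)) ⟩
    c zero * Φ (V zero ∷ T) + sum (λ k → c (suc k) * Φ (V (suc k) ∷ T)) ∎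
    where open ≡-Reasoning

-- Polarisation: `Φ` vanishes when both rows are `u+v`, and of the four terms of the bilinear
-- expansion only the two mixed ones survive.
swap-first-rows : (Φ : Matrix ℚ (suc (suc n)) m → ℚ) → Extensional Φ → Alternating (suc (suc n)) Φ →
  ∀ u v T → Φ (u ∷ v ∷ T) ≡ - Φ (v ∷ u ∷ T)
swap-first-rows Φ ext (lin , van , alt) u v T = begin
  Φ (u ∷ v ∷ T)
    ≡⟨ solve 2 (λ x y → x := (con 1ℚ :* (con 1ℚ :* con 0ℚ :+ con 1ℚ :* x) :+
         con 1ℚ :* (con 1ℚ :* y :+ con 1ℚ :* con 0ℚ)) :- y) refl _ (Φ (v ∷ u ∷ T)) ⟩
  (1ℚ * (1ℚ * 0ℚ + 1ℚ * Φ (u ∷ v ∷ T)) + 1ℚ * (1ℚ * Φ (v ∷ u ∷ T) + 1ℚ * 0ℚ)) - Φ (v ∷ u ∷ T)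
    ≡⟨ cong (_- Φ (v ∷ u ∷ T)) expand ⟨
  Φ (u+v ∷ u+v ∷ T) - Φ (v ∷ u ∷ T)
    ≡⟨ cong (_- Φ (v ∷ u ∷ T)) (van u+v T) ⟩
  0ℚ - Φ (v ∷ u ∷ T)
    ≡⟨ ℚ.+-identityˡ _ ⟩
  - Φ (v ∷ u ∷ T) ∎
  where
  open ≡-Reasoning
  u+v : Vector ℚ _
  u+v j = 1ℚ * u j + 1ℚ * v j
  expand : Φ (u+v ∷ u+v ∷ T) ≡
    1ℚ * (1ℚ * 0ℚ + 1ℚ * Φ (u ∷ v ∷ T)) + 1ℚ * (1ℚ * Φ (v ∷ u ∷ T) + 1ℚ * 0ℚ)
  expand = trans (lin 1ℚ 1ℚ u v (u+v ∷ T)) (cong₂ (λ s t → 1ℚ * s + 1ℚ * t)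
    (trans (proj₁ (alt u) 1ℚ 1ℚ u v T) (cong (λ z → 1ℚ * z + 1ℚ * Φ (u ∷ v ∷ T)) (van u T)))
    (trans (proj₁ (alt v) 1ℚ 1ℚ u v T) (cong (λ z → 1ℚ * Φ (v ∷ u ∷ T) + 1ℚ * z) (van v T))))

move-row-first : ∀ n (Φ : Matrix ℚ (suc n) m → ℚ) → Extensional Φ → Alternating (suc n) Φ →
  ∀ V j → Φ (V j ∷ removeAt V j) ≡ sgn j * Φ V
move-row-first n Φ ext alt V zero = trans
  (ext (λ { zero _ → refl ; (suc i) _ → refl }))
  (sym (ℚ.*-identityˡ (Φ V)))
move-row-first (suc n) Φ ext alt V (suc j) = begin
  Φ (V (suc j) ∷ removeAt V (suc j))
    ≡⟨ ext (λ { zero _ → refl ; (suc zero) _ → refl ; (suc (suc i)) _ → refl }) ⟩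
  Φ (V (suc j) ∷ V zero ∷ removeAt (tail V) j)
    ≡⟨ swap-first-rows Φ ext alt (V (suc j)) (V zero) _ ⟩
  - Φ (V zero ∷ V (suc j) ∷ removeAt (tail V) j)
    ≡⟨ cong -_ (move-row-first n _ (∷-ext Φ ext (V zero)) (proj₂ (proj₂ alt) (V zero)) (tail V) j) ⟩
  - (sgn j * Φ (V zero ∷ tail V))
    ≡⟨ cong (λ x → - (sgn j * x)) (ext (λ { zero _ → refl ; (suc i) _ → refl })) ⟩
  - (sgn j * Φ V)
    ≡⟨ solve 2 (λ s x → :- (s :* x) := (:- con 1ℚ :* s) :* x) refl (sgn j) (Φ V) ⟩
  sgn (suc j) * Φ V ∎
  where open ≡-Reasoning

sgn-square : (j : Fin n) → sgn j * sgn j ≡ 1ℚ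
sgn-square zero    = refl
sgn-square (suc j) = trans
  (solve 1 (λ s → (:- con 1ℚ :* s) :* (:- con 1ℚ :* s) := s :* s) refl (sgn j))
  (sgn-square j)

-- Only adjacent equal rows are covered by `Alternating`, so the copy of `v` is first carried up to
-- the second place; `sgn-square` cancels the sign this costs.
vanishes-on-repeated-row : ∀ n (Φ : Matrix ℚ (suc n) m → ℚ) → Extensional Φ →
  Alternating (suc n) Φ → ∀ v T k → T k ≗ v → Φ (v ∷ T) ≡ 0ℚ
vanishes-on-repeated-row (suc n) Φ ext alt v T k Tk≗v = begin
  Φ (v ∷ T)
    ≡⟨ ℚ.*-identityˡ _ ⟨
  1ℚ * Φ (v ∷ T)
    ≡⟨ cong (_* Φ (v ∷ T)) (sgn-square k) ⟨
  sgn k * sgn k * Φ (v ∷ T)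
    ≡⟨ ℚ.*-assoc (sgn k) (sgn k) _ ⟩
  sgn k * (sgn k * Φ (v ∷ T))
    ≡⟨ cong (sgn k *_) (move-row-first n _ (∷-ext Φ ext v) (proj₂ (proj₂ alt) v) T k) ⟨
  sgn k * Φ (v ∷ T k ∷ removeAt T k)
    ≡⟨ cong (sgn k *_) (ext (∷-cong (λ _ → refl) (∷-cong Tk≗v ≋-refl))) ⟩
  sgn k * Φ (v ∷ v ∷ removeAt T k)
    ≡⟨ cong (sgn k *_) (proj₁ (proj₂ alt) v _) ⟩
  sgn k * 0ℚ
    ≡⟨ ℚ.*-zeroʳ (sgn k) ⟩
  0ℚ ∎
  where open ≡-Reasoning

-- In the application `e` is a row held fixed outside `Θ`, which is why `Θ` vanishes once one of its
-- own rows equals `e`. Linearity then removes the multiples of `e` row by row.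
add-multiples : ∀ n (Θ : Matrix ℚ n m → ℚ) → Extensional Θ → Alternating n Θ →
  ∀ e → (∀ T k → T k ≗ e → Θ T ≡ 0ℚ) →
  ∀ T (t : Vector ℚ n) → Θ (λ i j → T i j + t i * e j) ≡ Θ T
add-multiples zero    Θ ext alt e van T t = ext (λ ())
add-multiples (suc n) Θ ext (lin , _ , alt) e van T t = begin
  Θ (λ i j → T i j + t i * e j)
    ≡⟨ ext (λ { zero j → cong (_+ t zero * e j) (sym (ℚ.*-identityˡ (T zero j)))
              ; (suc i) _ → refl }) ⟩
  Θ ((λ j → 1ℚ * T zero j + t zero * e j) ∷ T′)
    ≡⟨ lin 1ℚ (t zero) (T zero) e T′ ⟩
  1ℚ * Θ (T zero ∷ T′) + t zero * Θ (e ∷ T′)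
    ≡⟨ cong (λ z → 1ℚ * Θ (T zero ∷ T′) + t zero * z) (van (e ∷ T′) zero (λ _ → refl)) ⟩
  1ℚ * Θ (T zero ∷ T′) + t zero * 0ℚ
    ≡⟨ solve 2 (λ x y → con 1ℚ :* x :+ y :* con 0ℚ := x) refl _ (t zero) ⟩
  Θ (T zero ∷ T′)
    ≡⟨ add-multiples n _ (∷-ext Θ ext (T zero)) (alt (T zero)) e
         (λ S k → van (T zero ∷ S) (suc k)) (tail T) (tail t) ⟩
  Θ (T zero ∷ tail T)
    ≡⟨ ext (λ { zero _ → refl ; (suc i) _ → refl }) ⟩
  Θ T ∎
  where
  open ≡-Reasoning
  T′ : Matrix ℚ n _
  T′ i j = T (suc i) j + t (suc i) * e j

-- Splits off coordinate `k`, so that `add-multiples` can clear column `k` by means of the row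
-- `δ k`.
insert-remove : (v : Vector ℚ (suc n)) → ∀ k j →
  insertAt (removeAt v k) k 0ℚ j + v k * δ k j ≡ v j
insert-remove v zero zero = trans (ℚ.+-identityˡ _) (ℚ.*-identityʳ _)
insert-remove v zero (suc j) = trans (cong (v (suc j) +_) (ℚ.*-zeroʳ (v zero))) (ℚ.+-identityʳ _)
insert-remove {suc n} v (suc k) zero = trans (cong (v zero +_) (ℚ.*-zeroʳ (v (suc k)))) (ℚ.+-identityʳ _)
insert-remove {suc n} v (suc k) (suc j) = insert-remove (tail v) k j

insert-linear : (k : Fin (suc n)) → LinearMap {n} (λ v → insertAt v k 0ℚ)
insert-linear k = record { cong-≗ = cg k ; linear = lin k }
  where
  cg : (k : Fin (suc n)) {x y : Vector ℚ n} → x ≗ y → insertAt x k 0ℚ ≗ insertAt y k 0ℚ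
  cg zero x≗y zero = refl
  cg zero x≗y (suc j) = x≗y j
  cg {suc n} (suc k) x≗y zero = x≗y zero
  cg {suc n} (suc k) x≗y (suc j) = cg k (x≗y ∘ suc) j
  lin : (k : Fin (suc n)) → ∀ a b (x y : Vector ℚ n) →
    insertAt (λ j → a * x j + b * y j) k 0ℚ ≗ λ j → a * insertAt x k 0ℚ j + b * insertAt y k 0ℚ j
  lin zero a b x y zero = solve 2 (λ a b → con 0ℚ := a :* con 0ℚ :+ b :* con 0ℚ) refl a b
  lin zero a b x y (suc j) = refl
  lin {suc n} (suc k) a b x y zero = refl
  lin {suc n} (suc k) a b x y (suc j) = lin k a b (tail x) (tail y) j

insert-δ : (k : Fin (suc n)) (i : Fin n) → insertAt (δ i) k 0ℚ ≗ δ (punchIn k i)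
insert-δ zero i zero = refl
insert-δ zero i (suc j) = refl
insert-δ (suc k) zero zero = refl
insert-δ {suc n} (suc k) zero (suc j) = zeros k j
  where
  zeros : ∀ {n} (k j : Fin (suc n)) → insertAt (λ (_ : Fin n) → 0ℚ) k 0ℚ j ≡ 0ℚ
  zeros zero zero = refl
  zeros zero (suc j) = refl
  zeros {suc n} (suc k) zero = refl
  zeros {suc n} (suc k) (suc j) = zeros k j
insert-δ (suc k) (suc i) zero = refl
insert-δ (suc k) (suc i) (suc j) = insert-δ k i j

-- Expanding the first row of M in the standard basis and clearing the
-- corresponding column reproduces the Laplace expansion that defines det.
alternating-unique : ∀ n (Φ : Matrix ℚ n n → ℚ) → Extensional Φ → Alternating n Φ →
  ∀ M → Φ M ≡ det M * Φ δ
alternating-unique zero    Φ ext alt M = trans (ext (λ ())) (sym (ℚ.*-identityˡ _))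
alternating-unique (suc n) Φ ext alt@(lin , van , alt′) M = begin
  Φ M
    ≡⟨ ext (λ { zero j → sym (sum-δʳ j (M zero)) ; (suc i) _ → refl }) ⟩
  Φ ((λ j → sum (λ k → M zero k * δ k j)) ∷ tail M)
    ≡⟨ first-row-sum Φ ext lin (M zero) δ (tail M) ⟩
  sum (λ k → M zero k * Φ (δ k ∷ tail M))
    ≡⟨ sum-cong-≗ (λ k → trans (cong (M zero k *_) (expand k))
         (rearrange (M zero k) (det (minor k)) (sgn k) (Φ δ))) ⟩
  sum (λ k → sgn k * M zero k * det (minor k) * Φ δ)
    ≡⟨ *-distribʳ-sum (Φ δ) (λ k → sgn k * M zero k * det (minor k)) ⟨
  det M * Φ δ ∎
  where
  open ≡-Reasoning
  minor : Fin (suc n) → Matrix ℚ n n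
  minor k i = removeAt (tail M i) k
  rearrange : ∀ a d s x → a * (d * (s * x)) ≡ s * a * d * x
  rearrange = solve 4 (λ a d s x → a :* (d :* (s :* x)) := s :* a :* d :* x) refl
  Ψ : Fin (suc n) → Matrix ℚ n n → ℚ
  Ψ k N = Φ (δ k ∷ (λ i → insertAt (N i) k 0ℚ))
  expand : ∀ k → Φ (δ k ∷ tail M) ≡ det (minor k) * (sgn k * Φ δ)
  expand k = begin
    Φ (δ k ∷ tail M)
      ≡⟨ ext (∷-cong (λ _ → refl) (λ i j → insert-remove (tail M i) k j)) ⟨
    Φ (δ k ∷ (λ i j → insertAt (minor k i) k 0ℚ j + tail M i k * δ k j))
      ≡⟨ add-multiples n _ (∷-ext Φ ext (δ k)) (alt′ (δ k)) (δ k)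
           (vanishes-on-repeated-row n Φ ext alt (δ k)) (λ i → insertAt (minor k i) k 0ℚ) (λ i → tail M i k) ⟩
    Ψ k (minor k)
      ≡⟨ alternating-unique n (Ψ k)
           (λ S≋T → ext (∷-cong (λ _ → refl) (λ i → cong-≗ (insert-linear k) (S≋T i))))
           (alternating-map n (insert-linear k) _ (∷-ext Φ ext (δ k)) (alt′ (δ k)))
           (minor k) ⟩
    det (minor k) * Ψ k δ
      ≡⟨ cong (det (minor k) *_) (ext (∷-cong (λ _ → refl) (insert-δ k))) ⟩
    det (minor k) * Φ (δ k ∷ removeAt δ k)
      ≡⟨ cong (det (minor k) *_) (move-row-first n Φ ext alt δ k) ⟩
    det (minor k) * (sgn k * Φ δ) ∎

-- For fixed `N` the left side is an alternating form in the rows of `M`, hence `det M` times its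
-- value at the identity.
det-✶ : (M N : Matrix ℚ n n) → det (M ✶ N) ≡ det M * det N
det-✶ {n} M N = trans
  (alternating-unique n (λ L → det (L ✶ N))
    (λ L≋L′ → det-ext n (✶-congˡ N L≋L′))
    (alternating-map n (record
      { cong-≗ = λ x≗y k → sum-cong-≗ λ j → cong (_* N j k) (x≗y j)
      ; linear = λ a b x y k → trans
          (sum-cong-≗ λ j → distrib a b (x j) (y j) (N j k))
          (sum-linear a b (λ j → x j * N j k) (λ j → y j * N j k)) })
      det (det-ext n) (det-alternating n))
    M)
  (cong (det M *_) (det-ext n (✶-identityˡ N)))
  where
  distrib : ∀ a b x y z → (a * x + b * y) * z ≡ a * (x * z) + b * (y * z)
  distrib = solve 5 (λ a b x y z → (a :* x :+ b :* y) :* z := a :* (x :* z) :+ b :* (y :* z)) refl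

det-first-row : (M : Matrix ℚ (suc n) (suc n)) → (∀ j → M zero (suc j) ≡ 0ℚ) →
  det M ≡ M zero zero * det (λ i j → M (suc i) (suc j))
det-first-row {n} M M₀≡0 = trans
  (cong₂ _+_ (cong (_* det (λ i j → M (suc i) (suc j))) (ℚ.*-identityˡ (M zero zero)))
    (sum-zero (λ j → sgn (suc j) * M zero (suc j) * minor j)
      λ j → trans (cong (λ a → sgn (suc j) * a * minor j) (M₀≡0 j)) (zeros (sgn (suc j)) (minor j))))
  (ℚ.+-identityʳ _)
  where
  minor : Fin n → ℚ
  minor j = det (λ i → removeAt (tail M i) (suc j))
  zeros : ∀ s d → s * 0ℚ * d ≡ 0ℚ
  zeros = solve 2 (λ s d → s :* con 0ℚ :* d := con 0ℚ) refl

det-zero-first-column : (M : Matrix ℚ (suc n) (suc n)) → (∀ i → M i zero ≡ 0ℚ) → det M ≡ 0ℚ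
det-zero-first-column {n} M M≡0 = trans
  (cong₂ _+_ (trans (cong (λ a → 1ℚ * a * det (λ i j → M (suc i) (suc j))) (M≡0 zero)) (zeros 1ℚ (det (λ i j → M (suc i) (suc j)))))
    (sum-zero (λ j → sgn (suc j) * M zero (suc j) * det (λ i → removeAt (tail M i) (suc j))) (terms n M M≡0)))
  (ℚ.+-identityʳ 0ℚ)
  where
  zeros : ∀ s d → s * 0ℚ * d ≡ 0ℚ
  zeros = solve 2 (λ s d → s :* con 0ℚ :* d := con 0ℚ) refl
  terms : ∀ n (M : Matrix ℚ (suc n) (suc n)) → (∀ i → M i zero ≡ 0ℚ) → (j : Fin n) →
    sgn (suc j) * M zero (suc j) * det (λ i → removeAt (tail M i) (suc j)) ≡ 0ℚ
  terms (suc n) M M≡0 j = trans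
    (cong (sgn (suc j) * M zero (suc j) *_) (det-zero-first-column (λ i → removeAt (tail M i) (suc j)) (λ i → M≡0 (suc i))))
    (ℚ.*-zeroʳ (sgn (suc j) * M zero (suc j)))

-- The expansion still runs along the first row: every minor but the first retains the lower part of
-- the first column, which is zero.
det-first-column : (M : Matrix ℚ (suc n) (suc n)) → (∀ i → M (suc i) zero ≡ 0ℚ) →
  det M ≡ M zero zero * det (λ i j → M (suc i) (suc j))
det-first-column {n} M M≡0 = trans
  (cong₂ _+_ (cong (_* det (λ i j → M (suc i) (suc j))) (ℚ.*-identityˡ (M zero zero)))
    (sum-zero (λ j → sgn (suc j) * M zero (suc j) * det (λ i → removeAt (tail M i) (suc j))) (terms n M M≡0)))
  (ℚ.+-identityʳ _)
  where
  terms : ∀ n (M : Matrix ℚ (suc n) (suc n)) → (∀ i → M (suc i) zero ≡ 0ℚ) → (j : Fin n) →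
    sgn (suc j) * M zero (suc j) * det (λ i → removeAt (tail M i) (suc j)) ≡ 0ℚ
  terms (suc n) M M≡0 j = trans
    (cong (sgn (suc j) * M zero (suc j) *_) (det-zero-first-column (λ i → removeAt (tail M i) (suc j)) M≡0))
    (ℚ.*-zeroʳ (sgn (suc j) * M zero (suc j)))

det-δ : ∀ n → det (δ {n}) ≡ 1ℚ
det-δ zero    = refl
det-δ (suc n) = trans (det-first-row (δ {suc n}) (λ _ → refl)) (trans (ℚ.*-identityˡ (det (δ {n}))) (det-δ n))

replaceColumn : Matrix ℚ m n → Fin n → Vector ℚ m → Matrix ℚ m n
replaceColumn M l x i = updateAt (M i) l (const (x i))

-- Together with `det-✶` this is Cramer's rule, because `C` times this matrix is `C` with column `l`
-- replaced by `C ✶ᵥ x`.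
det-replaceColumn-δ : (l : Fin n) (x : Vector ℚ n) → det (replaceColumn δ l x) ≡ x l
det-replaceColumn-δ {suc n} zero x = trans
  (det-first-row (replaceColumn δ zero x) (λ _ → refl))
  (trans (cong (x zero *_) (det-δ n)) (ℚ.*-identityʳ (x zero)))
det-replaceColumn-δ {suc n} (suc l) x = trans
  (det-first-column (replaceColumn δ (suc l) x) (λ _ → refl))
  (trans (ℚ.*-identityˡ _) (det-replaceColumn-δ l (tail x)))

updateAt-map : ∀ {A B : Set} (f : A → B) (xs : Vector A n) l a →
  f ∘ updateAt xs l (const a) ≗ updateAt (f ∘ xs) l (const (f a))
updateAt-map {suc n} f xs zero    a zero    = refl
updateAt-map {suc n} f xs zero    a (suc i) = refl
updateAt-map {suc n} f xs (suc l) a zero    = refl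
updateAt-map {suc n} f xs (suc l) a (suc i) = updateAt-map f (tail xs) l a i

det-replaceRow-δ : (l : Fin n) (c : Vector ℚ n) → det (updateAt δ l (const c)) ≡ c l
det-replaceRow-δ {suc n} zero c = trans
  (det-first-column (updateAt δ zero (const c)) (λ _ → refl))
  (trans (cong (c zero *_) (det-δ n)) (ℚ.*-identityʳ (c zero)))
det-replaceRow-δ {suc n} (suc l) c = trans
  (det-first-row (updateAt δ (suc l) (const c)) (λ _ → refl))
  (trans (ℚ.*-identityˡ _) (trans
    (det-ext n (λ i j → cong (λ r → r j) (updateAt-map tail (tail δ) l c i)))
    (det-replaceRow-δ l (tail c))))

-- Written as the addition of a multiple of a unit vector, the replacement of a column becomes a
-- rank-one update, which sums can handle.
updateAt-δ : (v : Vector ℚ n) (l : Fin n) (a : ℚ) →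
  ∀ k → updateAt v l (const a) k ≡ v k + (a - v l) * δ l k
updateAt-δ {suc n} v zero a zero =
  solve 2 (λ a x → a := x :+ (a :- x) :* con 1ℚ) refl a (v zero)
updateAt-δ {suc n} v zero a (suc k) =
  solve 3 (λ a x y → y := y :+ (a :- x) :* con 0ℚ) refl a (v zero) (v (suc k))
updateAt-δ {suc n} v (suc l) a zero =
  solve 3 (λ a x y → y := y :+ (a :- x) :* con 0ℚ) refl a (v (suc l)) (v zero)
updateAt-δ {suc n} v (suc l) a (suc k) = updateAt-δ (tail v) l a k

-- Invertible matrices and bases

infixl 7 _✶ᵥ_

_✶ᵥ_ : Matrix ℚ m n → Vector ℚ n → Vector ℚ m
(M ✶ᵥ x) i = sum (λ j → M i j * x j)

✶ᵥ-assoc : (M : Matrix ℚ m n) (N : Matrix ℚ n p) (x : Vector ℚ p) →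
  (M ✶ N) ✶ᵥ x ≗ M ✶ᵥ (N ✶ᵥ x)
✶ᵥ-assoc M N x i = ✶-assoc M N (λ j (_ : Fin 1) → x j) i zero

sum-linearˡ : ∀ c (u v w : Vector ℚ n) →
  sum (λ i → (u i + c * v i) * w i) ≡ sum (λ i → u i * w i) + c * sum (λ i → v i * w i)
sum-linearˡ c u v w = trans
  (sum-cong-≗ λ i → solve 4
    (λ c u v w → (u :+ c :* v) :* w := con 1ℚ :* (u :* w) :+ c :* (v :* w)) refl c (u i) (v i) (w i))
  (trans (sum-linear 1ℚ c (λ i → u i * w i) (λ i → v i * w i))
    (cong (_+ c * sum (λ i → v i * w i)) (ℚ.*-identityˡ (sum (λ i → u i * w i)))))

sum-linearʳ : ∀ c (u v w : Vector ℚ n) →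
  sum (λ i → w i * (u i + v i * c)) ≡ sum (λ i → w i * u i) + sum (λ i → w i * v i) * c
sum-linearʳ c u v w = trans
  (sum-cong-≗ λ i → solve 4
    (λ c u v w → w :* (u :+ v :* c) := con 1ℚ :* (w :* u) :+ c :* (w :* v)) refl c (u i) (v i) (w i))
  (trans (sum-linear 1ℚ c (λ i → w i * u i) (λ i → w i * v i))
    (cong₂ _+_ (ℚ.*-identityˡ (sum (λ i → w i * u i))) (ℚ.*-comm c (sum (λ i → w i * v i)))))

record Invertible (C : Matrix ℚ r r) : Set where
  field
    inverse  : Matrix ℚ r r
    inverseˡ : inverse ✶ C ≋ δ
    inverseʳ : C ✶ inverse ≋ δ

open Invertible

invertible-≋ : {C D : Matrix ℚ r r} → C ≋ D → Invertible C → Invertible D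
invertible-≋ {D = D} C≋D iC = record
  { inverse  = inverse iC
  ; inverseˡ = λ i j → trans (sym (✶-congʳ (inverse iC) C≋D i j)) (inverseˡ iC i j)
  ; inverseʳ = λ i j → trans (sym (✶-congˡ (inverse iC) C≋D i j)) (inverseʳ iC i j)
  }

δ-invertible : Invertible (δ {r})
δ-invertible = record { inverse = δ ; inverseˡ = ✶-identityˡ δ ; inverseʳ = ✶-identityˡ δ }

module _ {C : Matrix ℚ r r} (iC : Invertible C) (l : Fin r) (a : Vector ℚ r)
  (dl≢0 : (inverse iC ✶ᵥ a) l ≢ 0ℚ) where

  private
    B = inverse iC
    d = B ✶ᵥ a
    instance _ = ≢-nonZero dl≢0
    v = 1/ d l
    C′ = replaceColumn C l a
    -- The pivot of the simplex method: adding `e k` times row `l` to each row `k` turns `d` into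
    -- the unit vector `l` and fixes the other unit vectors. Applied to the rows of `B`, it gives
    -- the inverse of `C′`.
    e : Vector ℚ r
    e k = (δ k l - d k) * v
    B′ : Matrix ℚ r r
    B′ k j = B k j + e k * B l j

    C′-formula : ∀ i j → C′ i j ≡ C i j + (a i - C i l) * δ l j
    C′-formula i j = updateAt-δ (C i) l (a i) j

    BC′ : ∀ k j → (B ✶ C′) k j ≡ δ k j + (d k - δ k l) * δ l j
    BC′ k j = begin
      sum (λ p → B k p * C′ p j)
        ≡⟨ sum-cong-≗ (λ p → cong (B k p *_) (C′-formula p j)) ⟩
      sum (λ p → B k p * (C p j + (a p - C p l) * δ l j))
        ≡⟨ sum-linearʳ (δ l j) (λ p → C p j) (λ p → a p - C p l) (B k) ⟩
      (B ✶ C) k j + sum (λ p → B k p * (a p - C p l)) * δ l j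
        ≡⟨ cong₂ (λ x y → x + y * δ l j) (inverseˡ iC k j) difference ⟩
      δ k j + (d k - δ k l) * δ l j ∎
      where
      open ≡-Reasoning
      difference : sum (λ p → B k p * (a p - C p l)) ≡ d k - δ k l
      difference = begin
        sum (λ p → B k p * (a p - C p l))
          ≡⟨ sum-cong-≗ (λ p → solve 3 (λ b a c → b :* (a :- c) := b :* (a :+ c :* (:- con 1ℚ)))
               refl (B k p) (a p) (C p l)) ⟩
        sum (λ p → B k p * (a p + C p l * (- 1ℚ)))
          ≡⟨ sum-linearʳ (- 1ℚ) a (λ p → C p l) (B k) ⟩
        d k + (B ✶ C) k l * (- 1ℚ)
          ≡⟨ cong (λ x → d k + x * (- 1ℚ)) (inverseˡ iC k l) ⟩
        d k + δ k l * (- 1ℚ)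
          ≡⟨ solve 2 (λ d x → d :+ x :* (:- con 1ℚ) := d :- x) refl (d k) (δ k l) ⟩
        d k - δ k l ∎

    left : B′ ✶ C′ ≋ δ
    left k j = begin
      sum (λ p → (B k p + e k * B l p) * C′ p j)
        ≡⟨ sum-linearˡ (e k) (B k) (B l) (λ p → C′ p j) ⟩
      (B ✶ C′) k j + e k * (B ✶ C′) l j
        ≡⟨ cong₂ (λ x y → x + e k * y) (BC′ k j)
             (trans (BC′ l j) (cong (λ x → δ l j + (d l - x) * δ l j) (δ-refl l))) ⟩
      δ k j + (d k - δ k l) * δ l j + e k * (δ l j + (d l - 1ℚ) * δ l j)
        ≡⟨ solve 6 (λ x dk y z v dl →
             x :+ (dk :- y) :* z :+ ((y :- dk) :* v) :* (z :+ (dl :- con 1ℚ) :* z) :=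
             x :+ (dk :- y) :* z :* (con 1ℚ :- dl :* v))
             refl (δ k j) (d k) (δ k l) (δ l j) v (d l) ⟩
      δ k j + (d k - δ k l) * δ l j * (1ℚ - d l * v)
        ≡⟨ cong (λ x → δ k j + (d k - δ k l) * δ l j * (1ℚ - x)) (ℚ.*-inverseʳ (d l)) ⟩
      δ k j + (d k - δ k l) * δ l j * (1ℚ - 1ℚ)
        ≡⟨ solve 2 (λ x y → x :+ y :* (con 1ℚ :- con 1ℚ) := x) refl (δ k j) ((d k - δ k l) * δ l j) ⟩
      δ k j ∎
      where open ≡-Reasoning

    C′-row : ∀ k (w : Vector ℚ r) → (C′ ✶ᵥ w) k ≡ (C ✶ᵥ w) k + (a k - C k l) * w l
    C′-row k w = begin
      sum (λ p → C′ k p * w p)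
        ≡⟨ sum-cong-≗ (λ p → cong (_* w p) (C′-formula k p)) ⟩
      sum (λ p → (C k p + (a k - C k l) * δ l p) * w p)
        ≡⟨ sum-linearˡ (a k - C k l) (C k) (δ l) w ⟩
      (C ✶ᵥ w) k + (a k - C k l) * sum (λ p → δ l p * w p)
        ≡⟨ cong (λ x → (C ✶ᵥ w) k + (a k - C k l) * x) (sum-δˡ l w) ⟩
      (C ✶ᵥ w) k + (a k - C k l) * w l ∎
      where open ≡-Reasoning

    Cd : ∀ k → (C ✶ᵥ d) k ≡ a k
    Cd k = trans (sym (✶ᵥ-assoc C B a k))
      (trans (sum-cong-≗ λ p → cong (_* a p) (inverseʳ iC k p)) (sum-δˡ k a))

    Ce : ∀ k → (C ✶ᵥ e) k ≡ (C k l - a k) * v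
    Ce k = begin
      sum (λ p → C k p * ((δ p l - d p) * v))
        ≡⟨ sum-cong-≗ (λ p → solve 4 (λ c x d v → c :* ((x :- d) :* v) := v :* (c :* x) :+ (:- v) :* (c :* d))
             refl (C k p) (δ p l) (d p) v) ⟩
      sum (λ p → v * (C k p * δ p l) + (- v) * (C k p * d p))
        ≡⟨ sum-linear v (- v) (λ p → C k p * δ p l) (λ p → C k p * d p) ⟩
      v * sum (λ p → C k p * δ p l) + (- v) * (C ✶ᵥ d) k
        ≡⟨ cong₂ (λ x y → v * x + (- v) * y) (sum-δʳ l (C k)) (Cd k) ⟩
      v * C k l + (- v) * a k
        ≡⟨ solve 3 (λ v c a → v :* c :+ (:- v) :* a := (c :- a) :* v) refl v (C k l) (a k) ⟩
      (C k l - a k) * v ∎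
      where open ≡-Reasoning

    right : C′ ✶ B′ ≋ δ
    right k j = begin
      sum (λ p → C′ k p * (B p j + e p * B l j))
        ≡⟨ sum-linearʳ (B l j) (λ p → B p j) e (C′ k) ⟩
      (C′ ✶ B) k j + (C′ ✶ᵥ e) k * B l j
        ≡⟨ cong₂ (λ x y → x + y * B l j)
             (trans (C′-row k (λ p → B p j)) (cong (_+ (a k - C k l) * B l j) (inverseʳ iC k j)))
             (trans (C′-row k e) (cong₂ (λ x y → x + (a k - C k l) * ((y - d l) * v)) (Ce k) (δ-refl l))) ⟩
      δ k j + (a k - C k l) * B l j + ((C k l - a k) * v + (a k - C k l) * ((1ℚ - d l) * v)) * B l j
        ≡⟨ solve 6 (λ x a c b v d →
             x :+ (a :- c) :* b :+ ((c :- a) :* v :+ (a :- c) :* ((con 1ℚ :- d) :* v)) :* b :=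
             x :+ (a :- c) :* b :* (con 1ℚ :- d :* v))
             refl (δ k j) (a k) (C k l) (B l j) v (d l) ⟩
      δ k j + (a k - C k l) * B l j * (1ℚ - d l * v)
        ≡⟨ cong (λ x → δ k j + (a k - C k l) * B l j * (1ℚ - x)) (ℚ.*-inverseʳ (d l)) ⟩
      δ k j + (a k - C k l) * B l j * (1ℚ - 1ℚ)
        ≡⟨ solve 2 (λ x y → x :+ y :* (con 1ℚ :- con 1ℚ) := x) refl (δ k j) ((a k - C k l) * B l j) ⟩
      δ k j ∎
      where open ≡-Reasoning

  replaceColumn-invertible : Invertible (replaceColumn C l a)
  replaceColumn-invertible = record { inverse = B′ ; inverseˡ = left ; inverseʳ = right }

-- F is the identity or the double negation monad.
establish-all : (F : Set → Set) → (∀ {A} → A → F A) → (∀ {A B} → F A → (A → F B) → F B) →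
  {S : Set} (Done : S → Fin n → Set) →
  (∀ s k → F (Σ S λ s′ → Done s′ k × (∀ l → Done s l → Done s′ l))) →
  S → F (Σ S λ s → ∀ k → Done s k)
establish-all {zero}  F return _>>=_ Done step s = return (s , λ ())
establish-all {suc n} F return _>>=_ Done step s =
  establish-all F return _>>=_ (λ s k → Done s (suc k))
    (λ s k → step s (suc k) >>= λ (s′ , new , old) → return (s′ , new , λ l → old (suc l))) s
  >>= λ (s₁ , done) → step s₁ zero
  >>= λ (s₂ , new , old) → return (s₂ , λ { zero → new ; (suc k) → old (suc k) (done k) })

-- Gaussian elimination: the columns of the identity matrix are replaced one
-- by one by columns of A.
basis-exists : (A : Matrix ℚ r n) → FullRowRank A → ∃ λ g → Invertible (columns g A)
basis-exists {r} {n} A rank =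
  let (C , iC) , done = establish-all (λ A → A) (λ a → a) (λ a f → f a) Done step (δ , δ-invertible)
  in (λ k → proj₁ (done k)) , invertible-≋ (λ i k → proj₂ (done k) i) iC
  where
  State = Σ (Matrix ℚ r r) Invertible
  Done : State → Fin r → Set
  Done (C , _) k = ∃ λ j → ∀ i → C i k ≡ A i j
  step : ∀ s k → Σ State λ s′ → Done s′ k × (∀ l → Done s l → Done s′ l)
  step (C , iC) k with any? (λ j → ¬? (((inverse iC ✶ᵥ λ i → A i j) k) ℚ.≟ 0ℚ))
  ... | yes (j , ≢0) =
    (replaceColumn C k (λ i → A i j) , replaceColumn-invertible iC k _ ≢0) ,
    (j , λ i → updateAt-updates k (C i)) , old
    where
    old : ∀ l → Done (C , iC) l → ∃ λ j′ → ∀ i → replaceColumn C k (λ i → A i j) i l ≡ A i j′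
    old l (j′ , eq) with l Fin.≟ k
    ... | yes refl = j , λ i → updateAt-updates k (C i)
    ... | no l≢k   = j′ , λ i → trans (updateAt-minimal l k (C i) l≢k) (eq i)
  -- If no column of `A` can enter at `k`, row `k` of the inverse annihilates every column of `A`
  -- and is zero by full row rank. But its product with column `k` of `C` is one.
  ... | no none = contradiction
    (trans (sym (δ-refl k)) (trans (sym (inverseˡ iC k k))
      (sum-zero _ λ p → trans (cong (_* C p k) (rank (inverse iC k)
        (λ j → decidable-stable (_ ℚ.≟ 0ℚ) λ ≢0 → none (j , ≢0)) p)) (ℚ.*-zeroˡ (C p k)))))
    ℚ.1≢0

scatter : (Fin r → Fin n) → Vector ℚ r → Vector ℚ n
scatter g y j = sum (λ k → y k * δ (g k) j)

scatter-solves : (A : Matrix ℚ r n) (g : Fin p → Fin n) (y : Vector ℚ p) →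
  A ✶ᵥ scatter g y ≗ columns g A ✶ᵥ y
scatter-solves A g y i = begin
  sum (λ j → A i j * sum (λ k → y k * δ (g k) j))
    ≡⟨ sum-cong-≗ (λ j → *-distribˡ-sum (A i j) (λ k → y k * δ (g k) j)) ⟩
  sum (λ j → sum (λ k → A i j * (y k * δ (g k) j)))
    ≡⟨ ∑-comm (λ j k → A i j * (y k * δ (g k) j)) ⟩
  sum (λ k → sum (λ j → A i j * (y k * δ (g k) j)))
    ≡⟨ sum-cong-≗ (λ k → trans
         (sum-cong-≗ λ j → solve 3 (λ a y d → a :* (y :* d) := d :* (a :* y)) refl (A i j) (y k) (δ (g k) j))
         (sum-δˡ (g k) (λ j → A i j * y k))) ⟩
  sum (λ k → A i (g k) * y k) ∎
  where open ≡-Reasoning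

invertible-solvable : (C : Matrix ℚ r r) (iC : Invertible C) (b : Vector ℚ r) →
  C ✶ᵥ (inverse iC ✶ᵥ b) ≗ b
invertible-solvable C iC b i = trans (sym (✶ᵥ-assoc C (inverse iC) b i))
  (trans (sum-cong-≗ λ p → cong (_* b p) (inverseʳ iC i p)) (sum-δˡ i b))

full-rank-solvable : (A : Matrix ℚ r n) → FullRowRank A → ∀ b → ∃ λ x → A ✶ᵥ x ≗ b
full-rank-solvable A rank b =
  let g , iC = basis-exists A rank
  in scatter g (inverse iC ✶ᵥ b) , λ i → trans
    (scatter-solves A g (inverse iC ✶ᵥ b) i)
    (invertible-solvable (columns g A) iC b i)

invertible⇒det≢0 : {C : Matrix ℚ r r} → Invertible C → det C ≢ 0ℚ
invertible⇒det≢0 {r} {C} iC det≡0 = ℚ.1≢0 (begin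
  1ℚ                           ≡⟨ det-δ r ⟨
  det (δ {r})                  ≡⟨ det-ext r (inverseʳ iC) ⟨
  det (C ✶ inverse iC)         ≡⟨ det-✶ C (inverse iC) ⟩
  det C * det (inverse iC)     ≡⟨ cong (_* det (inverse iC)) det≡0 ⟩
  0ℚ * det (inverse iC)        ≡⟨ ℚ.*-zeroˡ (det (inverse iC)) ⟩
  0ℚ                           ∎)
  where open ≡-Reasoning

*-cancelʳ-≢0 : ∀ {x y} z → z ≢ 0ℚ → x * z ≡ y * z → x ≡ y
*-cancelʳ-≢0 {x} {y} z z≢0 eq = trans (sym (undo x)) (trans (cong (_* 1/ z) eq) (undo y))
  where
  instance _ = ≢-nonZero z≢0
  undo : ∀ x → x * z * 1/ z ≡ x
  undo x = trans (ℚ.*-assoc x z (1/ z)) (trans (cong (x *_) (ℚ.*-inverseʳ z)) (ℚ.*-identityʳ x))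

vanishes-on-zero-row : ∀ n (Φ : Matrix ℚ n m → ℚ) → Extensional Φ → Alternating n Φ →
  ∀ M k → (∀ j → M k j ≡ 0ℚ) → Φ M ≡ 0ℚ
vanishes-on-zero-row (suc n) Φ ext (lin , _ , alt) M zero Mk≡0 = trans
  (ext (λ { zero _ → refl ; (suc i) _ → refl }))
  (first-row-zero Φ ext lin (M zero) (tail M) Mk≡0)
vanishes-on-zero-row (suc n) Φ ext (lin , _ , alt) M (suc k) Mk≡0 = trans
  (ext (λ { zero _ → refl ; (suc i) _ → refl }))
  (vanishes-on-zero-row n _ (∷-ext Φ ext (M zero)) (alt (M zero)) (tail M) k Mk≡0)

-- Put the dependency `c` into row `i` of the identity. The determinant of this matrix is `c i`,
-- while its product with `C` has a zero row.
det≢0⇒full-rank : (C : Matrix ℚ r r) → det C ≢ 0ℚ → FullRowRank C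
det≢0⇒full-rank {r} C det≢0 c cC≡0 i = *-cancelʳ-≢0 (det C) det≢0 (begin
  c i * det C             ≡⟨ cong (_* det C) (det-replaceRow-δ i c) ⟨
  det S * det C           ≡⟨ det-✶ S C ⟨
  det (S ✶ C)             ≡⟨ vanishes-on-zero-row r det (det-ext r) (det-alternating r) (S ✶ C) i
                               (λ j → trans (sum-cong-≗ λ p → cong (λ s → s p * C p j) (updateAt-updates i δ))
                                 (cC≡0 j)) ⟩
  0ℚ                      ≡⟨ ℚ.*-zeroˡ (det C) ⟨
  0ℚ * det C              ∎)
  where
  open ≡-Reasoning
  S : Matrix ℚ r r
  S = updateAt δ i (const c)

-- Integers inside the rationals

ι : ℤ → ℚ
ι z = z / 1

-- The quotient `z / 1` is normalised by a gcd and does not reduce for a variable `z`; with the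
-- explicit fraction, sums, products and comparisons compute.
ι-mkℚ : ∀ z → ι z ≡ mkℚ z 0 (Coprime.sym (Coprime.1-coprimeTo ℤ.∣ z ∣))
ι-mkℚ z = ℚ.↥p/↧p≡p (mkℚ z 0 (Coprime.sym (Coprime.1-coprimeTo ℤ.∣ z ∣)))

ι-+ : ∀ a b → ι (a ℤ.+ b) ≡ ι a + ι b
ι-+ a b = sym (trans (cong₂ _+_ (ι-mkℚ a) (ι-mkℚ b))
  (cong ι (cong₂ ℤ._+_ (ℤ.*-identityʳ a) (ℤ.*-identityʳ b))))

ι-* : ∀ a b → ι (a ℤ.* b) ≡ ι a * ι b
ι-* a b = sym (cong₂ _*_ (ι-mkℚ a) (ι-mkℚ b))

ι-neg : ∀ a → ι (ℤ.- a) ≡ - ι a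
ι-neg a = begin
  ι (ℤ.- a)                       ≡⟨ solve 2 (λ x y → x := (y :+ x) :- y) refl (ι (ℤ.- a)) (ι a) ⟩
  (ι a + ι (ℤ.- a)) - ι a         ≡⟨ cong (_- ι a) (ι-+ a (ℤ.- a)) ⟨
  ι (a ℤ.+ ℤ.- a) - ι a           ≡⟨ cong (λ z → ι z - ι a) (ℤ.+-inverseʳ a) ⟩
  0ℚ - ι a                        ≡⟨ ℚ.+-identityˡ _ ⟩
  - ι a                           ∎
  where open ≡-Reasoning

ι-injective : ∀ {a b} → ι a ≡ ι b → a ≡ b
ι-injective {a} {b} eq = cong ↥_ (trans (sym (ι-mkℚ a)) (trans eq (ι-mkℚ b)))

Integral : ℚ → Set
Integral q = ∃ λ z → q ≡ ι z

integral-+ : ∀ {p q} → Integral p → Integral q → Integral (p + q)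
integral-+ (a , refl) (b , refl) = a ℤ.+ b , sym (ι-+ a b)

integral-* : ∀ {p q} → Integral p → Integral q → Integral (p * q)
integral-* (a , refl) (b , refl) = a ℤ.* b , sym (ι-* a b)

integral-sum : (v : Vector ℚ n) → (∀ i → Integral (v i)) → Integral (sum v)
integral-sum {zero}  v _   = ℤ.0ℤ , refl
integral-sum {suc n} v int = integral-+ (int zero) (integral-sum (tail v) (λ i → int (suc i)))

integral-det : (M : Matrix ℚ n n) → (∀ i j → Integral (M i j)) → Integral (det M)
integral-det {zero}  M int = ℤ.1ℤ , refl
integral-det {suc n} M int = integral-sum (λ j → sgn j * M zero j * det (λ i → removeAt (tail M i) j)) λ j →
  integral-* (integral-* (integral-sgn j) (int zero j))
    (integral-det (λ i → removeAt (tail M i) j) λ i k → int (suc i) (punchIn j k))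
  where
  integral-sgn : ∀ {n} (j : Fin n) → Integral (sgn j)
  integral-sgn zero    = ℤ.1ℤ , refl
  integral-sgn (suc j) = integral-* (ℤ.-1ℤ , refl) (integral-sgn j)

unit-abs : ∀ a b → ι a * ι b ≡ 1ℚ → ∣ ι a ∣ ≡ 1ℚ
unit-abs a b eq = cases a (ℕ.m*n≡1⇒m≡1 ℤ.∣ a ∣ ℤ.∣ b ∣
  (trans (sym (ℤ.abs-* a b)) (cong ℤ.∣_∣ (ι-injective {a ℤ.* b} {ℤ.1ℤ} (trans (ι-* a b) eq)))))
  where
  cases : ∀ a → ℤ.∣ a ∣ ≡ 1 → ∣ ι a ∣ ≡ 1ℚ
  cases (ℤ.+ .1)      refl = refl
  cases -[1+ zero ] refl = refl

-- Real numbers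

p≤∣p∣ : ∀ p → p ≤ ∣ p ∣
p≤∣p∣ p with ℚ.∣p∣≡p∨∣p∣≡-p p
... | inj₁ eq = ℚ.≤-reflexive (sym eq)
... | inj₂ eq with ℚ.≤-total p 0ℚ
...   | inj₁ p≤0 = ℚ.≤-trans p≤0 (ℚ.0≤∣p∣ p)
...   | inj₂ 0≤p = ℚ.≤-reflexive (sym (ℚ.0≤p⇒∣p∣≡p 0≤p))

∣p-q∣<ε⇒p≤q+ε : ∀ {p q ε} → ∣ p - q ∣ < ε → p ≤ q + ε
∣p-q∣<ε⇒p≤q+ε {p} {q} {ε} lt = subst (_≤ q + ε)
  (solve 2 (λ p q → q :+ (p :- q) := p) refl p q)
  (ℚ.+-monoʳ-≤ q (ℚ.≤-trans (p≤∣p∣ (p - q)) (ℚ.<⇒≤ lt)))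

half : ∀ {ε} → 0ℚ < ε → 0ℚ < ε * ½
half {ε} 0<ε = subst (_< ε * ½) (ℚ.*-zeroˡ ½) (ℚ.*-monoˡ-<-pos ½ 0<ε)

half+half : ∀ ε → ε * ½ + ε * ½ ≡ ε
half+half ε = trans (sym (ℚ.*-distribˡ-+ ε ½ ½)) (ℚ.*-identityʳ ε)

p≤p+ε : ∀ p {ε} → 0ℚ < ε → p ≤ p + ε
p≤p+ε p {ε} 0<ε = subst (_≤ p + ε) (ℚ.+-identityʳ p) (ℚ.+-monoʳ-≤ p (ℚ.<⇒≤ 0<ε))

≤ᵣ-pointwise : (∀ k → seq x k ≤ seq y k) → x ≤ᵣ y
≤ᵣ-pointwise {y = y} x≤y ε 0<ε = 0 , λ k _ → ℚ.≤-trans (x≤y k) (p≤p+ε (seq y k) 0<ε)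

≈-pointwise : (∀ k → seq x k ≡ seq y k) → x ≈ y
≈-pointwise {x} {y} x≡y =
  ≤ᵣ-pointwise {x} {y} (λ k → ℚ.≤-reflexive (x≡y k)) ,
  ≤ᵣ-pointwise {y} {x} (λ k → ℚ.≤-reflexive (sym (x≡y k)))

≤ᵣ-trans : x ≤ᵣ y → y ≤ᵣ z → x ≤ᵣ z
≤ᵣ-trans {x} {y} {z} x≤y y≤z ε 0<ε with x≤y (ε * ½) (half 0<ε) | y≤z (ε * ½) (half 0<ε)
... | N₁ , p | N₂ , q = N₁ ℕ.⊔ N₂ , λ k N≤k → begin
  seq x k                           ≤⟨ p k (ℕ.m⊔n≤o⇒m≤o N₁ N₂ N≤k) ⟩
  seq y k + ε * ½                   ≤⟨ ℚ.+-monoˡ-≤ (ε * ½) (q k (ℕ.m⊔n≤o⇒n≤o N₁ N₂ N≤k)) ⟩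
  seq z k + ε * ½ + ε * ½           ≡⟨ ℚ.+-assoc (seq z k) (ε * ½) (ε * ½) ⟩
  seq z k + (ε * ½ + ε * ½)         ≡⟨ cong (seq z k +_) (half+half ε) ⟩
  seq z k + ε                       ∎
  where open ℚ.≤-Reasoning

≤ᵣ-refl : x ≤ᵣ x
≤ᵣ-refl {x} = ≤ᵣ-pointwise {x} {x} (λ _ → ℚ.≤-refl)

≈-trans : x ≈ y → y ≈ z → x ≈ z
≈-trans {x} {y} {z} (p , p′) (q , q′) = ≤ᵣ-trans {x} {y} {z} p q , ≤ᵣ-trans {z} {y} {x} q′ p′

≈-sym : x ≈ y → y ≈ x
≈-sym (p , q) = q , p

+ᵣ-mono : x ≤ᵣ y → x′ ≤ᵣ y′ → x +ᵣ x′ ≤ᵣ y +ᵣ y′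
+ᵣ-mono {x} {y} {x′} {y′} x≤y x′≤y′ ε 0<ε with x≤y (ε * ½) (half 0<ε) | x′≤y′ (ε * ½) (half 0<ε)
... | N₁ , p | N₂ , q = N₁ ℕ.⊔ N₂ , λ k N≤k → begin
  seq x k + seq x′ k
    ≤⟨ ℚ.+-mono-≤ (p k (ℕ.m⊔n≤o⇒m≤o N₁ N₂ N≤k)) (q k (ℕ.m⊔n≤o⇒n≤o N₁ N₂ N≤k)) ⟩
  (seq y k + ε * ½) + (seq y′ k + ε * ½)
    ≡⟨ solve 3 (λ a b c → (a :+ c) :+ (b :+ c) := (a :+ b) :+ (c :+ c)) refl (seq y k) (seq y′ k) (ε * ½) ⟩
  (seq y k + seq y′ k) + (ε * ½ + ε * ½)
    ≡⟨ cong (seq y k + seq y′ k +_) (half+half ε) ⟩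
  (seq y k + seq y′ k) + ε ∎
  where open ℚ.≤-Reasoning

positive-inverse : ∀ {q} → 0ℚ < q → ∃ λ v → 0ℚ < v × q * v ≡ 1ℚ
positive-inverse {q} 0<q =
  1/ q , ℚ.positive⁻¹ (1/ q) {{ℚ.1/pos⇒pos q {{positive 0<q}}}} , ℚ.*-inverseʳ q
  where instance _ = ℚ.pos⇒nonZero q {{positive 0<q}}

0<*0< : ∀ {p q} → 0ℚ < p → 0ℚ < q → 0ℚ < p * q
0<*0< {p} {q} 0<p 0<q = ℚ.positive⁻¹ (p * q) {{ℚ.pos*pos⇒pos p {{positive 0<p}} q {{positive 0<q}}}}

0≤∧≢0⇒0< : ∀ {q} → 0ℚ ≤ q → q ≢ 0ℚ → 0ℚ < q
0≤∧≢0⇒0< 0≤q q≢0 = ℚ.≰⇒> λ q≤0 → q≢0 (ℚ.≤-antisym q≤0 0≤q)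

·-mono : ∀ {q} → 0ℚ ≤ q → x ≤ᵣ y → q · x ≤ᵣ q · y
·-mono {x} {y} {q} 0≤q x≤y with q ℚ.≟ 0ℚ
... | yes refl = ≤ᵣ-pointwise {0ℚ · x} {0ℚ · y}
  (λ k → ℚ.≤-reflexive (trans (ℚ.*-zeroˡ (seq x k)) (sym (ℚ.*-zeroˡ (seq y k)))))
... | no q≢0 with positive-inverse (0≤∧≢0⇒0< 0≤q q≢0)
...   | v , 0<v , qv≡1 = λ ε 0<ε →
  let N , p = x≤y (ε * v) (0<*0< 0<ε 0<v)
  in N , λ k N≤k → begin
    q * seq x k                     ≤⟨ ℚ.*-monoˡ-≤-nonNeg q {{nonNegative 0≤q}} (p k N≤k) ⟩
    q * (seq y k + ε * v)           ≡⟨ solve 4 (λ q y e v → q :* (y :+ e :* v) := q :* y :+ e :* (q :* v))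
                                         refl q (seq y k) ε v ⟩
    q * seq y k + ε * (q * v)       ≡⟨ cong (λ u → q * seq y k + ε * u) qv≡1 ⟩
    q * seq y k + ε * 1ℚ            ≡⟨ cong (q * seq y k +_) (ℚ.*-identityʳ ε) ⟩
    q * seq y k + ε                 ∎
  where open ℚ.≤-Reasoning

-- The means of rearranging real inequalities: only the difference of the two sides counts, so a
-- rearrangement is a rational ring identity at each index.
≤ᵣ-by₁ : x ≤ᵣ y → (∀ k → seq w k - seq z k ≡ seq x k - seq y k) → w ≤ᵣ z
≤ᵣ-by₁ {x} {y} {w} {z} x≤y eq ε 0<ε with x≤y ε 0<ε
... | N , p = N , λ k N≤k → begin
  seq w k
    ≡⟨ solve 2 (λ w z → w := z :+ (w :- z)) refl (seq w k) (seq z k) ⟩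
  seq z k + (seq w k - seq z k)
    ≡⟨ cong (seq z k +_) (eq k) ⟩
  seq z k + (seq x k - seq y k)
    ≤⟨ ℚ.+-monoʳ-≤ (seq z k) (ℚ.+-monoˡ-≤ (- seq y k) (p k N≤k)) ⟩
  seq z k + ((seq y k + ε) - seq y k)
    ≡⟨ solve 3 (λ z y e → z :+ ((y :+ e) :- y) := z :+ e) refl (seq z k) (seq y k) ε ⟩
  seq z k + ε ∎
  where open ℚ.≤-Reasoning

≤ᵣ-by₂ : x ≤ᵣ y → x′ ≤ᵣ y′ →
  (∀ k → seq w k - seq z k ≡ (seq x k - seq y k) + (seq x′ k - seq y′ k)) → w ≤ᵣ z
≤ᵣ-by₂ {x} {y} {x′} {y′} {w} {z} x≤y x′≤y′ eq =
  ≤ᵣ-by₁ {x +ᵣ x′} {y +ᵣ y′} {w} {z} (+ᵣ-mono {x} {y} {x′} {y′} x≤y x′≤y′) λ k → trans (eq k)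
    (solve 4 (λ x y x′ y′ → (x :- y) :+ (x′ :- y′) := (x :+ x′) :- (y :+ y′)) refl
      (seq x k) (seq y k) (seq x′ k) (seq y′ k))

·-cancel : ∀ {q} → 0ℚ < q → q · x ≤ᵣ q · y → x ≤ᵣ y
·-cancel {x} {y} {q} 0<q qx≤qy = ≤ᵣ-by₁ {v · (q · x)} {v · (q · y)} {x} {y}
  (·-mono {q · x} {q · y} (ℚ.<⇒≤ 0<v) qx≤qy)
  λ k → begin
    seq x k - seq y k                      ≡⟨ ℚ.*-identityˡ (seq x k - seq y k) ⟨
    1ℚ * (seq x k - seq y k)               ≡⟨ cong (_* (seq x k - seq y k)) (proj₂ (proj₂ inv)) ⟨
    q * v * (seq x k - seq y k)            ≡⟨ solve 4 (λ q v x y → q :* v :* (x :- y) := v :* (q :* x) :- v :* (q :* y))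
                                                refl q v (seq x k) (seq y k) ⟩
    v * (q * seq x k) - v * (q * seq y k)  ∎
  where
  open ≡-Reasoning
  inv = positive-inverse 0<q
  v = proj₁ inv
  0<v = proj₁ (proj₂ inv)

·-cong : ∀ q → x ≈ y → q · x ≈ q · y
·-cong {x} {y} q (x≤y , y≤x) with ℚ.≤-total 0ℚ q
... | inj₁ 0≤q = ·-mono {x} {y} 0≤q x≤y , ·-mono {y} {x} 0≤q y≤x
... | inj₂ q≤0 = flip x y y≤x , flip y x x≤y
  where
  flip : ∀ x y → y ≤ᵣ x → q · x ≤ᵣ q · y
  flip x y y≤x = ≤ᵣ-by₁ {(- q) · y} {(- q) · x} {q · x} {q · y}
    (·-mono {y} {x} (ℚ.neg-antimono-≤ q≤0) y≤x)
    (λ k → solve 3 (λ q x y → q :* x :- q :* y := (:- q) :* y :- (:- q) :* x) refl q (seq x k) (seq y k))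

+ᵣ-cong : x ≈ y → x′ ≈ y′ → x +ᵣ x′ ≈ y +ᵣ y′
+ᵣ-cong {x} {y} {x′} {y′} (p , p′) (q , q′) =
  +ᵣ-mono {x} {y} {x′} {y′} p q , +ᵣ-mono {y} {x} {y′} {x′} p′ q′

-- For each `ε` one rational comparison at a late index decides, with slack `ε * ½`. Should it fail,
-- `x` would stay below `y` from there on, since the two Cauchy errors `ε/4` together do not exceed
-- the slack.
≰ᵣ⇒≥ᵣ : ¬ (x ≤ᵣ y) → y ≤ᵣ x
≰ᵣ⇒≥ᵣ {x} {y} x≰y ε 0<ε with cauchy x (ε * ½ * ½) (half (half 0<ε)) | cauchy y (ε * ½ * ½) (half (half 0<ε))
... | N₁ , p | N₂ , q = compare (seq y N ℚ.≤? seq x N + ε * ½)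
  where
  open ℚ.≤-Reasoning
  N = N₁ ℕ.⊔ N₂
  ε/4 = ε * ½ * ½
  near : ∀ (s : ℝ) {M} → (∀ a b → M ℕ.≤ a → M ℕ.≤ b → ∣ seq s a - seq s b ∣ < ε/4) → M ℕ.≤ N →
    ∀ k → N ℕ.≤ k → seq s k ≤ seq s N + ε/4 × seq s N ≤ seq s k + ε/4
  near s close M≤N k N≤k =
    ∣p-q∣<ε⇒p≤q+ε {seq s k} (close k N (ℕ.≤-trans M≤N N≤k) M≤N) ,
    ∣p-q∣<ε⇒p≤q+ε {seq s N} (close N k M≤N (ℕ.≤-trans M≤N N≤k))
  near-x = near x p (ℕ.m≤m⊔n N₁ N₂)
  near-y = near y q (ℕ.m≤n⊔m N₁ N₂)
  compare : Dec (seq y N ≤ seq x N + ε * ½) → ∃ λ M → ∀ k → M ℕ.≤ k → seq y k ≤ seq x k + ε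
  compare (yes yN≤) = N , λ k N≤k → begin
    seq y k                                ≤⟨ proj₁ (near-y k N≤k) ⟩
    seq y N + ε/4                          ≤⟨ ℚ.+-monoˡ-≤ ε/4 yN≤ ⟩
    seq x N + ε * ½ + ε/4                  ≤⟨ ℚ.+-monoˡ-≤ ε/4 (ℚ.+-monoˡ-≤ (ε * ½) (proj₂ (near-x k N≤k))) ⟩
    seq x k + ε/4 + ε * ½ + ε/4            ≡⟨ solve 3 (λ x h e → x :+ h :+ e :+ h := x :+ (e :+ (h :+ h)))
                                                refl (seq x k) ε/4 (ε * ½) ⟩
    seq x k + (ε * ½ + (ε/4 + ε/4))        ≡⟨ cong (λ t → seq x k + (ε * ½ + t)) (half+half (ε * ½)) ⟩
    seq x k + (ε * ½ + ε * ½)              ≡⟨ cong (seq x k +_) (half+half ε) ⟩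
    seq x k + ε                            ∎
  compare (no yN≰) = contradiction x≤y x≰y
    where
    x≤y : x ≤ᵣ y
    x≤y η 0<η = N , λ k N≤k → begin
      seq x k                    ≤⟨ proj₁ (near-x k N≤k) ⟩
      seq x N + ε/4              ≡⟨ solve 2 (λ x h → x :+ h := x :+ (h :+ h) :- h) refl (seq x N) ε/4 ⟩
      seq x N + (ε/4 + ε/4) - ε/4 ≡⟨ cong (λ t → seq x N + t - ε/4) (half+half (ε * ½)) ⟩
      seq x N + ε * ½ - ε/4      ≤⟨ ℚ.+-monoˡ-≤ (- ε/4) (ℚ.<⇒≤ (ℚ.≰⇒> yN≰)) ⟩
      seq y N - ε/4              ≤⟨ ℚ.+-monoˡ-≤ (- ε/4) (proj₂ (near-y k N≤k)) ⟩
      seq y k + ε/4 - ε/4        ≡⟨ solve 2 (λ y h → y :+ h :- h := y) refl (seq y k) ε/4 ⟩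
      seq y k                    ≤⟨ p≤p+ε (seq y k) 0<η ⟩
      seq y k + η                ∎

fromℚ-mono : ∀ {p q} → p ≤ q → fromℚ p ≤ᵣ fromℚ q
fromℚ-mono {p} {q} p≤q = ≤ᵣ-pointwise {fromℚ p} {fromℚ q} (λ _ → p≤q)

fromℚ-cancel : ∀ {p q} → fromℚ p ≤ᵣ fromℚ q → p ≤ q
fromℚ-cancel {p} {q} p≤q with p ℚ.≤? q
... | yes p≤q′ = p≤q′
... | no p≰q with ℚ.<-dense (ℚ.≰⇒> p≰q)
...   | t , q<t , t<p with p≤q (t - q) (subst (_< t - q) (ℚ.+-inverseʳ q) (ℚ.+-monoˡ-< (- q) q<t))
...     | N , le = contradiction
  (ℚ.<-≤-trans t<p (subst (p ≤_) (solve 2 (λ q t → q :+ (t :- q) := t) refl q t) (le N ℕ.≤-refl)))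
  (ℚ.<-irrefl refl)

fromℚ-injective : ∀ {p q} → fromℚ p ≈ fromℚ q → p ≡ q
fromℚ-injective (p≤q , q≤p) = ℚ.≤-antisym (fromℚ-cancel p≤q) (fromℚ-cancel q≤p)

ι-mono : ∀ {a b} → a ℤ.≤ b → ι a ≤ ι b
ι-mono {a} {b} a≤b = subst₂ _≤_ (sym (ι-mkℚ a)) (sym (ι-mkℚ b))
  (*≤* (subst₂ ℤ._≤_ (sym (ℤ.*-identityʳ a)) (sym (ℤ.*-identityʳ b)) a≤b))

ι-cancel : ∀ {a b} → ι a ≤ ι b → a ℤ.≤ b
ι-cancel {a} {b} le = subst₂ ℤ._≤_ (ℤ.*-identityʳ a) (ℤ.*-identityʳ b)
  (ℚ.drop-*≤* (subst₂ _≤_ (ι-mkℚ a) (ι-mkℚ b) le))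

fromℤ-mono : ∀ {a b} → a ℤ.≤ b → fromℤ a ≤ᵣ fromℤ b
fromℤ-mono a≤b = fromℚ-mono (ι-mono a≤b)

fromℤ-cancel : ∀ {a b} → fromℤ a ≤ᵣ fromℤ b → a ℤ.≤ b
fromℤ-cancel le = ι-cancel (fromℚ-cancel le)

p≤ι∣↥p∣ : ∀ p → p ≤ ι (ℤ.+ ℤ.∣ ↥ p ∣)
p≤ι∣↥p∣ p = subst (p ≤_) (sym (ι-mkℚ (ℤ.+ ℤ.∣ ↥ p ∣))) (*≤* (begin
  ↥ p ℤ.* ℤ.1ℤ                ≡⟨ ℤ.*-identityʳ (↥ p) ⟩
  ↥ p                         ≤⟨ i≤∣i∣ (↥ p) ⟩
  ℤ.+ ℤ.∣ ↥ p ∣                 ≡⟨ ℤ.*-identityʳ (ℤ.+ ℤ.∣ ↥ p ∣) ⟨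
  ℤ.+ ℤ.∣ ↥ p ∣ ℤ.* ℤ.1ℤ        ≤⟨ ℤ.*-monoˡ-≤-nonNeg (ℤ.+ ℤ.∣ ↥ p ∣) (ℤ.+≤+ (ℕ.s≤s ℕ.z≤n)) ⟩
  ℤ.+ ℤ.∣ ↥ p ∣ ℤ.* ↧ p         ∎))
  where
  open ℤ.≤-Reasoning
  i≤∣i∣ : ∀ i → i ℤ.≤ ℤ.+ ℤ.∣ i ∣
  i≤∣i∣ (ℤ.+ n)    = ℤ.≤-refl
  i≤∣i∣ -[1+ n ] = ℤ.-≤+

-ι∣↥p∣≤p : ∀ p → ι (ℤ.- (ℤ.+ ℤ.∣ ↥ p ∣)) ≤ p
-ι∣↥p∣≤p p = subst₂ _≤_ (trans (cong (λ k → - ι (ℤ.+ k)) ∣↥-p∣) (sym (ι-neg (ℤ.+ ℤ.∣ ↥ p ∣))))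
  (solve 1 (λ p → :- (:- p) := p) refl p)
  (ℚ.neg-antimono-≤ (p≤ι∣↥p∣ (- p)))
  where
  ∣↥-p∣ : ℤ.∣ ↥ (- p) ∣ ≡ ℤ.∣ ↥ p ∣
  ∣↥-p∣ = trans (cong ℤ.∣_∣ (ℚ.↥-neg p)) (ℤ.∣-i∣≡∣i∣ (↥ p))

bounded-above : ∀ x → ∃ λ (K : ℤ) → x ≤ᵣ fromℤ K
bounded-above x with cauchy x 1ℚ (ℚ.positive⁻¹ 1ℚ)
... | N , close = ℤ.+ ℤ.∣ ↥ K ∣ , λ ε 0<ε → N , λ k N≤k →
  ℚ.≤-trans (∣p-q∣<ε⇒p≤q+ε {seq x k} (close k N N≤k ℕ.≤-refl))
    (ℚ.≤-trans (p≤ι∣↥p∣ K) (p≤p+ε (ι (ℤ.+ ℤ.∣ ↥ K ∣)) 0<ε))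
  where
  K = seq x N + 1ℚ

bounded-below : ∀ x → ∃ λ (K : ℤ) → fromℤ K ≤ᵣ x
bounded-below x = negate (bounded-above ((- 1ℚ) · x))
  where
  negate : (∃ λ (K : ℤ) → (- 1ℚ) · x ≤ᵣ fromℤ K) → ∃ λ (K : ℤ) → fromℤ K ≤ᵣ x
  negate (K , le) = ℤ.- K , ≤ᵣ-by₁ {(- 1ℚ) · x} {fromℤ K} {fromℤ (ℤ.- K)} {x} le λ k →
    trans (cong (_- seq x k) (ι-neg K))
      (solve 2 (λ a x → :- a :- x := (:- con 1ℚ) :* x :- a) refl (ι K) (seq x k))

seq-sumᵣ : (v : Vector ℝ n) → ∀ k → seq (sumᵣ v) k ≡ sum (λ j → seq (v j) k)
seq-sumᵣ {zero}  v k = refl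
seq-sumᵣ {suc n} v k = cong (_+_ (seq (v zero) k)) (seq-sumᵣ (tail v) k)

seq-*ᵥ : (M : Matrix ℚ m n) (x : Vector ℝ n) → ∀ i k →
  seq ((M *ᵥ x) i) k ≡ (M ✶ᵥ λ j → seq (x j) k) i
seq-*ᵥ M x i k = seq-sumᵣ (λ j → M i j · x j) k

sumᵣ-cong : (u v : Vector ℝ n) → (∀ j → u j ≈ v j) → sumᵣ u ≈ sumᵣ v
sumᵣ-cong {zero}  u v u≈v = ≤ᵣ-refl {fromℚ 0ℚ} , ≤ᵣ-refl {fromℚ 0ℚ}
sumᵣ-cong {suc n} u v u≈v = +ᵣ-cong {u zero} {v zero} {sumᵣ (tail u)} {sumᵣ (tail v)}
  (u≈v zero) (sumᵣ-cong (tail u) (tail v) (λ j → u≈v (suc j)))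

*ᵥ-cong : (M : Matrix ℚ m n) (x y : Vector ℝ n) → (∀ j → x j ≈ y j) → ∀ i → (M *ᵥ x) i ≈ (M *ᵥ y) i
*ᵥ-cong M x y x≈y i = sumᵣ-cong (λ j → M i j · x j) (λ j → M i j · y j)
  (λ j → ·-cong {x j} {y j} (M i j) (x≈y j))

Constant : Vector ℝ n → Vector ℚ n → Set
Constant X x = ∀ j k → seq (X j) k ≡ x j

*ᵥ-constant : (M : Matrix ℚ m n) (X : Vector ℝ n) (x : Vector ℚ n) → Constant X x →
  ∀ i → (M *ᵥ X) i ≈ fromℚ ((M ✶ᵥ x) i)
*ᵥ-constant M X x X≡x i = ≈-pointwise {(M *ᵥ X) i} {fromℚ ((M ✶ᵥ x) i)} λ k →
  trans (seq-*ᵥ M X i k) (sum-cong-≗ λ j → cong (M i j *_) (X≡x j k))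

constant-row : (M : Matrix ℚ m n) (X : Vector ℝ n) (x : Vector ℚ n) → Constant X x →
  ∀ i c → (M ✶ᵥ x) i ≡ c → (M *ᵥ X) i ≈ fromℚ c
constant-row M X x X≡x i c eq = subst (λ c → (M *ᵥ X) i ≈ fromℚ c) eq (*ᵥ-constant M X x X≡x i)

constant-row⁻ : (M : Matrix ℚ m n) (X : Vector ℝ n) (x : Vector ℚ n) → Constant X x →
  ∀ i c → (M *ᵥ X) i ≈ fromℚ c → (M ✶ᵥ x) i ≡ c
constant-row⁻ M X x X≡x i c eq = fromℚ-injective {(M ✶ᵥ x) i} {c}
  (≈-trans {fromℚ ((M ✶ᵥ x) i)} {(M *ᵥ X) i} {fromℚ c}
    (≈-sym {(M *ᵥ X) i} {fromℚ ((M ✶ᵥ x) i)} (*ᵥ-constant M X x X≡x i)) eq)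

constant-affine : (A : Matrix ℚ m n) (b : Vector ℚ m) (X : Vector ℝ n) (x : Vector ℚ n) →
  Constant X x → A ✶ᵥ x ≗ b → affineSpace A b X
constant-affine A b X x X≡x Ax≡b i = constant-row A X x X≡x i (b i) (Ax≡b i)

constant-affine⁻ : (A : Matrix ℚ m n) (b : Vector ℚ m) (X : Vector ℝ n) (x : Vector ℚ n) →
  Constant X x → affineSpace A b X → A ✶ᵥ x ≗ b
constant-affine⁻ A b X x X≡x AX≈b i = constant-row⁻ A X x X≡x i (b i) (AX≈b i)

✶ᵥ-linear : ∀ a b (M : Matrix ℚ m n) (x y : Vector ℚ n) i →
  (M ✶ᵥ λ j → a * x j + b * y j) i ≡ a * (M ✶ᵥ x) i + b * (M ✶ᵥ y) i
✶ᵥ-linear a b M x y i = trans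
  (sum-cong-≗ λ j → solve 5 (λ m a x b y → m :* (a :* x :+ b :* y) := a :* (m :* x) :+ b :* (m :* y))
    refl (M i j) a (x j) b (y j))
  (sum-linear a b (λ j → M i j * x j) (λ j → M i j * y j))

lincomb : ℚ → Vector ℝ n → ℚ → Vector ℝ n → Vector ℝ n
lincomb a x b y j = a · x j +ᵣ b · y j

*ᵥ-lincomb : ∀ (M : Matrix ℚ m n) a x b y i k →
  seq ((M *ᵥ lincomb a x b y) i) k ≡ a * seq ((M *ᵥ x) i) k + b * seq ((M *ᵥ y) i) k
*ᵥ-lincomb M a x b y i k = trans (seq-*ᵥ M (lincomb a x b y) i k)
  (trans (✶ᵥ-linear a b M (λ j → seq (x j) k) (λ j → seq (y j) k) i)
    (sym (cong₂ (λ u v → a * u + b * v) (seq-*ᵥ M x i k) (seq-*ᵥ M y i k))))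

affine-lincomb : (A : Matrix ℚ m n) (b c : Vector ℚ m) → ∀ s t x y →
  affineSpace A b x → affineSpace A c y → affineSpace A (λ i → s * b i + t * c i) (lincomb s x t y)
affine-lincomb A b c s t x y Ax≈b Ay≈c i =
  ≈-trans {(A *ᵥ lincomb s x t y) i} {s · (A *ᵥ x) i +ᵣ t · (A *ᵥ y) i} {fromℚ (s * b i + t * c i)}
    (≈-pointwise {(A *ᵥ lincomb s x t y) i} {s · (A *ᵥ x) i +ᵣ t · (A *ᵥ y) i} (*ᵥ-lincomb A s x t y i))
    (≈-trans {s · (A *ᵥ x) i +ᵣ t · (A *ᵥ y) i} {s · fromℚ (b i) +ᵣ t · fromℚ (c i)} {fromℚ (s * b i + t * c i)}
      (+ᵣ-cong {s · (A *ᵥ x) i} {s · fromℚ (b i)} {t · (A *ᵥ y) i} {t · fromℚ (c i)}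
        (·-cong {(A *ᵥ x) i} {fromℚ (b i)} s (Ax≈b i)) (·-cong {(A *ᵥ y) i} {fromℚ (c i)} t (Ay≈c i)))
      (≈-pointwise {s · fromℚ (b i) +ᵣ t · fromℚ (c i)} {fromℚ (s * b i + t * c i)} λ _ → refl))

affine-cong : (A : Matrix ℚ m n) {b c : Vector ℚ m} → b ≗ c → affineSpace A b ≐ affineSpace A c
affine-cong A b≗c =
  (λ {x} eq i → subst (λ t → (A *ᵥ x) i ≈ fromℚ t) (b≗c i) (eq i)) ,
  (λ {x} eq i → subst (λ t → (A *ᵥ x) i ≈ fromℚ t) (sym (b≗c i)) (eq i))

affine-combination : (A : Matrix ℚ m n) (b : Vector ℚ m) → ∀ s t x y → s + t ≡ 1ℚ →
  affineSpace A b x → affineSpace A b y → affineSpace A b (lincomb s x t y)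
affine-combination A b s t x y s+t≡1 Ax≈b Ay≈b = proj₁
  (affine-cong A λ i → trans (sym (ℚ.*-distribʳ-+ (b i) s t)) (trans (cong (_* b i) s+t≡1) (ℚ.*-identityˡ (b i))))
  {lincomb s x t y} (affine-lincomb A b b s t x y Ax≈b Ay≈b)

-- Polyhedra and faces

-- If the segment from w to x can be prolonged beyond x inside P, then every
-- face of P that contains x also contains w.
face-absorbs : {P F : Pred (Vector ℝ n) 0ℓ} → IsFace P F → ∀ {x w s} → 0ℚ < s →
  F x → P w → P (lincomb (1ℚ + s) x (- s) w) → F w
face-absorbs (_ , m , M , d , I , P≐ , F≐) {x} {w} {s} 0<s Fx Pw Py =
  proj₂ F≐ (Pw , λ i i∈I → proj₁ P≐ Pw i , tight i i∈I)
  where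
  0≤1+s : 0ℚ ≤ 1ℚ + s
  0≤1+s = ℚ.<⇒≤ (ℚ.+-mono-< (ℚ.positive⁻¹ 1ℚ) 0<s)
  -- At a tight row `x` has value `d i`, so the prolonged point has value `(1ℚ + s) * d i` minus `s`
  -- times the value at `w`. That this is at most `d i` is the claim.
  scaled : ∀ i → i ∈ₛ I → s · fromℚ (d i) ≤ᵣ s · (M *ᵥ w) i
  scaled i i∈I = ≤ᵣ-by₂ {(M *ᵥ lincomb (1ℚ + s) x (- s) w) i} {fromℚ (d i)} {(1ℚ + s) · fromℚ (d i)} {(1ℚ + s) · (M *ᵥ x) i}
    {s · fromℚ (d i)} {s · (M *ᵥ w) i}
    (proj₁ P≐ Py i)
    (·-mono {fromℚ (d i)} {(M *ᵥ x) i} 0≤1+s (proj₂ (proj₂ (proj₁ F≐ Fx) i i∈I)))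
    λ k → trans
      (solve 4 (λ s d x w → s :* d :- s :* w :=
         ((con 1ℚ :+ s) :* x :+ (:- s) :* w :- d) :+ ((con 1ℚ :+ s) :* d :- (con 1ℚ :+ s) :* x))
         refl s (d i) (seq ((M *ᵥ x) i) k) (seq ((M *ᵥ w) i) k))
      (cong (λ t → (t - d i) + ((1ℚ + s) * d i - (1ℚ + s) * seq ((M *ᵥ x) i) k))
        (sym (*ᵥ-lincomb M (1ℚ + s) x (- s) w i k)))
  tight : ∀ i → i ∈ₛ I → fromℚ (d i) ≤ᵣ (M *ᵥ w) i
  tight i i∈I = ·-cancel {fromℚ (d i)} {(M *ᵥ w) i} 0<s (scaled i i∈I)

whole-face : {P : Pred (Vector ℝ n) 0ℓ} → IsPolyhedron P → Satisfiable P → IsFace P P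
whole-face (m , M , d , P≐) sat =
  sat , m , M , d , ⊥ , P≐ ,
  (λ {x} Px → Px , λ i i∈⊥ → contradiction i∈⊥ ∉⊥) , (λ {x} → proj₁)

integer-point : {P : Pred (Vector ℝ n) 0ℓ} → IsInteger P → Satisfiable P →
  ∃ λ (z : Vector ℤ n) → P (λ j → fromℤ (z j))
integer-point {P = P} (isPoly , faces) sat = faces P (whole-face isPoly sat)

solutions-resp : {P Q : Pred (Vector ℝ n) 0ℓ} (M : Matrix ℚ m n) (d : Vector ℚ m) →
  P ≐ Q → P ≐ solutions M d → Q ≐ solutions M d
solutions-resp M d (P⊆Q , Q⊆P) (P⊆S , S⊆P) =
  (λ {x} Qx → P⊆S {x} (Q⊆P {x} Qx)) , (λ {x} Sx → P⊆Q {x} (S⊆P {x} Sx))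

isPolyhedron-resp : {P Q : Pred (Vector ℝ n) 0ℓ} → P ≐ Q → IsPolyhedron P → IsPolyhedron Q
isPolyhedron-resp P≐Q (m , M , d , P≐S) = m , M , d , solutions-resp M d P≐Q P≐S

isFace-resp : {P Q F : Pred (Vector ℝ n) 0ℓ} → P ≐ Q → IsFace P F → IsFace Q F
isFace-resp P≐Q@(P⊆Q , Q⊆P) (sat , m , M , d , I , P≐S , F⊆ , ⊆F) =
  sat , m , M , d , I , solutions-resp M d P≐Q P≐S ,
  (λ {x} Fx → P⊆Q {x} (proj₁ (F⊆ {x} Fx)) , proj₂ (F⊆ {x} Fx)) ,
  (λ {x} Qx∩t → ⊆F {x} (Q⊆P {x} (proj₁ Qx∩t) , proj₂ Qx∩t))

isInteger-resp : {P Q : Pred (Vector ℝ n) 0ℓ} → P ≐ Q → IsInteger P → IsInteger Q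
isInteger-resp P≐Q@(P⊆Q , Q⊆P) (isPoly , faces) =
  isPolyhedron-resp P≐Q isPoly , λ F face → faces F (isFace-resp (Q⊆P , P⊆Q) face)

boxInteger-resp : {P Q : Pred (Vector ℝ n) 0ℓ} → P ≐ Q → BoxInteger P → BoxInteger Q
boxInteger-resp (P⊆Q , Q⊆P) box ℓ u = isInteger-resp
  ((λ {x} Px∩b → P⊆Q {x} (proj₁ Px∩b) , proj₂ Px∩b) ,
   (λ {x} Qx∩b → Q⊆P {x} (proj₁ Qx∩b) , proj₂ Qx∩b))
  (box ℓ u)

SatisfiesRow : Vector ℝ n → Vector ℚ n → ℚ → Set
SatisfiesRow x row c = sumᵣ (λ j → row j · x j) ≤ᵣ fromℚ c

↑-elim : ∀ m {n} (R : Fin (m ℕ.+ n) → Set) → (∀ i → R (i ↑ˡ n)) → (∀ i → R (m ↑ʳ i)) → ∀ k → R k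
↑-elim m {n} R l r k = subst R (Fin.join-splitAt m n k) (cases (splitAt m k))
  where
  cases : ∀ s → R (join m n s)
  cases (inj₁ i) = l i
  cases (inj₂ i) = r i

solutions-++ : (M : Matrix ℚ m n) (d : Vector ℚ m) (M′ : Matrix ℚ p n) (d′ : Vector ℚ p) → ∀ x →
  solutions M d x → solutions M′ d′ x → solutions (M ++ M′) (d ++ d′) x
solutions-++ {m = m} {p = m′} M d M′ d′ x Sx S′x =
  ↑-elim m (λ k → SatisfiesRow x ((M ++ M′) k) ((d ++ d′) k))
    (λ i → subst₂ (SatisfiesRow x) {M i} {(M ++ M′) (i ↑ˡ m′)} {d i} {(d ++ d′) (i ↑ˡ m′)}
      (sym (lookup-++ˡ M M′ i)) (sym (lookup-++ˡ d d′ i)) (Sx i))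
    (λ i → subst₂ (SatisfiesRow x) {M′ i} {(M ++ M′) (m ↑ʳ i)} {d′ i} {(d ++ d′) (m ↑ʳ i)}
      (sym (lookup-++ʳ M M′ i)) (sym (lookup-++ʳ d d′ i)) (S′x i))

solutions-++⁻ : (M : Matrix ℚ m n) (d : Vector ℚ m) (M′ : Matrix ℚ p n) (d′ : Vector ℚ p) → ∀ x →
  solutions (M ++ M′) (d ++ d′) x → solutions M d x × solutions M′ d′ x
solutions-++⁻ {m = m} {p = m′} M d M′ d′ x Sx =
  (λ i → subst₂ (SatisfiesRow x) {(M ++ M′) (i ↑ˡ m′)} {M i} {(d ++ d′) (i ↑ˡ m′)} {d i}
    (lookup-++ˡ M M′ i) (lookup-++ˡ d d′ i) (Sx (i ↑ˡ m′))) ,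
  (λ i → subst₂ (SatisfiesRow x) {(M ++ M′) (m ↑ʳ i)} {M′ i} {(d ++ d′) (m ↑ʳ i)} {d′ i}
    (lookup-++ʳ M M′ i) (lookup-++ʳ d d′ i) (Sx (m ↑ʳ i)))

∩-isPolyhedron : {P Q : Pred (Vector ℝ n) 0ℓ} → IsPolyhedron P → IsPolyhedron Q → IsPolyhedron (P ∩ Q)
∩-isPolyhedron {n} (m , M , d , P⊆S , S⊆P) (m′ , M′ , d′ , Q⊆S , S⊆Q) =
  m ℕ.+ m′ , M ++ M′ , d ++ d′ ,
  (λ {x} PQx → solutions-++ M d M′ d′ x (P⊆S {x} (proj₁ PQx)) (Q⊆S {x} (proj₂ PQx))) ,
  (λ {x} Sx → S⊆P {x} (proj₁ (solutions-++⁻ M d M′ d′ x Sx)) ,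
              S⊆Q {x} (proj₂ (solutions-++⁻ M d M′ d′ x Sx)))

neg-row : (M : Matrix ℚ m n) (x : Vector ℝ n) → ∀ i k →
  seq (((λ i j → - M i j) *ᵥ x) i) k ≡ - seq ((M *ᵥ x) i) k
neg-row M x i k = begin
  seq (((λ i j → - M i j) *ᵥ x) i) k
    ≡⟨ seq-*ᵥ (λ i j → - M i j) x i k ⟩
  sum (λ j → - M i j * seq (x j) k)
    ≡⟨ sum-cong-≗ (λ j → solve 2 (λ m x → (:- m) :* x := (:- con 1ℚ) :* (m :* x)) refl (M i j) (seq (x j) k)) ⟩
  sum (λ j → (- 1ℚ) * (M i j * seq (x j) k))
    ≡⟨ *-distribˡ-sum (- 1ℚ) (λ j → M i j * seq (x j) k) ⟨
  (- 1ℚ) * (M ✶ᵥ λ j → seq (x j) k) i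
    ≡⟨ cong ((- 1ℚ) *_) (seq-*ᵥ M x i k) ⟨
  (- 1ℚ) * seq ((M *ᵥ x) i) k
    ≡⟨ solve 1 (λ x → (:- con 1ℚ) :* x := :- x) refl (seq ((M *ᵥ x) i) k) ⟩
  - seq ((M *ᵥ x) i) k ∎
  where open ≡-Reasoning

≥-isPolyhedron : (M : Matrix ℚ m n) (d : Vector ℚ m) → IsPolyhedron (λ x → ∀ i → fromℚ (d i) ≤ᵣ (M *ᵥ x) i)
≥-isPolyhedron {m} M d = m , (λ i j → - M i j) , (λ i → - d i) ,
  (λ {x} ge i → ≤ᵣ-by₁ {fromℚ (d i)} {(M *ᵥ x) i} {((λ i j → - M i j) *ᵥ x) i} {fromℚ (- d i)} (ge i)
    λ k → trans (cong (_- - d i) (neg-row M x i k))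
      (solve 2 (λ x d → :- x :- (:- d) := d :- x) refl (seq ((M *ᵥ x) i) k) (d i))) ,
  (λ {x} le i → ≤ᵣ-by₁ {((λ i j → - M i j) *ᵥ x) i} {fromℚ (- d i)} {fromℚ (d i)} {(M *ᵥ x) i} (le i)
    λ k → trans (solve 2 (λ x d → d :- x := :- x :- (:- d)) refl (seq ((M *ᵥ x) i) k) (d i))
      (cong (_- - d i) (sym (neg-row M x i k))))

affine-isPolyhedron : (A : Matrix ℚ m n) (b : Vector ℚ m) → IsPolyhedron (affineSpace A b)
affine-isPolyhedron {m} A b = isPolyhedron-resp
  ((λ (le , ge) i → le i , ge i) , (λ eq → (λ i → proj₁ (eq i)) , (λ i → proj₂ (eq i))))
  (∩-isPolyhedron (m , A , b , (λ S → S) , (λ S → S)) (≥-isPolyhedron A b))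

box-isPolyhedron : (ℓ u : Vector ℤ n) → IsPolyhedron (Box ℓ u)
box-isPolyhedron {n} ℓ u = isPolyhedron-resp
  ((λ {x} (le , ge) j →
      ≤ᵣ-by₁ {fromℤ (ℓ j)} {(δ *ᵥ x) j} {fromℤ (ℓ j)} {x j} (ge j) (λ k → cong (λ t → ι (ℓ j) - t) (sym (δ-row x j k))) ,
      ≤ᵣ-by₁ {(δ *ᵥ x) j} {fromℤ (u j)} {x j} {fromℤ (u j)} (le j) (λ k → cong (_- ι (u j)) (sym (δ-row x j k)))) ,
   (λ {x} box →
      (λ j → ≤ᵣ-by₁ {x j} {fromℤ (u j)} {(δ *ᵥ x) j} {fromℤ (u j)} (proj₂ (box j)) (λ k → cong (_- ι (u j)) (δ-row x j k))) ,
      (λ j → ≤ᵣ-by₁ {fromℤ (ℓ j)} {x j} {fromℤ (ℓ j)} {(δ *ᵥ x) j} (proj₁ (box j)) (λ k → cong (λ t → ι (ℓ j) - t) (δ-row x j k)))))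
  (∩-isPolyhedron (n , δ , (λ j → ι (u j)) , (λ S → S) , (λ S → S)) (≥-isPolyhedron δ (λ j → ι (ℓ j))))
  where
  δ-row : ∀ (x : Vector ℝ n) j k → seq ((δ *ᵥ x) j) k ≡ seq (x j) k
  δ-row x j k = trans (seq-*ᵥ δ x j k) (sum-δˡ j (λ i → seq (x i) k))

-- The whole line through `x` and `z` lies in the affine space, so any prolongation, here by `1ℚ`,
-- puts `z` into each face by `face-absorbs`.
affine-isInteger : (A : Matrix ℚ m n) (b : Vector ℚ m) (z : Vector ℤ n) →
  A ✶ᵥ (λ j → ι (z j)) ≗ b → IsInteger (affineSpace A b)
affine-isInteger A b z Az≡b = affine-isPolyhedron A b , λ F face → z , contains F face
  where
  Pz : affineSpace A b (λ j → fromℤ (z j))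
  Pz = constant-affine A b (λ j → fromℤ (z j)) (λ j → ι (z j)) (λ _ _ → refl) Az≡b
  contains : ∀ F → IsFace (affineSpace A b) F → F (λ j → fromℤ (z j))
  contains F face@((x , Fx) , _ , _ , _ , _ , _ , F⊆ , _) =
    face-absorbs face {x} {λ j → fromℤ (z j)} {1ℚ} (ℚ.positive⁻¹ 1ℚ) Fx Pz
      (affine-combination A b (1ℚ + 1ℚ) (- 1ℚ) x (λ j → fromℤ (z j)) refl (proj₁ (F⊆ {x} Fx)) Pz)

-- Dilations of affine spaces

scale-affine : (A : Matrix ℚ m n) (b : Vector ℚ m) → ∀ q x → affineSpace A b x →
  affineSpace A (λ i → q * b i) (λ j → q · x j)
scale-affine A b q x Ax≈b i =
  ≈-trans {(A *ᵥ (λ j → q · x j)) i} {q · (A *ᵥ x) i} {fromℚ (q * b i)}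
    (≈-pointwise {(A *ᵥ (λ j → q · x j)) i} {q · (A *ᵥ x) i} λ k → begin
      seq ((A *ᵥ (λ j → q · x j)) i) k
        ≡⟨ seq-*ᵥ A (λ j → q · x j) i k ⟩
      sum (λ j → A i j * (q * seq (x j) k))
        ≡⟨ sum-cong-≗ (λ j → solve 3 (λ a q x → a :* (q :* x) := q :* (a :* x)) refl (A i j) q (seq (x j) k)) ⟩
      sum (λ j → q * (A i j * seq (x j) k))
        ≡⟨ *-distribˡ-sum q (λ j → A i j * seq (x j) k) ⟨
      q * (A ✶ᵥ λ j → seq (x j) k) i
        ≡⟨ cong (q *_) (seq-*ᵥ A x i k) ⟨
      q * seq ((A *ᵥ x) i) k ∎)
    (≈-trans {q · (A *ᵥ x) i} {q · fromℚ (b i)} {fromℚ (q * b i)}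
      (·-cong {(A *ᵥ x) i} {fromℚ (b i)} q (Ax≈b i))
      (≈-pointwise {q · fromℚ (b i)} {fromℚ (q * b i)} λ _ → refl))
  where open ≡-Reasoning

scaling : ℚ → Pred (Vector ℝ n) 0ℓ → Pred (Vector ℝ n) 0ℓ
scaling q P y = ∃ λ x → P x × (∀ j → y j ≈ q · x j)

scaling-affine : (A : Matrix ℚ m n) (b : Vector ℚ m) → ∀ q → 0ℚ < q →
  scaling q (affineSpace A b) ≐ affineSpace A (λ i → q * b i)
scaling-affine A b q 0<q = (λ {y} → stretch {y}) , (λ {y} → shrink {y})
  where
  stretch : ∀ {y} → scaling q (affineSpace A b) y → affineSpace A (λ i → q * b i) y
  stretch {y} (x , Ax≈b , y≈qx) i =
    ≈-trans {(A *ᵥ y) i} {(A *ᵥ (λ j → q · x j)) i} {fromℚ (q * b i)}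
      (*ᵥ-cong A y (λ j → q · x j) y≈qx i)
      (scale-affine A b q x Ax≈b i)
  v : ℚ
  v = proj₁ (positive-inverse 0<q)
  qv≡1 : q * v ≡ 1ℚ
  qv≡1 = proj₂ (proj₂ (positive-inverse 0<q))
  cancel : ∀ c → q * (v * c) ≡ c
  cancel c = trans (sym (ℚ.*-assoc q v c)) (trans (cong (_* c) qv≡1) (ℚ.*-identityˡ c))
  cancel′ : ∀ c → v * (q * c) ≡ c
  cancel′ c = trans (solve 3 (λ v q c → v :* (q :* c) := q :* (v :* c)) refl v q c) (cancel c)
  shrink : ∀ {y} → affineSpace A (λ i → q * b i) y → scaling q (affineSpace A b) y
  shrink {y} Ay≈qb =
    (λ j → v · y j) ,
    proj₁ (affine-cong A {λ i → v * (q * b i)} {b} (λ i → cancel′ (b i)))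
      {λ j → v · y j} (scale-affine A (λ i → q * b i) v y Ay≈qb) ,
    (λ j → ≈-pointwise {y j} {q · (v · y j)} λ l → sym (cancel (seq (y j) l)))

-- Dilation merely rescales the right-hand side, so principal box-integrality for all `b` reduces to
-- box-integrality of those affine spaces that are integer.
dilate-affine : (A : Matrix ℚ m n) (b : Vector ℚ m) → ∀ k → 0 ℕ.< k →
  dilate k (affineSpace A b) ≐ affineSpace A (λ i → (ℤ.+ k / 1) * b i)
dilate-affine A b k 0<k = scaling-affine A b (ℤ.+ k / 1) (0≤∧≢0⇒0< (ι-mono {ℤ.0ℤ} {ℤ.+ k} (ℤ.+≤+ ℕ.z≤n))
  λ eq → ℕ.<⇒≢ 0<k (sym (ℤ.+-injective (ι-injective {ℤ.+ k} {ℤ.0ℤ} eq))))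

-- From box-integrality to equal determinants

δ-injective : {f : Fin r → Fin n} → Injective _≡_ _≡_ f → ∀ k l → δ (f k) (f l) ≡ δ k l
δ-injective {f = f} f-inj k l with k Fin.≟ l
... | yes refl = trans (δ-refl (f k)) (sym (δ-refl k))
... | no k≢l   = trans (δ-≢ (k≢l ∘ f-inj)) (sym (δ-≢ k≢l))

scatter-outside : (f : Fin r → Fin n) (y : Vector ℚ r) → ∀ j → (∀ k → f k ≢ j) → scatter f y j ≡ 0ℚ
scatter-outside f y j j∉f = sum-zero (λ k → y k * δ (f k) j)
  λ k → trans (cong (y k *_) (δ-≢ (j∉f k))) (ℚ.*-zeroʳ (y k))

scatter-restrict : (f : Fin r → Fin n) → Injective _≡_ _≡_ f → (v : Vector ℚ n) →
  (∀ j → (∀ k → f k ≢ j) → v j ≡ 0ℚ) → scatter f (λ k → v (f k)) ≗ v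
scatter-restrict f f-inj v v≡0 j with any? (λ k → f k Fin.≟ j)
... | yes (l , refl) = trans
  (sum-cong-≗ λ k → cong (v (f k) *_) (δ-injective f-inj k l))
  (sum-δʳ l (λ k → v (f k)))
... | no j∉f = trans (scatter-outside f (λ k → v (f k)) j λ k fk≡j → j∉f (k , fk≡j))
  (sym (v≡0 j λ k fk≡j → j∉f (k , fk≡j)))

columns-restrict : (A : Matrix ℚ p n) (f : Fin r → Fin n) → Injective _≡_ _≡_ f → (v : Vector ℚ n) →
  (∀ j → (∀ k → f k ≢ j) → v j ≡ 0ℚ) → columns f A ✶ᵥ (λ k → v (f k)) ≗ A ✶ᵥ v
columns-restrict A f f-inj v v≡0 i = trans
  (sym (scatter-solves A f (λ k → v (f k)) i))
  (sum-cong-≗ λ j → cong (A i j *_) (scatter-restrict f f-inj v v≡0 j))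

-- The box [-|p|, |p|], where p is the numerator of x, is {0} for x = 0.
integer-point-near : (A : Matrix ℚ r n) (b : Vector ℚ r) → BoxInteger (affineSpace A b) →
  (x : Vector ℚ n) → A ✶ᵥ x ≗ b →
  ∃ λ (z : Vector ℤ n) → A ✶ᵥ (λ j → ι (z j)) ≗ b × (∀ j → x j ≡ 0ℚ → z j ≡ ℤ.0ℤ)
integer-point-near {n = n} A b box x Ax≡b = extract
  (integer-point (box (λ j → ℤ.- (ℤ.+ ℤ.∣ ↥ x j ∣)) (λ j → ℤ.+ ℤ.∣ ↥ x j ∣))
    ((λ j → fromℚ (x j)) ,
     constant-affine A b (λ j → fromℚ (x j)) x (λ _ _ → refl) Ax≡b ,
     λ j → fromℚ-mono (-ι∣↥p∣≤p (x j)) , fromℚ-mono (p≤ι∣↥p∣ (x j))))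
  where
  extract : (∃ λ (z : Vector ℤ n) → affineSpace A b (λ j → fromℤ (z j)) ×
      Box (λ j → ℤ.- (ℤ.+ ℤ.∣ ↥ x j ∣)) (λ j → ℤ.+ ℤ.∣ ↥ x j ∣) (λ j → fromℤ (z j))) →
    ∃ λ (z : Vector ℤ n) → A ✶ᵥ (λ j → ι (z j)) ≗ b × (∀ j → x j ≡ 0ℚ → z j ≡ ℤ.0ℤ)
  extract (z , Az≈b , near) = z ,
    constant-affine⁻ A b (λ j → fromℤ (z j)) (λ j → ι (z j)) (λ _ _ → refl) Az≈b ,
    λ j xj≡0 → ℤ.≤-antisym
      (subst (λ q → z j ℤ.≤ ℤ.+ ℤ.∣ ↥ q ∣) xj≡0 (fromℤ-cancel (proj₂ (near j))))
      (subst (λ q → ℤ.- (ℤ.+ ℤ.∣ ↥ q ∣) ℤ.≤ z j) xj≡0 (fromℤ-cancel (proj₁ (near j))))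

-- The rational basic solution is zero outside `f`. The integer point near it is zero there too, so
-- its entries at `f` already solve the square system.
basic-integer-solution : (A : Matrix ℚ r n) (b : Vector ℚ r) → BoxInteger (affineSpace A b) →
  (f : Fin r → Fin n) → Injective _≡_ _≡_ f → det (columns f A) ≢ 0ℚ →
  ∃ λ (w : Vector ℤ r) → columns f A ✶ᵥ (λ k → ι (w k)) ≗ b
basic-integer-solution {r} {n} A b box f f-inj det≢0 =
  restrict (full-rank-solvable (columns f A) (det≢0⇒full-rank (columns f A) det≢0) b)
  where
  restrict : (∃ λ y → columns f A ✶ᵥ y ≗ b) → ∃ λ (w : Vector ℤ r) → columns f A ✶ᵥ (λ k → ι (w k)) ≗ b
  restrict (y , solves) = supported
    (integer-point-near A b box (scatter f y) λ i → trans (scatter-solves A f y i) (solves i))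
    where
    supported : (∃ λ (z : Vector ℤ n) → A ✶ᵥ (λ j → ι (z j)) ≗ b × (∀ j → scatter f y j ≡ 0ℚ → z j ≡ ℤ.0ℤ)) →
      ∃ λ (w : Vector ℤ r) → columns f A ✶ᵥ (λ k → ι (w k)) ≗ b
    supported (z , Az≡b , zeros) = (λ k → z (f k)) , λ i → trans
      (columns-restrict A f f-inj (λ j → ι (z j))
        (λ j j∉f → cong ι (zeros j (scatter-outside f y j j∉f))) i)
      (Az≡b i)

integral-δ : (i j : Fin n) → Integral (δ i j)
integral-δ i j with i Fin.≟ j
... | yes refl = ℤ.1ℤ , δ-refl i
... | no i≢j   = ℤ.0ℤ , δ-≢ i≢j

-- Every integer point yields an integer right-hand side, so the columns of
-- one basis are integer combinations of the columns of any other one; the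
-- two change-of-basis matrices have integer determinants with product 1.
box-integer⇒equal-dets : (A : Matrix ℚ r n) →
  (∀ (z : Vector ℤ n) → BoxInteger (affineSpace A (A ✶ᵥ (λ j → ι (z j))))) →
  (f g : Fin r → Fin n) → Injective _≡_ _≡_ f → Injective _≡_ _≡_ g →
  det (columns f A) ≢ 0ℚ → det (columns g A) ≢ 0ℚ →
  ∣ det (columns f A) ∣ ≡ ∣ det (columns g A) ∣
box-integer⇒equal-dets {r} {n} A box f g f-inj g-inj f≢0 g≢0 =
  let (a , g≡fa) = ratio f f-inj f≢0 g
      (b , f≡gb) = ratio g g-inj g≢0 f
  in sym (begin
    ∣ det (columns g A) ∣                     ≡⟨ cong ∣_∣ g≡fa ⟩
    ∣ det (columns f A) * ι a ∣               ≡⟨ ℚ.∣p*q∣≡∣p∣*∣q∣ (det (columns f A)) (ι a) ⟩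
    ∣ det (columns f A) ∣ * ∣ ι a ∣           ≡⟨ cong (∣ det (columns f A) ∣ *_) (unit-abs a b (product a b g≡fa f≡gb)) ⟩
    ∣ det (columns f A) ∣ * 1ℚ                ≡⟨ ℚ.*-identityʳ ∣ det (columns f A) ∣ ⟩
    ∣ det (columns f A) ∣                     ∎)
  where
  open ≡-Reasoning
  ratio : ∀ f → Injective _≡_ _≡_ f → det (columns f A) ≢ 0ℚ → ∀ g →
    ∃ λ a → det (columns g A) ≡ det (columns f A) * ι a
  ratio f f-inj f≢0 g = proj₁ integral , (begin
    det (columns g A)               ≡⟨ det-ext r (λ i k → trans (sym (right-hand-side k i)) (sym (proj₂ (sol k) i))) ⟩
    det (columns f A ✶ W)           ≡⟨ det-✶ (columns f A) W ⟩
    det (columns f A) * det W       ≡⟨ cong (det (columns f A) *_) (proj₂ integral) ⟩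
    det (columns f A) * ι (proj₁ integral) ∎)
    where
    -- With the unit vector of `g k` as integral point, the right-hand side is column `g k` of `A`;
    -- the integer solutions form the columns of the change-of-basis matrix `W`.
    e : Fin r → Vector ℤ n
    e k j = proj₁ (integral-δ (g k) j)
    sol : ∀ k → ∃ λ w → columns f A ✶ᵥ (λ j → ι (w j)) ≗ A ✶ᵥ (λ j → ι (e k j))
    sol k = basic-integer-solution A (A ✶ᵥ (λ j → ι (e k j))) (box (e k)) f f-inj f≢0
    right-hand-side : ∀ k i → (A ✶ᵥ (λ j → ι (e k j))) i ≡ A i (g k)
    right-hand-side k i = trans
      (sum-cong-≗ λ j → cong (A i j *_) (trans (sym (proj₂ (integral-δ (g k) j))) (δ-sym (g k) j)))
      (sum-δʳ (g k) (A i))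
    W : Matrix ℚ r r
    W l k = ι (proj₁ (sol k) l)
    integral : Integral (det W)
    integral = integral-det W λ l k → proj₁ (sol k) l , refl
  product : ∀ a b → det (columns g A) ≡ det (columns f A) * ι a →
    det (columns f A) ≡ det (columns g A) * ι b → ι a * ι b ≡ 1ℚ
  product a b g≡fa f≡gb = sym (*-cancelʳ-≢0 (det (columns f A)) f≢0 (begin
    1ℚ * det (columns f A)              ≡⟨ ℚ.*-identityˡ (det (columns f A)) ⟩
    det (columns f A)                   ≡⟨ f≡gb ⟩
    det (columns g A) * ι b             ≡⟨ cong (_* ι b) g≡fa ⟩
    det (columns f A) * ι a * ι b       ≡⟨ solve 3 (λ f a b → f :* a :* b := a :* b :* f) refl (det (columns f A)) (ι a) (ι b) ⟩
    ι a * ι b * det (columns f A)       ∎))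

dilate-1-affine : (A : Matrix ℚ m n) (b : Vector ℚ m) → dilate 1 (affineSpace A b) ≐ affineSpace A b
dilate-1-affine A b =
  (λ {x} Dx → proj₁ (affine-cong A 1b≗b) {x} (proj₁ (dilate-affine A b 1 (ℕ.s≤s ℕ.z≤n)) {x} Dx)) ,
  (λ {x} Px → proj₂ (dilate-affine A b 1 (ℕ.s≤s ℕ.z≤n)) {x} (proj₂ (affine-cong A 1b≗b) {x} Px))
  where
  1b≗b : (λ i → (ℤ.+ 1 / 1) * b i) ≗ b
  1b≗b i = ℚ.*-identityˡ (b i)

-- The hypothesis is applied with `k = 1`, to right-hand sides for which the integral point `z`
-- makes the affine space integer.
principally-box-integer⇒equimodular : (A : Matrix ℚ r n) → FullRowRank A →
  (∀ b → PrincipallyBoxInteger (affineSpace A b)) → Equimodular A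
principally-box-integer⇒equimodular A rank pbi = rank , box-integer⇒equal-dets A λ z →
  box (A ✶ᵥ (λ j → ι (z j))) (affine-isInteger A (A ✶ᵥ (λ j → ι (z j))) z (λ _ → refl))
  where
  box : ∀ b → IsInteger (affineSpace A b) → BoxInteger (affineSpace A b)
  box b int = boxInteger-resp D≐P (pbi b 1 (ℕ.s≤s ℕ.z≤n) (isInteger-resp P≐D int))
    where
    D≐P : dilate 1 (affineSpace A b) ≐ affineSpace A b
    D≐P = dilate-1-affine A b
    P≐D : affineSpace A b ≐ dilate 1 (affineSpace A b)
    P≐D = (λ {x} → proj₂ D≐P {x}) , (λ {x} → proj₁ D≐P {x})

-- Exchanging a column of a basis

Unit : ℚ → Set
Unit q = q ≡ 1ℚ ⊎ q ≡ - 1ℚ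

unit≢0 : ∀ {q} → Unit q → q ≢ 0ℚ
unit≢0 (inj₁ refl) ()
unit≢0 (inj₂ refl) ()

unit-neg : ∀ {q} → Unit q → Unit (- q)
unit-neg (inj₁ refl) = inj₂ refl
unit-neg (inj₂ refl) = inj₁ refl

unit-integral : ∀ {q} → Unit q → Integral q
unit-integral (inj₁ refl) = ℤ.1ℤ , refl
unit-integral (inj₂ refl) = ℤ.-1ℤ , refl

∣q∣≡1⇒unit : ∀ q → ∣ q ∣ ≡ 1ℚ → Unit q
∣q∣≡1⇒unit q ∣q∣≡1 with ℚ.∣p∣≡p∨∣p∣≡-p q
... | inj₁ eq = inj₁ (trans (sym eq) ∣q∣≡1)
... | inj₂ eq = inj₂ (trans (solve 1 (λ q → q := :- (:- q)) refl q) (cong -_ (trans (sym eq) ∣q∣≡1)))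

invertible-columns-injective : (A : Matrix ℚ r n) (g : Fin r → Fin n) → Invertible (columns g A) →
  Injective _≡_ _≡_ g
invertible-columns-injective A g ig {k} {l} gk≡gl with k Fin.≟ l
... | yes k≡l = k≡l
... | no k≢l  = contradiction
  (trans (sym (δ-refl k)) (trans (sym (inverseˡ ig k k))
    (trans (sum-cong-≗ λ p → cong (λ j → inverse ig k p * A p j) gk≡gl)
      (trans (inverseˡ ig k l) (δ-≢ k≢l)))))
  ℚ.1≢0

replaceColumn-✶ : (C : Matrix ℚ r r) (l : Fin r) (d : Vector ℚ r) →
  C ✶ replaceColumn δ l d ≋ replaceColumn C l (C ✶ᵥ d)
replaceColumn-✶ C l d i k with k Fin.≟ l
... | yes refl = trans
  (sum-cong-≗ λ p → cong (C i p *_) (updateAt-updates k (δ p)))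
  (sym (updateAt-updates k (C i)))
... | no k≢l = trans
  (sum-cong-≗ λ p → cong (C i p *_) (updateAt-minimal k l (δ p) k≢l))
  (trans (sum-δʳ k (C i)) (sym (updateAt-minimal k l (C i) k≢l)))

column : Matrix ℚ m n → Fin n → Vector ℚ m
column A j i = A i j

module _ (A : Matrix ℚ r n) (g : Fin r → Fin n) (ig : Invertible (columns g A)) (j : Fin n) where

  -- Column `j` of the tableau: its entry `k` is `(inverse ig ✶ A) k j` by definition, so
  -- `coordinate-unit` also speaks about tableau rows.
  coordinates : Vector ℚ r
  coordinates = inverse ig ✶ᵥ column A j

  coordinates-solve : columns g A ✶ᵥ coordinates ≗ column A j
  coordinates-solve = invertible-solvable (columns g A) ig (column A j)

  module _ (l : Fin r) where

    exchange : Fin r → Fin n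
    exchange = updateAt g l (const j)

    columns-exchange : replaceColumn (columns g A) l (column A j) ≋ columns exchange A
    columns-exchange i k = sym (updateAt-map (A i) g l j k)

    exchange-invertible : coordinates l ≢ 0ℚ → Invertible (columns exchange A)
    exchange-invertible d≢0 =
      invertible-≋ columns-exchange (replaceColumn-invertible ig l (column A j) d≢0)

    det-exchange : det (columns exchange A) ≡ det (columns g A) * coordinates l
    det-exchange = begin
      det (columns exchange A)
        ≡⟨ det-ext r (λ i k → trans (replaceColumn-✶ (columns g A) l coordinates i k)
             (trans (replaceColumn-cong i k) (columns-exchange i k))) ⟨
      det (columns g A ✶ replaceColumn δ l coordinates)
        ≡⟨ det-✶ (columns g A) (replaceColumn δ l coordinates) ⟩
      det (columns g A) * det (replaceColumn δ l coordinates)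
        ≡⟨ cong (det (columns g A) *_) (det-replaceColumn-δ l coordinates) ⟩
      det (columns g A) * coordinates l ∎
      where
      open ≡-Reasoning
      replaceColumn-cong : replaceColumn (columns g A) l (columns g A ✶ᵥ coordinates) ≋
        replaceColumn (columns g A) l (column A j)
      replaceColumn-cong i k = cong (λ a → updateAt (columns g A i) l (const a) k) (coordinates-solve i)

    -- A nonzero coordinate makes the exchanged columns a basis as well, and the coordinate is the
    -- ratio of two determinants that equimodularity forces to agree in absolute value.
    coordinate-unit : Equimodular A → coordinates l ≡ 0ℚ ⊎ Unit (coordinates l)
    coordinate-unit (_ , equal-dets) with coordinates l ℚ.≟ 0ℚ
    ... | yes d≡0 = inj₁ d≡0
    ... | no d≢0  = inj₂ (∣q∣≡1⇒unit (coordinates l) (sym (*-cancelʳ-≢0 ∣ det (columns g A) ∣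
      (λ eq → det≢0 (ℚ.∣p∣≡0⇒p≡0 (det (columns g A)) eq))
      (begin
        1ℚ * ∣ det (columns g A) ∣
          ≡⟨ ℚ.*-identityˡ ∣ det (columns g A) ∣ ⟩
        ∣ det (columns g A) ∣
          ≡⟨ equal-dets g exchange (invertible-columns-injective A g ig)
               (invertible-columns-injective A exchange (exchange-invertible d≢0))
               det≢0 (invertible⇒det≢0 (exchange-invertible d≢0)) ⟩
        ∣ det (columns exchange A) ∣
          ≡⟨ cong ∣_∣ det-exchange ⟩
        ∣ det (columns g A) * coordinates l ∣
          ≡⟨ cong ∣_∣ (ℚ.*-comm (det (columns g A)) (coordinates l)) ⟩
        ∣ coordinates l * det (columns g A) ∣
          ≡⟨ ℚ.∣p*q∣≡∣p∣*∣q∣ (coordinates l) (det (columns g A)) ⟩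
        ∣ coordinates l ∣ * ∣ det (columns g A) ∣ ∎))))
      where
      open ≡-Reasoning
      det≢0 : det (columns g A) ≢ 0ℚ
      det≢0 = invertible⇒det≢0 ig

  -- The edge direction of the simplex method: the entering coordinate `j` grows at rate one and the
  -- basic coordinates compensate.
  direction : Vector ℚ n
  direction i = 1ℚ * δ j i + (- 1ℚ) * scatter g coordinates i

  direction-kernel : ∀ i → (A ✶ᵥ direction) i ≡ 0ℚ
  direction-kernel i = begin
    (A ✶ᵥ direction) i
      ≡⟨ ✶ᵥ-linear 1ℚ (- 1ℚ) A (δ j) (scatter g coordinates) i ⟩
    1ℚ * (A ✶ᵥ δ j) i + (- 1ℚ) * (A ✶ᵥ scatter g coordinates) i
      ≡⟨ cong₂ (λ s t → 1ℚ * s + (- 1ℚ) * t)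
           (trans (sum-cong-≗ λ k → cong (A i k *_) (δ-sym j k)) (sum-δʳ j (A i)))
           (trans (scatter-solves A g coordinates i) (coordinates-solve i)) ⟩
    1ℚ * A i j + (- 1ℚ) * A i j
      ≡⟨ solve 1 (λ a → con 1ℚ :* a :+ (:- con 1ℚ) :* a := con 0ℚ) refl (A i j) ⟩
    0ℚ ∎
    where open ≡-Reasoning

  module _ (j∉g : ∀ k → g k ≢ j) where

    direction-at : ∀ i {a b} → δ j i ≡ a → scatter g coordinates i ≡ b → direction i ≡ a - b
    direction-at i {a} {b} eq₁ eq₂ = trans
      (cong₂ (λ s t → 1ℚ * s + (- 1ℚ) * t) eq₁ eq₂)
      (solve 2 (λ a b → con 1ℚ :* a :+ (:- con 1ℚ) :* b := a :- b) refl a b)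

    direction-entering : direction j ≡ 1ℚ
    direction-entering = direction-at j (δ-refl j) (scatter-outside g coordinates j j∉g)

    direction-basic : ∀ k → direction (g k) ≡ - coordinates k
    direction-basic k = trans
      (direction-at (g k) (δ-≢ λ j≡gk → j∉g k (sym j≡gk))
        (trans (sum-cong-≗ λ l → cong (coordinates l *_)
            (δ-injective (invertible-columns-injective A g ig) l k))
          (sum-δʳ k coordinates)))
      (ℚ.+-identityˡ (- coordinates k))

    direction-nonbasic : ∀ i → i ≢ j → (∀ k → g k ≢ i) → direction i ≡ 0ℚ
    direction-nonbasic i i≢j i∉g =
      direction-at i (δ-≢ λ j≡i → i≢j (sym j≡i)) (scatter-outside g coordinates i i∉g)

    -- Records why a coordinate moves in the form that pivoting needs: it is the entering one, or a
    -- basic one with a usable pivot.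
    Moving : Fin n → Set
    Moving i = i ≡ j ⊎ ∃ λ k → g k ≡ i × coordinates k ≢ 0ℚ

    direction-unit : Equimodular A → ∀ i → direction i ≡ 0ℚ ⊎ Unit (direction i) × Moving i
    direction-unit equi i with i Fin.≟ j
    ... | yes refl = inj₂ (inj₁ direction-entering , inj₁ refl)
    ... | no i≢j with any? (λ k → g k Fin.≟ i)
    ...   | no i∉g = inj₁ (direction-nonbasic i i≢j (λ k gk≡i → i∉g (k , gk≡i)))
    ...   | yes (k , refl) = basic (coordinate-unit k equi)
      where
      basic : coordinates k ≡ 0ℚ ⊎ Unit (coordinates k) →
        direction (g k) ≡ 0ℚ ⊎ Unit (direction (g k)) × Moving (g k)
      basic (inj₁ d≡0)  = inj₁ (trans (direction-basic k) (cong -_ d≡0))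
      basic (inj₂ unit) = inj₂
        (subst Unit (sym (direction-basic k)) (unit-neg unit) , inj₂ (k , refl , unit≢0 unit))

-- Rounding

infixl 1 _>>=_

_>>=_ : ∀ {X Y : Set} → ¬ ¬ X → (X → ¬ ¬ Y) → ¬ ¬ Y
(x >>= f) k = x λ a → f a k

return : ∀ {X : Set} → X → ¬ ¬ X
return x k = k x

¬¬-all : ∀ n {P : Fin n → Set} → (∀ i → ¬ ¬ P i) → ¬ ¬ (∀ i → P i)
¬¬-all zero    _ = return λ ()
¬¬-all (suc n) p = p zero >>= λ p₀ → ¬¬-all n (λ i → p (suc i)) >>= λ ps →
  return λ { zero → p₀ ; (suc i) → ps i }

¬¬-total : ∀ x y → ¬ ¬ (x ≤ᵣ y ⊎ y ≤ᵣ x)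
¬¬-total x y = ¬¬-excluded-middle >>= λ
  { (yes x≤y) → return (inj₁ x≤y)
  ; (no x≰y)  → return (inj₂ (≰ᵣ⇒≥ᵣ {x} {y} x≰y)) }

-- Integral real numbers and rounding to neighbours

record Integer (x : ℝ) : Set where
  constructor integer
  field
    value : ℤ
    x≈value : x ≈ fromℤ value

open Integer

integer-resp : ∀ x y → x ≈ y → Integer x → Integer y
integer-resp x y x≈y (integer c x≈c) =
  integer c (≈-trans {y} {x} {fromℤ c} (≈-sym {x} {y} x≈y) x≈c)

integer-+ : ∀ x y → Integer x → Integer y → Integer (x +ᵣ y)
integer-+ x y (integer c x≈c) (integer d y≈d) = integer (c ℤ.+ d)
  (≈-trans {x +ᵣ y} {fromℤ c +ᵣ fromℤ d} {fromℤ (c ℤ.+ d)}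
    (+ᵣ-cong {x} {fromℤ c} {y} {fromℤ d} x≈c y≈d)
    (≈-pointwise {fromℤ c +ᵣ fromℤ d} {fromℤ (c ℤ.+ d)} λ _ → sym (ι-+ c d)))

integer-· : ∀ {q} x → Integral q → Integer x → Integer (q · x)
integer-· {q} x (a , q≡ιa) (integer c x≈c) = integer (a ℤ.* c)
  (≈-trans {q · x} {q · fromℤ c} {fromℤ (a ℤ.* c)}
    (·-cong {x} {fromℤ c} q x≈c)
    (≈-pointwise {q · fromℤ c} {fromℤ (a ℤ.* c)} λ _ → trans (cong (_* ι c) q≡ιa) (sym (ι-* a c))))

integer-0· : ∀ {q} x → q ≡ 0ℚ → Integer (q · x)
integer-0· {q} x q≡0 = integer ℤ.0ℤ
  (≈-pointwise {q · x} {fromℤ ℤ.0ℤ} λ k → trans (cong (_* seq x k) q≡0) (ℚ.*-zeroˡ (seq x k)))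

integer-cancelʳ : ∀ x y → Integer (x +ᵣ y) → Integer y → Integer x
integer-cancelʳ x y ix+y iy = integer-resp ((x +ᵣ y) +ᵣ (- 1ℚ) · y) x
  (≈-pointwise {(x +ᵣ y) +ᵣ (- 1ℚ) · y} {x} λ k →
    solve 2 (λ x y → (x :+ y) :+ (:- con 1ℚ) :* y := x) refl (seq x k) (seq y k))
  (integer-+ (x +ᵣ y) ((- 1ℚ) · y) ix+y (integer-· { - 1ℚ} y (ℤ.-1ℤ , refl) iy))

integer-cancelˡ : ∀ x y → Integer (x +ᵣ y) → Integer x → Integer y
integer-cancelˡ x y ix+y ix = integer-cancelʳ y x
  (integer-resp (x +ᵣ y) (y +ᵣ x)
    (≈-pointwise {x +ᵣ y} {y +ᵣ x} λ k → ℚ.+-comm (seq x k) (seq y k)) ix+y)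
  ix

sumᵣ-suc : (u : Vector ℝ (suc n)) → sumᵣ u ≈ u zero +ᵣ sumᵣ (tail u)
sumᵣ-suc u = ≈-pointwise {sumᵣ u} {u zero +ᵣ sumᵣ (tail u)} λ k →
  trans (seq-sumᵣ u k) (cong (_+_ (seq (u zero) k)) (sym (seq-sumᵣ (tail u) k)))

integer-sumᵣ : (u : Vector ℝ n) → (∀ i → Integer (u i)) → Integer (sumᵣ u)
integer-sumᵣ {zero}  u iu = integer ℤ.0ℤ (≈-pointwise {sumᵣ u} {fromℤ ℤ.0ℤ} λ k → seq-sumᵣ u k)
integer-sumᵣ {suc n} u iu = integer-resp (u zero +ᵣ sumᵣ (tail u)) (sumᵣ u)
  (≈-sym {sumᵣ u} {u zero +ᵣ sumᵣ (tail u)} (sumᵣ-suc u))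
  (integer-+ (u zero) (sumᵣ (tail u)) (iu zero) (integer-sumᵣ (tail u) (λ i → iu (suc i))))

integer-summand : (u : Vector ℝ n) → ∀ l → (∀ i → i ≢ l → Integer (u i)) →
  Integer (sumᵣ u) → Integer (u l)
integer-summand {suc n} u l iu isum = split l iu
  (integer-resp (sumᵣ u) (u zero +ᵣ sumᵣ (tail u)) (sumᵣ-suc u) isum)
  where
  split : ∀ l → (∀ i → i ≢ l → Integer (u i)) → Integer (u zero +ᵣ sumᵣ (tail u)) → Integer (u l)
  split zero    iu isum = integer-cancelʳ (u zero) (sumᵣ (tail u)) isum
    (integer-sumᵣ (tail u) (λ i → iu (suc i) λ ()))
  split (suc l) iu isum = integer-summand (tail u) l (λ i i≢l → iu (suc i) (λ { refl → i≢l refl }))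
    (integer-cancelˡ (u zero) (sumᵣ (tail u)) isum (iu zero λ ()))

-- y lies between the floor and the ceiling of x.
infix 4 _↝_

record _↝_ (x y : ℝ) : Set where
  field
    ≤-preserved : ∀ c → x ≤ᵣ fromℤ c → y ≤ᵣ fromℤ c
    ≥-preserved : ∀ c → fromℤ c ≤ᵣ x → fromℤ c ≤ᵣ y

open _↝_

↝-trans : ∀ {x y z} → x ↝ y → y ↝ z → x ↝ z
↝-trans p q = record
  { ≤-preserved = λ c → ≤-preserved q c ∘ ≤-preserved p c
  ; ≥-preserved = λ c → ≥-preserved q c ∘ ≥-preserved p c }

≈⇒↝ : ∀ x y → x ≈ y → x ↝ y
≈⇒↝ x y (x≤y , y≤x) = record
  { ≤-preserved = λ c → ≤ᵣ-trans {y} {x} {fromℤ c} y≤x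
  ; ≥-preserved = λ c c≤x → ≤ᵣ-trans {fromℤ c} {x} {y} c≤x x≤y }

integer-↝ : ∀ {x y} → x ↝ y → Integer x → Integer y
integer-↝ x↝y (integer c (x≤c , c≤x)) = integer c (≤-preserved x↝y c x≤c , ≥-preserved x↝y c c≤x)

-- A search upwards from a lower bound, with the distance `k` to the upper bound as fuel. Each
-- comparison of reals costs a double negation.
climb : ∀ k c x → fromℤ c ≤ᵣ x → x ≤ᵣ fromℤ (c ℤ.+ ℤ.+ k) →
  ¬ ¬ ∃ λ c → fromℤ c ≤ᵣ x × x ≤ᵣ fromℤ (ℤ.suc c)
climb zero c x c≤x x≤ = return (c , c≤x ,
  ≤ᵣ-trans {x} {fromℤ (c ℤ.+ ℤ.0ℤ)} {fromℤ (ℤ.suc c)} x≤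
    (fromℤ-mono {c ℤ.+ ℤ.0ℤ} {ℤ.suc c} (ℤ.≤-trans (ℤ.≤-reflexive (ℤ.+-identityʳ c)) (ℤ.i≤suc[i] c))))
climb (suc k) c x c≤x x≤ = ¬¬-total x (fromℤ (ℤ.suc c)) >>= λ
  { (inj₁ x≤1+c) → return (c , c≤x , x≤1+c)
  ; (inj₂ 1+c≤x) → climb k (ℤ.suc c) x 1+c≤x (subst (λ d → x ≤ᵣ fromℤ d) shift x≤) }
  where
  shift : c ℤ.+ ℤ.+ suc k ≡ ℤ.suc c ℤ.+ ℤ.+ k
  shift = trans (sym (ℤ.+-assoc c ℤ.1ℤ (ℤ.+ k))) (cong (ℤ._+ ℤ.+ k) (ℤ.+-comm c ℤ.1ℤ))

i+∣j-i∣≡j : ∀ {i j} → i ℤ.≤ j → i ℤ.+ ℤ.+ ℤ.∣ j ℤ.- i ∣ ≡ j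
i+∣j-i∣≡j {i} {j} i≤j = begin
  i ℤ.+ ℤ.+ ℤ.∣ j ℤ.- i ∣       ≡⟨ cong (λ k → i ℤ.+ k) (ℤ.0≤i⇒+∣i∣≡i (ℤ.i≤j⇒0≤j-i i≤j)) ⟩
  i ℤ.+ (j ℤ.- i)               ≡⟨ ℤ.+-comm i (j ℤ.- i) ⟩
  j ℤ.- i ℤ.+ i                 ≡⟨ ℤ.+-assoc j (ℤ.- i) i ⟩
  j ℤ.+ (ℤ.- i ℤ.+ i)           ≡⟨ cong (λ k → j ℤ.+ k) (ℤ.+-inverseˡ i) ⟩
  j ℤ.+ ℤ.0ℤ                    ≡⟨ ℤ.+-identityʳ j ⟩
  j                             ∎
  where open ≡-Reasoning

floor-exists : ∀ x → ¬ ¬ ∃ λ c → fromℤ c ≤ᵣ x × x ≤ᵣ fromℤ (ℤ.suc c)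
floor-exists x = between (bounded-below x) (bounded-above x)
  where
  between : (∃ λ a → fromℤ a ≤ᵣ x) → (∃ λ b → x ≤ᵣ fromℤ b) →
    ¬ ¬ ∃ λ c → fromℤ c ≤ᵣ x × x ≤ᵣ fromℤ (ℤ.suc c)
  between (a , a≤x) (b , x≤b) = climb ℤ.∣ b ℤ.- a ∣ a x a≤x
    (subst (λ d → x ≤ᵣ fromℤ d) (sym (i+∣j-i∣≡j a≤b)) x≤b)
    where
    a≤b : a ℤ.≤ b
    a≤b = fromℤ-cancel {a} {b} (≤ᵣ-trans {fromℤ a} {x} {fromℤ b} a≤x x≤b)

integer-between : ∀ x a → x ≤ᵣ fromℤ a → fromℤ a ≤ᵣ x → Integer x
integer-between x a x≤a a≤x = integer a (x≤a , a≤x)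

≥-resp-≡ : ∀ x {a c} → c ≡ a → fromℤ c ≤ᵣ x → fromℤ a ≤ᵣ x
≥-resp-≡ x refl c≤x = c≤x

c≤x≤a⇒c≤a : ∀ c x a → fromℤ c ≤ᵣ x → x ≤ᵣ fromℤ a → c ℤ.≤ a
c≤x≤a⇒c≤a c x a c≤x x≤a = fromℤ-cancel {c} {a} (≤ᵣ-trans {fromℤ c} {x} {fromℤ a} c≤x x≤a)

module _ (x : ℝ) (c : ℤ) (c≤x : fromℤ c ≤ᵣ x) (x≤1+c : x ≤ᵣ fromℤ (ℤ.suc c)) (¬ix : ¬ Integer x) where

  upper-bounds : ∀ a → x ≤ᵣ fromℤ a → ℤ.suc c ℤ.≤ a
  upper-bounds a x≤a = ℤ.i<j⇒suc[i]≤j {c} {a} (ℤ.≤∧≢⇒< {c} {a} (c≤x≤a⇒c≤a c x a c≤x x≤a)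
    λ c≡a → ¬ix (integer-between x a x≤a (≥-resp-≡ x {a} {c} c≡a c≤x)))

  lower-bounds : ∀ a → fromℤ a ≤ᵣ x → a ℤ.≤ c
  lower-bounds a a≤x = ℤ.≮⇒≥ {c} {a} λ c<a → ¬ix (integer-between x (ℤ.suc c) x≤1+c
    (≤ᵣ-trans {fromℤ (ℤ.suc c)} {fromℤ a} {x} (fromℤ-mono {ℤ.suc c} {a} (ℤ.i<j⇒suc[i]≤j {c} {a} c<a)) a≤x))

  -- The integer bounds of a non-integral `x` hold on the whole interval from `c` to `ℤ.suc c`: a
  -- sharper bound would meet `x` at an endpoint and make it integral.
  between⇒↝ : ∀ y → fromℤ c ≤ᵣ y → y ≤ᵣ fromℤ (ℤ.suc c) → x ↝ y
  between⇒↝ y c≤y y≤1+c = record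
    { ≤-preserved = λ a x≤a → ≤ᵣ-trans {y} {fromℤ (ℤ.suc c)} {fromℤ a} y≤1+c
        (fromℤ-mono {ℤ.suc c} {a} (upper-bounds a x≤a))
    ; ≥-preserved = λ a a≤x → ≤ᵣ-trans {fromℤ a} {fromℤ c} {y} (fromℤ-mono {a} {c} (lower-bounds a a≤x)) c≤y }

-- How far x can move in the direction q = ±1 before reaching an integer.
Gap : ℝ → ℚ → Set
Gap x q = Σ ℝ λ size → fromℚ 0ℚ ≤ᵣ size × Integer (x +ᵣ q · size) ×
  (∀ t → fromℚ 0ℚ ≤ᵣ t → t ≤ᵣ size → x ↝ (x +ᵣ q · t))

gap⁺ : ∀ x c → fromℤ c ≤ᵣ x → x ≤ᵣ fromℤ (ℤ.suc c) → ¬ Integer x → Gap x 1ℚ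
gap⁺ x c c≤x x≤1+c ¬ix =
  fromℤ (ℤ.suc c) +ᵣ (- 1ℚ) · x ,
  ≤ᵣ-by₁ {x} {fromℤ (ℤ.suc c)} {fromℚ 0ℚ} {fromℤ (ℤ.suc c) +ᵣ (- 1ℚ) · x} x≤1+c
    (λ k → solve 2 (λ x s → con 0ℚ :- (s :+ (:- con 1ℚ) :* x) := x :- s) refl (seq x k) (ι (ℤ.suc c))) ,
  integer (ℤ.suc c) (≈-pointwise {x +ᵣ 1ℚ · (fromℤ (ℤ.suc c) +ᵣ (- 1ℚ) · x)} {fromℤ (ℤ.suc c)}
    (λ k → solve 2 (λ x s → x :+ con 1ℚ :* (s :+ (:- con 1ℚ) :* x) := s) refl (seq x k) (ι (ℤ.suc c)))) ,
  λ t 0≤t t≤size → between⇒↝ x c c≤x x≤1+c ¬ix (x +ᵣ 1ℚ · t)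
    (≤ᵣ-by₂ {fromℤ c} {x} {fromℚ 0ℚ} {t} {fromℤ c} {x +ᵣ 1ℚ · t} c≤x 0≤t
      (λ k → solve 3 (λ c x t → c :- (x :+ con 1ℚ :* t) := (c :- x) :+ (con 0ℚ :- t)) refl
        (ι c) (seq x k) (seq t k)))
    (≤ᵣ-by₁ {t} {fromℤ (ℤ.suc c) +ᵣ (- 1ℚ) · x} {x +ᵣ 1ℚ · t} {fromℤ (ℤ.suc c)} t≤size
      (λ k → solve 3 (λ s x t → (x :+ con 1ℚ :* t) :- s := t :- (s :+ (:- con 1ℚ) :* x)) refl
        (ι (ℤ.suc c)) (seq x k) (seq t k)))

gap⁻ : ∀ x c → fromℤ c ≤ᵣ x → x ≤ᵣ fromℤ (ℤ.suc c) → ¬ Integer x → Gap x (- 1ℚ)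
gap⁻ x c c≤x x≤1+c ¬ix =
  x +ᵣ (- 1ℚ) · fromℤ c ,
  ≤ᵣ-by₁ {fromℤ c} {x} {fromℚ 0ℚ} {x +ᵣ (- 1ℚ) · fromℤ c} c≤x
    (λ k → solve 2 (λ x c → con 0ℚ :- (x :+ (:- con 1ℚ) :* c) := c :- x) refl (seq x k) (ι c)) ,
  integer c (≈-pointwise {x +ᵣ (- 1ℚ) · (x +ᵣ (- 1ℚ) · fromℤ c)} {fromℤ c}
    (λ k → solve 2 (λ x c → x :+ (:- con 1ℚ) :* (x :+ (:- con 1ℚ) :* c) := c) refl (seq x k) (ι c))) ,
  λ t 0≤t t≤size → between⇒↝ x c c≤x x≤1+c ¬ix (x +ᵣ (- 1ℚ) · t)
    (≤ᵣ-by₁ {t} {x +ᵣ (- 1ℚ) · fromℤ c} {fromℤ c} {x +ᵣ (- 1ℚ) · t} t≤size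
      (λ k → solve 3 (λ c x t → c :- (x :+ (:- con 1ℚ) :* t) := t :- (x :+ (:- con 1ℚ) :* c)) refl
        (ι c) (seq x k) (seq t k)))
    (≤ᵣ-by₂ {x} {fromℤ (ℤ.suc c)} {fromℚ 0ℚ} {t} {x +ᵣ (- 1ℚ) · t} {fromℤ (ℤ.suc c)} x≤1+c 0≤t
      (λ k → solve 3 (λ s x t → (x :+ (:- con 1ℚ) :* t) :- s := (x :- s) :+ (con 0ℚ :- t)) refl
        (ι (ℤ.suc c)) (seq x k) (seq t k)))

gap-exists : ∀ x {q} → Unit q → ¬ Integer x → ¬ ¬ Gap x q
gap-exists x (inj₁ refl) ¬ix = floor-exists x >>= λ (c , c≤x , x≤1+c) → return (gap⁺ x c c≤x x≤1+c ¬ix)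
gap-exists x (inj₂ refl) ¬ix = floor-exists x >>= λ (c , c≤x , x≤1+c) → return (gap⁻ x c c≤x x≤1+c ¬ix)

-- The ratio test: `Z` marks coordinates at rest, `G` carries the gap of a moving one, and the first
-- alternative is that nothing moves.
¬¬-minimum : ∀ n {Z G : Fin n → Set} (val : ∀ i → G i → ℝ) → (∀ i → Z i ⊎ G i) →
  ¬ ¬ ((∀ i → Z i) ⊎
       Σ (Fin n) λ i → Σ (G i) λ γ → ∀ k → Z k ⊎ Σ (G k) λ γ′ → val i γ ≤ᵣ val k γ′)
¬¬-minimum zero    val items = return (inj₁ λ ())
¬¬-minimum (suc n) {Z} {G} val items =
  ¬¬-minimum n (λ i → val (suc i)) (λ i → items (suc i)) >>= combine (items zero)
  where
  Minimum : Fin (suc n) → Set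
  Minimum i = Σ (G i) λ γ → ∀ k → Z k ⊎ Σ (G k) λ γ′ → val i γ ≤ᵣ val k γ′
  combine : Z zero ⊎ G zero →
    ((∀ i → Z (suc i)) ⊎ Σ (Fin n) λ i → Σ (G (suc i)) λ γ →
      ∀ k → Z (suc k) ⊎ Σ (G (suc k)) λ γ′ → val (suc i) γ ≤ᵣ val (suc k) γ′) →
    ¬ ¬ ((∀ i → Z i) ⊎ Σ (Fin (suc n)) Minimum)
  combine (inj₁ z) (inj₁ zs) = return (inj₁ λ { zero → z ; (suc i) → zs i })
  combine (inj₁ z) (inj₂ (i , γ , min)) =
    return (inj₂ (suc i , γ , λ { zero → inj₁ z ; (suc k) → min k }))
  combine (inj₂ γ) (inj₁ zs) = return (inj₂ (zero , γ , λ
    { zero → inj₂ (γ , ≤ᵣ-refl {val zero γ}) ; (suc k) → inj₁ (zs k) }))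
  combine (inj₂ γ₀) (inj₂ (i , γ , min)) = ¬¬-total (val zero γ₀) (val (suc i) γ) >>= λ
    { (inj₁ le) → return (inj₂ (zero , γ₀ , λ
        { zero    → inj₂ (γ₀ , ≤ᵣ-refl {val zero γ₀})
        ; (suc k) → weaken k le (min k) }))
    ; (inj₂ ge) → return (inj₂ (suc i , γ , λ
        { zero    → inj₂ (γ₀ , ge)
        ; (suc k) → min k })) }
    where
    weaken : ∀ k → val zero γ₀ ≤ᵣ val (suc i) γ →
      Z (suc k) ⊎ Σ (G (suc k)) (λ γ′ → val (suc i) γ ≤ᵣ val (suc k) γ′) →
      Z (suc k) ⊎ Σ (G (suc k)) (λ γ′ → val zero γ₀ ≤ᵣ val (suc k) γ′)
    weaken k le (inj₁ z) = inj₁ z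
    weaken k le (inj₂ (γ′ , le′)) =
      inj₂ (γ′ , ≤ᵣ-trans {val zero γ₀} {val (suc i) γ} {val (suc k) γ′} le le′)

-- The step length is the smallest gap. No coordinate passes its next integer, and the one with the
-- smallest gap lands on it; `j` guarantees that something moves.
move : (y : Vector ℝ n) (v : Vector ℚ n) → (∀ i → v i ≡ 0ℚ ⊎ Unit (v i) × ¬ Integer (y i)) →
  ∀ j → v j ≢ 0ℚ →
  ¬ ¬ ∃ λ t → (∀ i → y i ↝ (y i +ᵣ v i · t)) × ∃ λ i → v i ≢ 0ℚ × Integer (y i +ᵣ v i · t)
move {n} y v kind j vj≢0 =
  ¬¬-all n (λ i → item i (kind i)) >>= λ items →
  ¬¬-minimum n (λ i (_ , γ) → proj₁ γ) items >>= λ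
    { (inj₁ v≡0) → contradiction (v≡0 j) vj≢0
    ; (inj₂ (i , (vi≢0 , size , 0≤size , hits , _) , min)) → return
        (size , (λ k → step size 0≤size k (min k)) , i , vi≢0 , hits) }
  where
  Item : Fin n → Set
  Item i = v i ≢ 0ℚ × Gap (y i) (v i)
  item : ∀ i → v i ≡ 0ℚ ⊎ Unit (v i) × ¬ Integer (y i) → ¬ ¬ (v i ≡ 0ℚ ⊎ Item i)
  item i (inj₁ vi≡0)        = return (inj₁ vi≡0)
  item i (inj₂ (unit , ¬iy)) = gap-exists (y i) unit ¬iy >>= λ γ → return (inj₂ (unit≢0 unit , γ))
  step : ∀ t → fromℚ 0ℚ ≤ᵣ t → ∀ k → v k ≡ 0ℚ ⊎ (Σ (Item k) λ (_ , γ) → t ≤ᵣ proj₁ γ) →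
    y k ↝ (y k +ᵣ v k · t)
  step t 0≤t k (inj₁ vk≡0) = ≈⇒↝ (y k) (y k +ᵣ v k · t)
    (≈-pointwise {y k} {y k +ᵣ v k · t} λ l → sym
      (trans (cong (λ q → seq (y k) l + q * seq t l) vk≡0)
        (solve 2 (λ y t → y :+ con 0ℚ :* t := y) refl (seq (y k) l) (seq t l))))
  step t 0≤t k (inj₂ ((_ , _ , _ , _ , stays) , t≤size)) = stays t 0≤t t≤size

affine-translate : (A : Matrix ℚ m n) (b : Vector ℚ m) (y : Vector ℝ n) (v : Vector ℚ n) (t : ℝ) →
  (∀ i → (A ✶ᵥ v) i ≡ 0ℚ) → affineSpace A b y → affineSpace A b (λ i → y i +ᵣ v i · t)
affine-translate A b y v t Av≡0 Ay≈b i =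
  ≈-trans {(A *ᵥ (λ j → y j +ᵣ v j · t)) i} {(A *ᵥ y) i} {fromℚ (b i)}
    (≈-pointwise {(A *ᵥ (λ j → y j +ᵣ v j · t)) i} {(A *ᵥ y) i} λ k → begin
      seq ((A *ᵥ (λ j → y j +ᵣ v j · t)) i) k
        ≡⟨ seq-*ᵥ A (λ j → y j +ᵣ v j · t) i k ⟩
      sum (λ j → A i j * (seq (y j) k + v j * seq t k))
        ≡⟨ sum-linearʳ (seq t k) (λ j → seq (y j) k) v (A i) ⟩
      (A ✶ᵥ λ j → seq (y j) k) i + (A ✶ᵥ v) i * seq t k
        ≡⟨ cong₂ (λ a c → a + c * seq t k) (sym (seq-*ᵥ A y i k)) (Av≡0 i) ⟩
      seq ((A *ᵥ y) i) k + 0ℚ * seq t k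
        ≡⟨ solve 2 (λ a t → a :+ con 0ℚ :* t := a) refl (seq ((A *ᵥ y) i) k) (seq t k) ⟩
      seq ((A *ᵥ y) i) k ∎)
    (Ay≈b i)
  where open ≡-Reasoning

affine-✶ : (B : Matrix ℚ p m) (A : Matrix ℚ m n) (b : Vector ℚ m) (x : Vector ℝ n) →
  affineSpace A b x → affineSpace (B ✶ A) (B ✶ᵥ b) x
affine-✶ B A b x Ax≈b k =
  ≈-trans {((B ✶ A) *ᵥ x) k} {(B *ᵥ (A *ᵥ x)) k} {fromℚ ((B ✶ᵥ b) k)}
    (≈-pointwise {((B ✶ A) *ᵥ x) k} {(B *ᵥ (A *ᵥ x)) k} λ l → begin
      seq (((B ✶ A) *ᵥ x) k) l                           ≡⟨ seq-*ᵥ (B ✶ A) x k l ⟩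
      ((B ✶ A) ✶ᵥ λ j → seq (x j) l) k                   ≡⟨ ✶ᵥ-assoc B A (λ j → seq (x j) l) k ⟩
      (B ✶ᵥ (A ✶ᵥ λ j → seq (x j) l)) k                  ≡⟨ sum-cong-≗ (λ i → cong (B k i *_) (seq-*ᵥ A x i l)) ⟨
      (B ✶ᵥ λ i → seq ((A *ᵥ x) i) l) k                  ≡⟨ seq-*ᵥ B (A *ᵥ x) k l ⟨
      seq ((B *ᵥ (A *ᵥ x)) k) l                          ∎)
    (≈-trans {(B *ᵥ (A *ᵥ x)) k} {(B *ᵥ (λ i → fromℚ (b i))) k} {fromℚ ((B ✶ᵥ b) k)}
      (*ᵥ-cong B (A *ᵥ x) (λ i → fromℚ (b i)) Ax≈b k)
      (*ᵥ-constant B (λ i → fromℚ (b i)) b (λ _ _ → refl) k))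
  where open ≡-Reasoning

row-integer : (M : Matrix ℚ m n) (b : Vector ℚ m) (x : Vector ℝ n) → affineSpace M b x →
  ∀ k l → b k ≡ 0ℚ → M k l ≡ 1ℚ →
  (∀ i → i ≢ l → M k i ≡ 0ℚ ⊎ Integral (M k i) × Integer (x i)) → Integer (x l)
row-integer M b x Mx≈b k l bk≡0 Mkl≡1 others =
  integer-resp (M k l · x l) (x l)
    (≈-pointwise {M k l · x l} {x l} λ s →
      trans (cong (_* seq (x l) s) Mkl≡1) (ℚ.*-identityˡ (seq (x l) s)))
    (integer-summand (λ i → M k i · x i) l (λ i i≢l → term i (others i i≢l)) total)
  where
  total : Integer ((M *ᵥ x) k)
  total = integer ℤ.0ℤ (≈-trans {(M *ᵥ x) k} {fromℚ (b k)} {fromℤ ℤ.0ℤ} (Mx≈b k)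
    (≈-pointwise {fromℚ (b k)} {fromℤ ℤ.0ℤ} λ _ → bk≡0))
  term : ∀ i → M k i ≡ 0ℚ ⊎ Integral (M k i) × Integer (x i) → Integer (M k i · x i)
  term i (inj₁ Mki≡0)      = integer-0· {M k i} (x i) Mki≡0
  term i (inj₂ (iM , ixi)) = integer-· {M k i} (x i) iM ixi

integer-difference : ∀ x y → Integer x → Integer y → Integer (1ℚ · x +ᵣ (- 1ℚ) · y)
integer-difference x y ix iy = integer-+ (1ℚ · x) ((- 1ℚ) · y)
  (integer-· {1ℚ} x (ℤ.1ℤ , refl) ix) (integer-· { - 1ℚ} y (ℤ.-1ℤ , refl) iy)

integer-difference⁻ : ∀ x y → Integer (1ℚ · x +ᵣ (- 1ℚ) · y) → Integer y → Integer x
integer-difference⁻ x y ix-y iy = integer-resp (1ℚ · x) x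
  (≈-pointwise {1ℚ · x} {x} λ k → ℚ.*-identityˡ (seq x k))
  (integer-cancelʳ (1ℚ · x) ((- 1ℚ) · y) ix-y (integer-· { - 1ℚ} y (ℤ.-1ℤ , refl) iy))

integer-fromℤ : ∀ c → Integer (fromℤ c)
integer-fromℤ c = integer c (≤ᵣ-refl {fromℤ c} , ≤ᵣ-refl {fromℤ c})

-- The rounding walk

module Rounding (A : Matrix ℚ r n) (equi : Equimodular A) (b : Vector ℚ r)
  (z : Vector ℤ n) (Az≡b : A ✶ᵥ (λ j → ι (z j)) ≗ b) (x₀ : Vector ℝ n) where

  Reachable : Vector ℝ n → Set
  Reachable y = affineSpace A b y × (∀ j → x₀ j ↝ y j)

  State : Set
  State = Σ (Fin r → Fin n) λ g → Σ (Vector ℝ n) λ y → Invertible (columns g A) × Reachable y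

  -- A basic coordinate counts as settled even while it is not integral; it becomes integral only at
  -- the end, as a consequence of the nonbasic ones.
  Settled : (Fin r → Fin n) → Vector ℝ n → Fin n → Set
  Settled g y j = (∃ λ k → g k ≡ j) ⊎ Integer (y j)

  Done : State → Fin n → Set
  Done (g , y , _) = Settled g y

  -- The point stays where it is: `j` is settled by entering the basis, and the leaving coordinate
  -- stays settled because it is integral.
  pivot : ∀ g y (ig : Invertible (columns g A)) → Reachable y → ∀ j l →
    coordinates A g ig j l ≢ 0ℚ → Integer (y (g l)) →
    Σ State λ s → Done s j × (∀ i → Settled g y i → Done s i)
  pivot g y ig reach j l d≢0 int =
    (exchange A g ig j l , y , exchange-invertible A g ig j l d≢0 , reach) ,
    inj₁ (l , updateAt-updates l g) , old
    where
    old : ∀ i → Settled g y i → Settled (exchange A g ig j l) y i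
    old i (inj₂ iyi) = inj₂ iyi
    old i (inj₁ (k , gk≡i)) = leaving (k Fin.≟ l)
      where
      leaving : Dec (k ≡ l) → Settled (exchange A g ig j l) y i
      leaving (yes refl) = inj₂ (subst (λ i → Integer (y i)) gk≡i int)
      leaving (no k≢l)   = inj₁ (k , trans (updateAt-minimal k l g k≢l) gk≡i)

  -- Integers survive the move by `integer-↝`, and the basis is still the same. If the coordinate
  -- that has become integral is basic, it is then pivoted out in favour of `j`.
  moved : ∀ g y (ig : Invertible (columns g A)) → Reachable y → ∀ j (j∉g : ∀ k → g k ≢ j) t →
    (∀ i → y i ↝ (y i +ᵣ direction A g ig j i · t)) →
    ∀ i → Moving A g ig j j∉g i → Integer (y i +ᵣ direction A g ig j i · t) →
    Σ State λ s → Done s j × (∀ l → Settled g y l → Done s l)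
  moved g y ig (Ay≈b , x₀↝y) j j∉g t y↝y′ i moving int = arrived i moving int
    where
    reach′ : Reachable (λ i → y i +ᵣ direction A g ig j i · t)
    reach′ = affine-translate A b y (direction A g ig j) t (direction-kernel A g ig j) Ay≈b ,
      λ i → ↝-trans (x₀↝y i) (y↝y′ i)
    old : ∀ l → Settled g y l → Settled g (λ i → y i +ᵣ direction A g ig j i · t) l
    old l (inj₁ basic) = inj₁ basic
    old l (inj₂ iyl)   = inj₂ (integer-↝ (y↝y′ l) iyl)
    arrived : ∀ i → Moving A g ig j j∉g i → Integer (y i +ᵣ direction A g ig j i · t) →
      Σ State λ s → Done s j × (∀ l → Settled g y l → Done s l)
    arrived .j (inj₁ refl) int =
      (g , (λ i → y i +ᵣ direction A g ig j i · t) , ig , reach′) , inj₂ int , old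
    arrived .(g k) (inj₂ (k , refl , d≢0)) int =
      let s , new , kept = pivot g (λ i → y i +ᵣ direction A g ig j i · t) ig reach′ j k d≢0 int
      in s , new , λ l settled → kept l (old l settled)

  step : ∀ s j → ¬ ¬ Σ State λ s′ → Done s′ j × (∀ l → Done s l → Done s′ l)
  step s@(g , y , ig , reach) j = enter (any? (λ k → g k Fin.≟ j))
    where
    enter : Dec (∃ λ k → g k ≡ j) → ¬ ¬ Σ State λ s′ → Done s′ j × (∀ l → Done s l → Done s′ l)
    enter (yes basic) = return (s , inj₁ basic , λ _ done → done)
    enter (no ∄k) = ¬¬-excluded-middle >>= λ
      { (yes iyj) → return (s , inj₂ iyj , λ _ done → done)
      ; (no ¬iyj) → ¬¬-excluded-middle >>= nonintegral ¬iyj }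
      where
      j∉g : ∀ k → g k ≢ j
      j∉g k gk≡j = ∄k (k , gk≡j)
      nonintegral : ¬ Integer (y j) → Dec (∃ λ k → coordinates A g ig j k ≢ 0ℚ × Integer (y (g k))) →
        ¬ ¬ Σ State λ s′ → Done s′ j × (∀ l → Done s l → Done s′ l)
      nonintegral ¬iyj (yes (k , d≢0 , int)) = return (pivot g y ig reach j k d≢0 int)
      -- As no integral basic coordinate can be exchanged with `j`, all moving coordinates are
      -- non-integral, which is what `move` requires.
      nonintegral ¬iyj (no none) =
        move y (direction A g ig j) (λ i → kind i (direction-unit A g ig j j∉g equi i)) j
          (λ eq → ℚ.1≢0 (trans (sym (direction-entering A g ig j j∉g)) eq)) >>= λ
          (t , y↝y′ , i , vi≢0 , int) → return
            (moved g y ig reach j j∉g t y↝y′ i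
              (mobile i vi≢0 (direction-unit A g ig j j∉g equi i)) int)
        where
        nonint : ∀ i → Moving A g ig j j∉g i → ¬ Integer (y i)
        nonint .j (inj₁ refl) = ¬iyj
        nonint .(g k) (inj₂ (k , refl , d≢0)) int = none (k , d≢0 , int)
        kind : ∀ i → direction A g ig j i ≡ 0ℚ ⊎ Unit (direction A g ig j i) × Moving A g ig j j∉g i →
          direction A g ig j i ≡ 0ℚ ⊎ Unit (direction A g ig j i) × ¬ Integer (y i)
        kind i (inj₁ vi≡0)            = inj₁ vi≡0
        kind i (inj₂ (unit , moving)) = inj₂ (unit , nonint i moving)
        mobile : ∀ i → direction A g ig j i ≢ 0ℚ →
          direction A g ig j i ≡ 0ℚ ⊎ Unit (direction A g ig j i) × Moving A g ig j j∉g i → Moving A g ig j j∉g i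
        mobile i vi≢0 (inj₁ vi≡0)         = contradiction vi≡0 vi≢0
        mobile i vi≢0 (inj₂ (_ , moving)) = moving

  -- Row k of the tableau expresses the k-th basic coordinate of y - z as a
  -- combination, with coefficients 0 and ±1, of nonbasic ones.
  basic-integer : ∀ g y (ig : Invertible (columns g A)) → affineSpace A b y →
    (∀ j → Settled g y j) → ∀ k → Integer (y (g k))
  basic-integer g y ig Ay≈b settled k =
    integer-difference⁻ (y (g k)) (fromℤ (z (g k)))
      -- The right-hand side is `b` minus `b`, kept in the shape in which `affine-lincomb` delivers
      -- it; `right-hand-side` shows that it vanishes.
      (row-integer (inverse ig ✶ A) (inverse ig ✶ᵥ (λ i → 1ℚ * b i + (- 1ℚ) * b i))
        (lincomb 1ℚ y (- 1ℚ) (λ j → fromℤ (z j)))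
        (affine-✶ (inverse ig) A (λ i → 1ℚ * b i + (- 1ℚ) * b i) (lincomb 1ℚ y (- 1ℚ) (λ j → fromℤ (z j)))
          (affine-lincomb A b b 1ℚ (- 1ℚ) y (λ j → fromℤ (z j)) Ay≈b
            (constant-affine A b (λ j → fromℤ (z j)) (λ j → ι (z j)) (λ _ _ → refl) Az≡b)))
        k (g k) right-hand-side (trans (inverseˡ ig k k) (δ-refl k))
        (λ i i≢gk → entry i i≢gk (settled i) (coordinate-unit A g ig i k equi)))
      (integer-fromℤ (z (g k)))
    where
    right-hand-side : (inverse ig ✶ᵥ (λ i → 1ℚ * b i + (- 1ℚ) * b i)) k ≡ 0ℚ
    right-hand-side = sum-zero (λ i → inverse ig k i * (1ℚ * b i + (- 1ℚ) * b i)) λ i →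
      solve 2 (λ a b → a :* (con 1ℚ :* b :+ (:- con 1ℚ) :* b) := con 0ℚ) refl (inverse ig k i) (b i)
    entry : ∀ i → i ≢ g k → Settled g y i → (inverse ig ✶ A) k i ≡ 0ℚ ⊎ Unit ((inverse ig ✶ A) k i) →
      (inverse ig ✶ A) k i ≡ 0ℚ ⊎
      Integral ((inverse ig ✶ A) k i) × Integer (lincomb 1ℚ y (- 1ℚ) (λ j → fromℤ (z j)) i)
    entry i i≢gk _ (inj₁ ≡0) = inj₁ ≡0
    entry i i≢gk (inj₁ (l , refl)) (inj₂ _) =
      inj₁ (trans (inverseˡ ig k l) (δ-≢ λ k≡l → i≢gk (cong g (sym k≡l))))
    entry i i≢gk (inj₂ iyi) (inj₂ unit) = inj₂
      (unit-integral unit , integer-difference (y i) (fromℤ (z i)) iyi (integer-fromℤ (z i)))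

  settled-integer : ∀ g y (ig : Invertible (columns g A)) → affineSpace A b y →
    (∀ j → Settled g y j) → ∀ j → Integer (y j)
  settled-integer g y ig Ay≈b settled j = cases (settled j)
    where
    cases : Settled g y j → Integer (y j)
    cases (inj₁ (k , gk≡j)) = subst (λ i → Integer (y i)) gk≡j (basic-integer g y ig Ay≈b settled k)
    cases (inj₂ iyj)        = iyj

  round : affineSpace A b x₀ →
    ¬ ¬ ∃ λ (w : Vector ℤ n) → affineSpace A b (λ j → fromℤ (w j)) × (∀ j → x₀ j ↝ fromℤ (w j))
  round Ax₀≈b = establish-all (λ X → ¬ ¬ X) return _>>=_ Done step start >>= λ (s , done) → return (finish s done)
    where
    start : State
    start = let g , ig = basis-exists A (proj₁ equi)
            in g , x₀ , ig , Ax₀≈b , λ j → ≈⇒↝ (x₀ j) (x₀ j) (≤ᵣ-refl {x₀ j} , ≤ᵣ-refl {x₀ j})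
    finish : ∀ s → (∀ j → Done s j) →
      ∃ λ (w : Vector ℤ n) → affineSpace A b (λ j → fromℤ (w j)) × (∀ j → x₀ j ↝ fromℤ (w j))
    finish (g , y , ig , Ay≈b , x₀↝y) done =
      (λ j → value (int j)) ,
      (λ i → ≈-trans {(A *ᵥ (λ j → fromℤ (value (int j)))) i} {(A *ᵥ y) i} {fromℚ (b i)}
        (*ᵥ-cong A (λ j → fromℤ (value (int j))) y
          (λ j → ≈-sym {y j} {fromℤ (value (int j))} (x≈value (int j))) i)
        (Ay≈b i)) ,
      (λ j → ↝-trans (x₀↝y j) (≈⇒↝ (y j) (fromℤ (value (int j))) (x≈value (int j))))
      where
      int : ∀ j → Integer (y j)
      int = settled-integer g y ig Ay≈b done

-- Faces of boxes

-- The condition holds up to a threshold and not just at one value, so that finitely many conditions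
-- are met together at the least threshold.
Small : (ℚ → Set) → Set
Small P = ∃ λ s → 0ℚ < s × (∀ t → 0ℚ < t → t ≤ s → P t)

small-× : ∀ {P Q} → Small P → Small Q → Small (λ s → P s × Q s)
small-× (s , 0<s , Ps) (t , 0<t , Qt) with ℚ.≤-total s t
... | inj₁ s≤t = s , 0<s , λ u 0<u u≤s → Ps u 0<u u≤s , Qt u 0<u (ℚ.≤-trans u≤s s≤t)
... | inj₂ t≤s = t , 0<t , λ u 0<u u≤t → Ps u 0<u (ℚ.≤-trans u≤t t≤s) , Qt u 0<u u≤t

small-all : ∀ n {P : Fin n → ℚ → Set} → (∀ i → Small (P i)) → Small (λ s → ∀ i → P i s)
small-all zero    _   = 1ℚ , ℚ.positive⁻¹ 1ℚ , λ _ _ _ ()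
small-all (suc n) {P} all = combine (small-× {P zero} (all zero) (small-all n (λ i → all (suc i))))
  where
  combine : Small (λ s → P zero s × (∀ i → P (suc i) s)) → Small (λ s → ∀ i → P i s)
  combine (s , 0<s , Ps) = s , 0<s , λ t 0<t t≤s → λ
    { zero → proj₁ (Ps t 0<t t≤s) ; (suc i) → proj₂ (Ps t 0<t t≤s) i }

positive-witness : ∀ b → ¬ (b ≤ᵣ fromℚ 0ℚ) → ¬ ¬ ∃ λ δ → 0ℚ < δ × fromℚ δ ≤ᵣ b
positive-witness b b≰0 none = b≰0 λ ε 0<ε → eventually ε (below ε 0<ε (ε * ½) (half 0<ε))
  where
  below : ∀ ε → 0ℚ < ε → b ≤ᵣ fromℚ (ε * ½)
  below ε 0<ε = ≰ᵣ⇒≥ᵣ {fromℚ (ε * ½)} {b} λ le → none (ε * ½ , half 0<ε , le)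
  eventually : ∀ ε → (∃ λ N → ∀ k → N ℕ.≤ k → seq b k ≤ ε * ½ + ε * ½) →
    ∃ λ N → ∀ k → N ℕ.≤ k → seq b k ≤ 0ℚ + ε
  eventually ε (N , le) = N , λ k N≤k →
    subst (seq b k ≤_) (trans (half+half ε) (sym (ℚ.+-identityˡ ε))) (le k N≤k)

positive-bound : ∀ a → ∃ λ K → 0ℚ < K × a ≤ᵣ fromℚ K
positive-bound a = enlarge (bounded-above a)
  where
  enlarge : (∃ λ c → a ≤ᵣ fromℤ c) → ∃ λ K → 0ℚ < K × a ≤ᵣ fromℚ K
  enlarge (c , a≤c) = ∣ ι c ∣ + 1ℚ ,
    ℚ.+-mono-≤-< (ℚ.0≤∣p∣ (ι c)) (ℚ.positive⁻¹ 1ℚ) ,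
    ≤ᵣ-trans {a} {fromℤ c} {fromℚ (∣ ι c ∣ + 1ℚ)} a≤c
      (fromℚ-mono {ι c} {∣ ι c ∣ + 1ℚ} (ℚ.≤-trans (p≤∣p∣ (ι c)) (p≤p+ε ∣ ι c ∣ (ℚ.positive⁻¹ 1ℚ))))

-- If `a` is not at most zero, then neither is `b`, by `implies`. A rational lower bound `δ` of `b`
-- divided by a rational upper bound `K` of `a` is then a threshold.
small-multiple : ∀ a b → fromℚ 0ℚ ≤ᵣ b → (b ≤ᵣ fromℚ 0ℚ → a ≤ᵣ fromℚ 0ℚ) →
  ¬ ¬ Small (λ s → s · a ≤ᵣ b)
small-multiple a b 0≤b implies = ¬¬-excluded-middle >>= cases
  where
  cases : Dec (a ≤ᵣ fromℚ 0ℚ) → ¬ ¬ Small (λ s → s · a ≤ᵣ b)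
  cases (yes a≤0) = return (1ℚ , ℚ.positive⁻¹ 1ℚ , λ s 0<s _ →
    ≤ᵣ-trans {s · a} {s · fromℚ 0ℚ} {b} (·-mono {a} {fromℚ 0ℚ} (ℚ.<⇒≤ 0<s) a≤0)
      (≤ᵣ-trans {s · fromℚ 0ℚ} {fromℚ 0ℚ} {b}
        (≤ᵣ-pointwise {s · fromℚ 0ℚ} {fromℚ 0ℚ} λ _ → ℚ.≤-reflexive (ℚ.*-zeroʳ s)) 0≤b))
  cases (no a≰0) = positive-witness b (λ b≤0 → a≰0 (implies b≤0)) >>= λ (δ , 0<δ , δ≤b) →
    return (ratio δ 0<δ δ≤b (positive-bound a))
    where
    ratio : ∀ δ → 0ℚ < δ → fromℚ δ ≤ᵣ b → (∃ λ K → 0ℚ < K × a ≤ᵣ fromℚ K) → Small (λ s → s · a ≤ᵣ b)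
    ratio δ 0<δ δ≤b (K , 0<K , a≤K) = δ * v , 0<*0< 0<δ 0<v , λ s 0<s s≤δv →
      ≤ᵣ-trans {s · a} {s · fromℚ K} {b} (·-mono {a} {fromℚ K} (ℚ.<⇒≤ 0<s) a≤K)
        (≤ᵣ-trans {s · fromℚ K} {fromℚ δ} {b}
          (≤ᵣ-pointwise {s · fromℚ K} {fromℚ δ} λ _ → ℚ.≤-trans
            (ℚ.*-monoʳ-≤-nonNeg K {{nonNegative (ℚ.<⇒≤ 0<K)}} s≤δv)
            (ℚ.≤-reflexive (trans (ℚ.*-assoc δ v K) (trans (cong (δ *_) (trans (ℚ.*-comm v K) Kv≡1))
              (ℚ.*-identityʳ δ)))))
          δ≤b)
      where
      v : ℚ
      v = proj₁ (positive-inverse 0<K)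
      0<v : 0ℚ < v
      0<v = proj₁ (proj₂ (positive-inverse 0<K))
      Kv≡1 : K * v ≡ 1ℚ
      Kv≡1 = proj₂ (proj₂ (positive-inverse 0<K))

-- The prolonged point is `x` plus `s` times the difference of `x` and `w`. When there is no slack
-- below `u`, the relation `x ↝ w` forces `w` up to `u` and this difference is not positive.
prolong-≤ : ∀ x w u → x ↝ w → x ≤ᵣ fromℤ u →
  ¬ ¬ Small (λ s → (1ℚ + s) · x +ᵣ (- s) · w ≤ᵣ fromℤ u)
prolong-≤ x w u x↝w x≤u =
  small-multiple (x +ᵣ (- 1ℚ) · w) (fromℤ u +ᵣ (- 1ℚ) · x)
    (≤ᵣ-by₁ {x} {fromℤ u} {fromℚ 0ℚ} {fromℤ u +ᵣ (- 1ℚ) · x} x≤u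
      λ k → solve 2 (λ x u → con 0ℚ :- (u :+ (:- con 1ℚ) :* x) := x :- u) refl (seq x k) (ι u))
    (λ u-x≤0 → ≤ᵣ-by₁ {x} {w} {x +ᵣ (- 1ℚ) · w} {fromℚ 0ℚ}
      (≤ᵣ-trans {x} {fromℤ u} {w} x≤u (≥-preserved x↝w u
        (≤ᵣ-by₁ {fromℤ u +ᵣ (- 1ℚ) · x} {fromℚ 0ℚ} {fromℤ u} {x} u-x≤0
          λ k → solve 2 (λ x u → u :- x := (u :+ (:- con 1ℚ) :* x) :- con 0ℚ) refl (seq x k) (ι u))))
      λ k → solve 2 (λ x w → (x :+ (:- con 1ℚ) :* w) :- con 0ℚ := x :- w) refl (seq x k) (seq w k)) >>= λ
  (s , 0<s , small) → return (s , 0<s , λ t 0<t t≤s →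
    ≤ᵣ-by₁ {t · (x +ᵣ (- 1ℚ) · w)} {fromℤ u +ᵣ (- 1ℚ) · x} {(1ℚ + t) · x +ᵣ (- t) · w} {fromℤ u} (small t 0<t t≤s)
      λ k → solve 4 (λ x w u t → ((con 1ℚ :+ t) :* x :+ (:- t) :* w) :- u :=
        t :* (x :+ (:- con 1ℚ) :* w) :- (u :+ (:- con 1ℚ) :* x)) refl (seq x k) (seq w k) (ι u) t)

prolong-≥ : ∀ x w ℓ → x ↝ w → fromℤ ℓ ≤ᵣ x →
  ¬ ¬ Small (λ s → fromℤ ℓ ≤ᵣ (1ℚ + s) · x +ᵣ (- s) · w)
prolong-≥ x w ℓ x↝w ℓ≤x =
  small-multiple (w +ᵣ (- 1ℚ) · x) (x +ᵣ (- 1ℚ) · fromℤ ℓ)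
    (≤ᵣ-by₁ {fromℤ ℓ} {x} {fromℚ 0ℚ} {x +ᵣ (- 1ℚ) · fromℤ ℓ} ℓ≤x
      λ k → solve 2 (λ x l → con 0ℚ :- (x :+ (:- con 1ℚ) :* l) := l :- x) refl (seq x k) (ι ℓ))
    (λ x-ℓ≤0 → ≤ᵣ-by₁ {w} {x} {w +ᵣ (- 1ℚ) · x} {fromℚ 0ℚ}
      (≤ᵣ-trans {w} {fromℤ ℓ} {x} (≤-preserved x↝w ℓ
        (≤ᵣ-by₁ {x +ᵣ (- 1ℚ) · fromℤ ℓ} {fromℚ 0ℚ} {x} {fromℤ ℓ} x-ℓ≤0
          λ k → solve 2 (λ x l → x :- l := (x :+ (:- con 1ℚ) :* l) :- con 0ℚ) refl (seq x k) (ι ℓ))) ℓ≤x)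
      λ k → solve 2 (λ x w → (w :+ (:- con 1ℚ) :* x) :- con 0ℚ := w :- x) refl (seq x k) (seq w k)) >>= λ
  (s , 0<s , small) → return (s , 0<s , λ t 0<t t≤s →
    ≤ᵣ-by₁ {t · (w +ᵣ (- 1ℚ) · x)} {x +ᵣ (- 1ℚ) · fromℤ ℓ} {fromℤ ℓ} {(1ℚ + t) · x +ᵣ (- t) · w} (small t 0<t t≤s)
      λ k → solve 4 (λ x w l t → l :- ((con 1ℚ :+ t) :* x :+ (:- t) :* w) :=
        t :* (w :+ (:- con 1ℚ) :* x) :- (x :+ (:- con 1ℚ) :* l)) refl (seq x k) (seq w k) (ι ℓ) t)

prolong-box : ∀ (ℓ u : Vector ℤ n) (x w : Vector ℝ n) → (∀ j → x j ↝ w j) → Box ℓ u x →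
  ¬ ¬ ∃ λ s → 0ℚ < s × Box ℓ u (lincomb (1ℚ + s) x (- s) w)
prolong-box {n} ℓ u x w x↝w box =
  ¬¬-all n (λ j → prolong-≥ (x j) (w j) (ℓ j) (x↝w j) (proj₁ (box j)) >>= λ lower →
                  prolong-≤ (x j) (w j) (u j) (x↝w j) (proj₂ (box j)) >>= λ upper →
                  return (small-× {λ s → fromℤ (ℓ j) ≤ᵣ (1ℚ + s) · x j +ᵣ (- s) · w j}
                                  {λ s → (1ℚ + s) · x j +ᵣ (- s) · w j ≤ᵣ fromℤ (u j)} lower upper)) >>= λ smalls →
  return (choose (small-all n
    {λ j s → fromℤ (ℓ j) ≤ᵣ (1ℚ + s) · x j +ᵣ (- s) · w j × (1ℚ + s) · x j +ᵣ (- s) · w j ≤ᵣ fromℤ (u j)} smalls))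
  where
  choose : Small (λ s → ∀ j →
      fromℤ (ℓ j) ≤ᵣ (1ℚ + s) · x j +ᵣ (- s) · w j × (1ℚ + s) · x j +ᵣ (- s) · w j ≤ᵣ fromℤ (u j)) →
    ∃ λ s → 0ℚ < s × Box ℓ u (lincomb (1ℚ + s) x (- s) w)
  choose (s , 0<s , inside) = s , 0<s , inside s 0<s ℚ.≤-refl

-- Finite search for an integer point in a face

interval? : {P : ℤ → Set} → (∀ c → Dec (P c)) → ∀ ℓ u → Dec (∃ λ c → (ℓ ℤ.≤ c × c ℤ.≤ u) × P c)
interval? {P} P? ℓ u = map′
  (λ (k , inside) → ℓ ℤ.+ ℤ.+ toℕ k , inside)
  (λ (c , (ℓ≤c , c≤u) , Pc) → index c ℓ≤c c≤u , subst (λ c → (ℓ ℤ.≤ c × c ℤ.≤ u) × P c)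
    (sym (trans (cong (λ k → ℓ ℤ.+ ℤ.+ k) (Fin.toℕ-fromℕ< (bound c ℓ≤c c≤u))) (i+∣j-i∣≡j ℓ≤c)))
    ((ℓ≤c , c≤u) , Pc))
  (any? λ k → (ℓ ℤ.≤? ℓ ℤ.+ ℤ.+ toℕ k ×-dec ℓ ℤ.+ ℤ.+ toℕ k ℤ.≤? u) ×-dec P? (ℓ ℤ.+ ℤ.+ toℕ k))
  where
  bound : ∀ c → ℓ ℤ.≤ c → c ℤ.≤ u → ℤ.∣ c ℤ.- ℓ ∣ ℕ.< suc ℤ.∣ u ℤ.- ℓ ∣
  bound c ℓ≤c c≤u = ℕ.s≤s (ℤ.drop‿+≤+ (subst₂ ℤ._≤_
    (sym (ℤ.0≤i⇒+∣i∣≡i (ℤ.i≤j⇒0≤j-i ℓ≤c)))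
    (sym (ℤ.0≤i⇒+∣i∣≡i (ℤ.i≤j⇒0≤j-i (ℤ.≤-trans ℓ≤c c≤u))))
    (ℤ.+-monoˡ-≤ (ℤ.- ℓ) c≤u)))
  index : ∀ c → ℓ ℤ.≤ c → c ℤ.≤ u → Fin (suc ℤ.∣ u ℤ.- ℓ ∣)
  index c ℓ≤c c≤u = fromℕ< (bound c ℓ≤c c≤u)

box? : ∀ n (ℓ u : Vector ℤ n) {P : Vector ℤ n → Set} → (∀ {v w} → v ≗ w → P v → P w) →
  (∀ w → Dec (P w)) → Dec (∃ λ w → (∀ j → ℓ j ℤ.≤ w j × w j ℤ.≤ u j) × P w)
box? zero ℓ u respects P? = map′
  (λ P[] → [] , (λ ()) , P[])
  (λ (w , _ , Pw) → respects {w} {[]} (λ ()) Pw)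
  (P? [])
box? (suc n) ℓ u {P} respects P? = map′
  (λ (c , inside , w , insides , Pw) → (c ∷ w) , (λ { zero → inside ; (suc j) → insides j }) , Pw)
  (λ (w , insides , Pw) → w zero , insides zero , tail w , (λ j → insides (suc j)) ,
    respects {w} {w zero ∷ tail w} (λ { zero → refl ; (suc j) → refl }) Pw)
  (interval? (λ c → box? n (tail ℓ) (tail u) {λ w → P (c ∷ w)}
    (λ v≗w → respects λ { zero → refl ; (suc j) → v≗w j }) (λ w → P? (c ∷ w))) (ℓ zero) (u zero))

module _ (A : Matrix ℚ r n) (equi : Equimodular A) (b : Vector ℚ r)
  (z : Vector ℤ n) (Az≡b : A ✶ᵥ (λ j → ι (z j)) ≗ b) (ℓ u : Vector ℤ n) where

  face-contains-integer : ∀ F → IsFace (affineSpace A b ∩ Box ℓ u) F →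
    ¬ ¬ ∃ λ (w : Vector ℤ n) → F (λ j → fromℤ (w j))
  face-contains-integer F face@((x , Fx) , _ , _ , _ , _ , _ , F⊆ , _) =
    contains (proj₁ (proj₁ (F⊆ {x} Fx))) (proj₂ (proj₁ (F⊆ {x} Fx)))
    where
    contains : affineSpace A b x → Box ℓ u x → ¬ ¬ ∃ λ (w : Vector ℤ n) → F (λ j → fromℤ (w j))
    contains Ax≈b box = Rounding.round A equi b z Az≡b x Ax≈b >>= λ (w , Aw≈b , x↝w) →
      prolong-box ℓ u x (λ j → fromℤ (w j)) x↝w box >>= λ (s , 0<s , prolonged) →
      return (w , face-absorbs face {x} {λ j → fromℤ (w j)} {s} 0<s Fx
        (Aw≈b , λ j → ≥-preserved (x↝w j) (ℓ j) (proj₁ (box j)) , ≤-preserved (x↝w j) (u j) (proj₂ (box j)))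
        (affine-combination A b (1ℚ + s) (- s) x (λ j → fromℤ (w j))
          (solve 1 (λ s → (con 1ℚ :+ s) :+ (:- s) := con 1ℚ) refl s) Ax≈b Aw≈b , prolonged))

  -- Membership of an integer point of the box in a face is decidable, so the
  -- double negation can be removed by a finite search.
  equimodular⇒box-face-integer : ∀ F → IsFace (affineSpace A b ∩ Box ℓ u) F →
    ∃ λ (w : Vector ℤ n) → F (λ j → fromℤ (w j))
  equimodular⇒box-face-integer F face@(_ , m , M , d , I , _ , F⊆ , ⊆F) =
    found (decidable-stable (box? n ℓ u {InFace} respects inFace?) (λ none →
      face-contains-integer F face λ (w , Fw) → none (w , rational w (F⊆ {λ j → fromℤ (w j)} Fw))))
    where
    -- The affine equations and the box imply all inequalities of `M`, so inside the searched box
    -- membership comes down to rational equations, which are decidable.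
    InFace : Vector ℤ n → Set
    InFace w = (∀ i → (A ✶ᵥ (λ j → ι (w j))) i ≡ b i) ×
               (∀ i → i ∈ₛ I → (M ✶ᵥ (λ j → ι (w j))) i ≡ d i)
    respects : ∀ {v w} → v ≗ w → InFace v → InFace w
    respects v≗w (Av≡b , Mv≡d) =
      (λ i → trans (sum-cong-≗ λ j → cong (λ c → A i j * ι c) (sym (v≗w j))) (Av≡b i)) ,
      (λ i i∈I → trans (sum-cong-≗ λ j → cong (λ c → M i j * ι c) (sym (v≗w j))) (Mv≡d i i∈I))
    inFace? : ∀ w → Dec (InFace w)
    inFace? w =
      Fin.all? (λ i → (A ✶ᵥ (λ j → ι (w j))) i ℚ.≟ b i) ×-dec
      Fin.all? (λ i → (i ∈? I) →-dec ((M ✶ᵥ (λ j → ι (w j))) i ℚ.≟ d i))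
    rational : ∀ w →
      (affineSpace A b ∩ Box ℓ u) (λ j → fromℤ (w j)) ×
        (∀ i → i ∈ₛ I → (M *ᵥ (λ j → fromℤ (w j))) i ≈ fromℚ (d i)) →
      (∀ j → ℓ j ℤ.≤ w j × w j ℤ.≤ u j) × InFace w
    rational w ((Aw≈b , box) , tight) =
      (λ j → fromℤ-cancel {ℓ j} {w j} (proj₁ (box j)) , fromℤ-cancel {w j} {u j} (proj₂ (box j))) ,
      (λ i → constant-row⁻ A (λ j → fromℤ (w j)) (λ j → ι (w j)) (λ _ _ → refl) i (b i) (Aw≈b i)) ,
      (λ i i∈I → constant-row⁻ M (λ j → fromℤ (w j)) (λ j → ι (w j)) (λ _ _ → refl) i (d i) (tight i i∈I))
    found : (∃ λ w → (∀ j → ℓ j ℤ.≤ w j × w j ℤ.≤ u j) × InFace w) →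
      ∃ λ (w : Vector ℤ n) → F (λ j → fromℤ (w j))
    found (w , inside , Aw≡b , Mw≡d) = w , ⊆F {λ j → fromℤ (w j)}
      (((λ i → constant-row A (λ j → fromℤ (w j)) (λ j → ι (w j)) (λ _ _ → refl) i (b i) (Aw≡b i)) ,
        (λ j → fromℤ-mono {ℓ j} {w j} (proj₁ (inside j)) , fromℤ-mono {w j} {u j} (proj₂ (inside j)))) ,
       (λ i i∈I → constant-row M (λ j → fromℤ (w j)) (λ j → ι (w j)) (λ _ _ → refl) i (d i) (Mw≡d i i∈I)))

-- The equivalence

equimodular⇒box-integer : (A : Matrix ℚ r n) → Equimodular A → ∀ b (z : Vector ℤ n) →
  A ✶ᵥ (λ j → ι (z j)) ≗ b → BoxInteger (affineSpace A b)
equimodular⇒box-integer A equi b z Az≡b ℓ u =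
  ∩-isPolyhedron (affine-isPolyhedron A b) (box-isPolyhedron ℓ u) ,
  equimodular⇒box-face-integer A equi b z Az≡b ℓ u

equimodular⇒principally-box-integer : (A : Matrix ℚ r n) → Equimodular A →
  ∀ b → PrincipallyBoxInteger (affineSpace A b)
equimodular⇒principally-box-integer {r} {n} A equi b k 0<k int =
  -- Integrality of the dilated space yields an integral point only once the space is known to be
  -- nonempty; full row rank supplies a rational point.
  boxInteger-resp P≐D (integral-solution (full-rank-solvable A (proj₁ equi) (λ i → (ℤ.+ k / 1) * b i)))
  where
  D≐P : dilate k (affineSpace A b) ≐ affineSpace A (λ i → (ℤ.+ k / 1) * b i)
  D≐P = dilate-affine A b k 0<k
  P≐D : affineSpace A (λ i → (ℤ.+ k / 1) * b i) ≐ dilate k (affineSpace A b)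
  P≐D = (λ {x} → proj₂ D≐P {x}) , (λ {x} → proj₁ D≐P {x})
  box : (∃ λ (z : Vector ℤ n) → affineSpace A (λ i → (ℤ.+ k / 1) * b i) (λ j → fromℤ (z j))) →
    BoxInteger (affineSpace A (λ i → (ℤ.+ k / 1) * b i))
  box (z , Az≈kb) = equimodular⇒box-integer A equi (λ i → (ℤ.+ k / 1) * b i) z
    (constant-affine⁻ A (λ i → (ℤ.+ k / 1) * b i) (λ j → fromℤ (z j)) (λ j → ι (z j)) (λ _ _ → refl) Az≈kb)
  integral-solution : (∃ λ x → A ✶ᵥ x ≗ (λ i → (ℤ.+ k / 1) * b i)) →
    BoxInteger (affineSpace A (λ i → (ℤ.+ k / 1) * b i))
  integral-solution (x , Ax≡kb) = box (integer-point (isInteger-resp D≐P int)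
    ((λ j → fromℚ (x j)) ,
     constant-affine A (λ i → (ℤ.+ k / 1) * b i) (λ j → fromℚ (x j)) x (λ _ _ → refl) Ax≡kb))

theorem4p3 : (r n : ℕ) (A : Matrix ℚ r n) → FullRowRank A →
    Equimodular A ⇔ ((b : Vector ℚ r) → PrincipallyBoxInteger (affineSpace A b))
theorem4p3 r n A rank = mk⇔
  (equimodular⇒principally-box-integer A)
  (principally-box-integer⇒equimodular A rank)
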